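{- Let $p(x)\in\mathbb{Z}[x]$ be a polynomial with even degree, with simple roots belonging to the set $\left\{\ldots,-3,-2,-1,\tfrac12,\tfrac32,\tfrac52,\ldots\right\}$, and such that $p(x)=p\left(-\tfrac12-x\right)$. Then $$ \sum_{n\geq 0}(-1)^n\frac{4n+1}{p(n)}\left[\frac{1}{4^n}\binom{2n}{n}\right]^3 $$ is a rational multiple of $\frac{1}{\pi}$, and $$ \sum_{n\geq 0}\frac{4n+1}{p(n)^2}\left[\frac{1}{4^n}\binom{2n}{n}\right]^4,\qquad \sum_{n\geq 0}\frac{4n+1}{p(n)}\left[\frac{1}{4^n}\binom{2n}{n}\right]^4 $$ are rational multiples of $\frac{1}{\pi^2}$.
   Context: The set of admissible roots consists of all negative integers together with all positive half-integers $\tfrac12,\tfrac32,\tfrac52,\ldots$. A rational multiple of a real number $c$ means a number of the form $qc$ with $q\in\mathbb{Q}$.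
   Formalization: For the two fourth-power series the polynomial p is assumed to have positive degree, since for a nonzero constant p (even degree 0, no roots) both of these series diverge; the first series is covered for constants too. -}

module Defs where

open import Algebra.Definitions.RawSemiring using (_^_)
open import Data.Empty using (⊥-elim)
open import Data.Integer.Base as ℤ using (ℤ; +_; -[1+_])
open import Data.Integer.GCD using (gcd)
import Data.Integer.Properties as ℤₚ
open import Data.List.Base using (List; []; _∷_; foldr; map)
open import Data.List.Relation.Unary.All using (All; []; _∷_)
open import Data.List.Relation.Unary.Unique.Propositional using (Unique)
open import Data.Nat.Base as ℕ using (ℕ; zero; suc; z≤n; s≤s)
open import Data.Nat.Combinatorics using (_C_)
import Data.Nat.Properties as ℕₚ
open import Data.Product.Base using (Σ-syntax; ∃-syntax; _×_; _,_; proj₁; proj₂)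
open import Data.Rational
open import Data.Rational.Properties
open import Data.Rational.Solver using (module +-*-Solver)
import Data.Rational.Unnormalised as ℚᵘ
import Data.Rational.Unnormalised.Properties as ℚᵘₚ
open import Data.Sum.Base using (_⊎_; inj₁; inj₂)
open import Relation.Binary.PropositionalEquality
  using (_≡_; _≢_; refl; sym; trans; cong; cong₂; subst)
open import Relation.Nullary using (yes; no)
open import Relation.Nullary.Decidable using (from-yes)

infixr 8 _^ℚ_
_^ℚ_ : ℚ → ℕ → ℚ
_^ℚ_ = _^_ +-*-rawSemiring

ℤ→ℚ : ℤ → ℚ
ℤ→ℚ i = i / 1

ℕ→ℚ : ℕ → ℚ
ℕ→ℚ n = ℤ→ℚ (+ n)

x*y≢0 : ∀ {x y} → x ≢ 0ℚ → y ≢ 0ℚ → x * y ≢ 0ℚ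
x*y≢0 {x} {y} x≢0 y≢0 xy≡0 = y≢0 (begin
    y               ≡⟨ sym (*-identityˡ y) ⟩
    1ℚ * y          ≡⟨ cong (_* y) (sym (*-inverseˡ x)) ⟩
    1/ x * x * y    ≡⟨ *-assoc (1/ x) x y ⟩
    1/ x * (x * y)  ≡⟨ cong (1/ x *_) xy≡0 ⟩
    1/ x * 0ℚ       ≡⟨ *-zeroʳ (1/ x) ⟩
    0ℚ              ∎)
  where
  open Relation.Binary.PropositionalEquality.≡-Reasoning
  instance
    nz : NonZero x
    nz = ≢-nonZero x≢0

x-y≡0⇒x≡y : ∀ x y → x - y ≡ 0ℚ → x ≡ y
x-y≡0⇒x≡y x y eq = trans
  (solve 2 (λ a b → a := (a :- b) :+ b) refl x y)
  (trans (cong (_+ y) eq) (+-identityˡ y))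
  where open +-*-Solver

ℤ→ℚ-≢0 : ∀ {i} → i ≢ + 0 → ℤ→ℚ i ≢ 0ℚ
ℤ→ℚ-≢0 {i} i≢0 eq =
  i≢0 (trans (sym (↥-/ i 1)) (cong (λ q → ↥ q ℤ.* gcd i (+ 1)) eq))

*-mono-≤-nonNeg : ∀ {a b c d} → 0ℚ ≤ b → 0ℚ ≤ c → a ≤ b → c ≤ d → a * c ≤ b * d
*-mono-≤-nonNeg {a} {b} {c} {d} 0≤b 0≤c a≤b c≤d = ≤-trans
  (*-monoʳ-≤-nonNeg c {{nonNegative 0≤c}} a≤b)
  (*-monoˡ-≤-nonNeg b {{nonNegative 0≤b}} c≤d)

0<x*y : ∀ {x y} → 0ℚ < x → 0ℚ < y → 0ℚ < x * y
0<x*y {x} {y} 0<x 0<y =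
  positive⁻¹ (x * y) {{pos*pos⇒pos x {{positive 0<x}} y {{positive 0<y}}}}

∣x-y∣≡∣y-x∣ : ∀ x y → ∣ x - y ∣ ≡ ∣ y - x ∣
∣x-y∣≡∣y-x∣ x y = trans (sym (∣-p∣≡∣p∣ (x - y)))
  (cong ∣_∣ (solve 2 (λ a b → :- (a :- b) := b :- a) refl x y))
  where open +-*-Solver

x≤∣x∣ : ∀ x → x ≤ ∣ x ∣
x≤∣x∣ x with ≤-total 0ℚ x
... | inj₁ 0≤x = ≤-reflexive (sym (0≤p⇒∣p∣≡p 0≤x))
... | inj₂ x≤0 = ≤-trans x≤0 (0≤∣p∣ x)

∣x∣-bound : ∀ x y → ∣ x ∣ ≤ ∣ y ∣ + ∣ x - y ∣
∣x∣-bound x y = subst (λ z → ∣ z ∣ ≤ ∣ y ∣ + ∣ x - y ∣)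
  (solve 2 (λ a b → b :+ (a :- b) := a) refl x y)
  (∣p+q∣≤∣p∣+∣q∣ y (x - y))
  where open +-*-Solver

private
  open +-*-Solver

  ring₁ : ∀ a b c d → a * b - c * d ≡ a * (b - d) + d * (a - c)
  ring₁ = solve 4 (λ a b c d → a :* b :- c :* d := a :* (b :- d) :+ d :* (a :- c)) refl

  ring₂ : ∀ a b e i → a * (e * i) + b * (e * i) ≡ e * (i * (a + b))
  ring₂ = solve 4 (λ a b e i → a :* (e :* i) :+ b :* (e :* i) := e :* (i :* (a :+ b))) refl

  ring₃ : ∀ e d i j → e * (d * d) * (i * j) ≡ e * ((d * i) * (d * j))
  ring₃ = solve 4 (λ e d i j → e :* (d :* d) :* (i :* j) := e :* ((d :* i) :* (d :* j))) refl

  ring₄ : ∀ a b u v → u * (b * v) - v * (a * u) ≡ (b - a) * (u * v)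
  ring₄ = solve 4 (λ a b u v → u :* (b :* v) :- v :* (a :* u) := (b :- a) :* (u :* v)) refl

  ring₅ : ∀ x y → x ≡ x + y * 0ℚ
  ring₅ = solve 2 (λ x y → x := x :+ y :* con 0ℚ) refl

  ring₆ : ∀ S s a t → S + s * a + (- 1ℚ * s) * t ≡ S + s * (a - t)
  ring₆ = solve 4 (λ S s a t → S :+ s :* a :+ (:- con 1ℚ :* s) :* t := S :+ s :* (a :- t)) refl

  ring₇ : ∀ x y → x + y - x ≡ y
  ring₇ = solve 2 (λ x y → x :+ y :- x := y) refl

  ring₈ : ∀ x y z → x - y ≡ (x - z) + (z - y)
  ring₈ = solve 3 (λ x y z → x :- y := (x :- z) :+ (z :- y)) refl

  ring₉ : ∀ e → ½ * e + ½ * e ≡ e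
  ring₉ = solve 1 (λ e → con ½ :* e :+ con ½ :* e := e) refl

-- A real number is a Cauchy sequence of rationals; equality of reals is _≈ℝ_.

IsCauchy : (ℕ → ℚ) → Set
IsCauchy s = ∀ ε → 0ℚ < ε → ∃[ N ] ∀ m n → N ℕ.≤ m → N ℕ.≤ n → ∣ s m - s n ∣ ≤ ε

record ℝ : Set where
  constructor mkℝ
  field
    seq    : ℕ → ℚ
    cauchy : IsCauchy seq

open ℝ public

infix 4 _≈ℝ_
_≈ℝ_ : ℝ → ℝ → Set
x ≈ℝ y = ∀ ε → 0ℚ < ε → ∃[ N ] ∀ n → N ℕ.≤ n → ∣ seq x n - seq y n ∣ ≤ ε

fromℚ : ℚ → ℝ
fromℚ q = mkℝ (λ _ → q) λ ε 0<ε → 0 , λ _ _ _ _ →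
  subst (_≤ ε) (cong ∣_∣ (sym (+-inverseʳ q))) (<⇒≤ 0<ε)

Bound : (ℕ → ℚ) → Set
Bound s = ∃[ B ] (0ℚ < B × ∃[ N ] ∀ n → N ℕ.≤ n → ∣ s n ∣ ≤ B)

cauchy-bound : ∀ s → IsCauchy s → Bound s
cauchy-bound s c = ∣ s N ∣ + 1ℚ
  , positive⁻¹ (∣ s N ∣ + 1ℚ) {{nonNeg+pos⇒pos (∣ s N ∣) {{∣-∣-nonNeg (s N)}} 1ℚ}}
  , N
  , λ n N≤n → ≤-trans (∣x∣-bound (s n) (s N))
                      (+-monoʳ-≤ (∣ s N ∣) (proj₂ (c 1ℚ 0<1) n N N≤n ℕₚ.≤-refl))
  where
  0<1 = positive⁻¹ 1ℚ
  N = proj₁ (c 1ℚ 0<1)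

shrink : ∀ {A B ε} → 0ℚ < A → 0ℚ < B → 0ℚ < ε →
         ∃[ ε′ ] (0ℚ < ε′ × A * ε′ + B * ε′ ≡ ε)
shrink {A} {B} {ε} 0<A 0<B 0<ε = ε * c , 0<x*y 0<ε 0<c , eq
  where
  open Relation.Binary.PropositionalEquality.≡-Reasoning
  A+B>0 : Positive (A + B)
  A+B>0 = pos+pos⇒pos A {{positive 0<A}} B {{positive 0<B}}
  A+B≢0 : NonZero (A + B)
  A+B≢0 = pos⇒nonZero (A + B) {{A+B>0}}
  c = (1/ (A + B)) {{A+B≢0}}
  0<c : 0ℚ < c
  0<c = positive⁻¹ c {{1/pos⇒pos (A + B) {{A+B>0}}}}
  eq : A * (ε * c) + B * (ε * c) ≡ ε
  eq = begin
    A * (ε * c) + B * (ε * c)  ≡⟨ ring₂ A B ε c ⟩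
    ε * (c * (A + B))          ≡⟨ cong (ε *_) (*-inverseˡ (A + B) {{A+B≢0}}) ⟩
    ε * 1ℚ                     ≡⟨ *-identityʳ ε ⟩
    ε                          ∎

product-estimate : ∀ a b c d {A B e} → 0ℚ ≤ A → 0ℚ ≤ B →
                   ∣ a ∣ ≤ A → ∣ d ∣ ≤ B → ∣ b - d ∣ ≤ e → ∣ a - c ∣ ≤ e →
                   ∣ a * b - c * d ∣ ≤ A * e + B * e
product-estimate a b c d {A} {B} {e} 0≤A 0≤B a≤A d≤B b-d≤e a-c≤e = begin
  ∣ a * b - c * d ∣                          ≡⟨ cong ∣_∣ (ring₁ a b c d) ⟩
  ∣ a * (b - d) + d * (a - c) ∣              ≤⟨ ∣p+q∣≤∣p∣+∣q∣ (a * (b - d)) (d * (a - c)) ⟩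
  ∣ a * (b - d) ∣ + ∣ d * (a - c) ∣          ≡⟨ cong₂ _+_ (∣p*q∣≡∣p∣*∣q∣ a (b - d))
                                                          (∣p*q∣≡∣p∣*∣q∣ d (a - c)) ⟩
  ∣ a ∣ * ∣ b - d ∣ + ∣ d ∣ * ∣ a - c ∣      ≤⟨ +-mono-≤
      (*-mono-≤-nonNeg 0≤A (0≤∣p∣ (b - d)) a≤A b-d≤e)
      (*-mono-≤-nonNeg 0≤B (0≤∣p∣ (a - c)) d≤B a-c≤e) ⟩
  A * e + B * e                              ∎
  where open ≤-Reasoning

*-cauchy′ : ∀ s t → IsCauchy s → IsCauchy t → Bound s → Bound t → IsCauchy (λ n → s n * t n)
*-cauchy′ s t cs ct (A , 0<A , M , ≤A) (B , 0<B , M′ , ≤B) ε 0<ε = N , near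
  where
  shrunk = shrink 0<A 0<B 0<ε
  ε′ = proj₁ shrunk
  0<ε′ = proj₁ (proj₂ shrunk)
  ε′≡ = proj₂ (proj₂ shrunk)
  K = proj₁ (cs ε′ 0<ε′)
  L = proj₁ (ct ε′ 0<ε′)
  N = (M ℕ.⊔ M′) ℕ.⊔ (K ℕ.⊔ L)
  N₁ : ∀ {n} → N ℕ.≤ n → M ℕ.≤ n
  N₁ h = ℕₚ.m⊔n≤o⇒m≤o M M′ (ℕₚ.m⊔n≤o⇒m≤o _ _ h)
  N₂ : ∀ {n} → N ℕ.≤ n → M′ ℕ.≤ n
  N₂ h = ℕₚ.m⊔n≤o⇒n≤o M M′ (ℕₚ.m⊔n≤o⇒m≤o _ _ h)
  N₃ : ∀ {n} → N ℕ.≤ n → K ℕ.≤ n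
  N₃ h = ℕₚ.m⊔n≤o⇒m≤o K L (ℕₚ.m⊔n≤o⇒n≤o (M ℕ.⊔ M′) _ h)
  N₄ : ∀ {n} → N ℕ.≤ n → L ℕ.≤ n
  N₄ h = ℕₚ.m⊔n≤o⇒n≤o K L (ℕₚ.m⊔n≤o⇒n≤o (M ℕ.⊔ M′) _ h)
  near : ∀ m n → N ℕ.≤ m → N ℕ.≤ n → ∣ s m * t m - s n * t n ∣ ≤ ε
  near m n N≤m N≤n = subst (∣ s m * t m - s n * t n ∣ ≤_) ε′≡
    (product-estimate (s m) (t m) (s n) (t n) {A} {B} {ε′} (<⇒≤ 0<A) (<⇒≤ 0<B)
      (≤A m (N₁ N≤m)) (≤B n (N₂ N≤n))
      (proj₂ (ct ε′ 0<ε′) m n (N₄ N≤m) (N₄ N≤n))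
      (proj₂ (cs ε′ 0<ε′) m n (N₃ N≤m) (N₃ N≤n)))

*-cauchy : ∀ s t → IsCauchy s → IsCauchy t → IsCauchy (λ n → s n * t n)
*-cauchy s t cs ct = *-cauchy′ s t cs ct (cauchy-bound s cs) (cauchy-bound t ct)

infixl 7 _*ℝ_
_*ℝ_ : ℝ → ℝ → ℝ
mkℝ s cs *ℝ mkℝ t ct = mkℝ (λ n → s n * t n) (*-cauchy s t cs ct)

Apart₀ : ℝ → Set
Apart₀ x = ∃[ δ ] (0ℚ < δ × ∃[ N ] ∀ n → N ℕ.≤ n → δ ≤ ∣ seq x n ∣)

-- The value at 0 is immaterial: a real apart from 0 has only finitely many
-- zero approximants.
recip : ℚ → ℚ
recip q with q ≟ 0ℚ
... | yes _   = 0ℚ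
... | no  q≢0 = (1/ q) {{≢-nonZero q≢0}}

recip-inverse : ∀ {q} → q ≢ 0ℚ → q * recip q ≡ 1ℚ
recip-inverse {q} q≢0 with q ≟ 0ℚ
... | yes q≡0 = ⊥-elim (q≢0 q≡0)
... | no  q≢0 = *-inverseʳ q {{≢-nonZero q≢0}}

δ≤∣q∣⇒q≢0 : ∀ {δ q} → 0ℚ < δ → δ ≤ ∣ q ∣ → q ≢ 0ℚ
δ≤∣q∣⇒q≢0 0<δ δ≤ refl = <-irrefl refl (<-≤-trans 0<δ δ≤)

δ∣recip∣≤1 : ∀ {δ q} → 0ℚ < δ → δ ≤ ∣ q ∣ → δ * ∣ recip q ∣ ≤ 1ℚ
δ∣recip∣≤1 {δ} {q} 0<δ δ≤ = begin
  δ * ∣ recip q ∣      ≤⟨ *-monoʳ-≤-nonNeg ∣ recip q ∣ {{∣-∣-nonNeg (recip q)}} δ≤ ⟩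
  ∣ q ∣ * ∣ recip q ∣  ≡⟨ sym (∣p*q∣≡∣p∣*∣q∣ q (recip q)) ⟩
  ∣ q * recip q ∣      ≡⟨ cong ∣_∣ (recip-inverse (δ≤∣q∣⇒q≢0 0<δ δ≤)) ⟩
  1ℚ                   ∎
  where open ≤-Reasoning

recip-cauchy : ∀ x → Apart₀ x → IsCauchy (λ n → recip (seq x n))
recip-cauchy (mkℝ s cs) (δ , 0<δ , M , δ≤) ε 0<ε = M ℕ.⊔ K , near
  where
  0<ε′ : 0ℚ < ε * (δ * δ)
  0<ε′ = 0<x*y 0<ε (0<x*y 0<δ 0<δ)
  K = proj₁ (cs (ε * (δ * δ)) 0<ε′)
  near : ∀ m n → M ℕ.⊔ K ℕ.≤ m → M ℕ.⊔ K ℕ.≤ n → ∣ recip (s m) - recip (s n) ∣ ≤ ε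
  near m n N≤m N≤n = begin
    ∣ u - v ∣
      ≡⟨ cong ∣_∣ diff ⟩
    ∣ (b - a) * (u * v) ∣
      ≡⟨ trans (∣p*q∣≡∣p∣*∣q∣ (b - a) (u * v)) (cong (λ x → ∣ b - a ∣ * x) (∣p*q∣≡∣p∣*∣q∣ u v)) ⟩
    ∣ b - a ∣ * (∣ u ∣ * ∣ v ∣)
      ≤⟨ *-monoʳ-≤-nonNeg (∣ u ∣ * ∣ v ∣)
           {{nonNeg*nonNeg⇒nonNeg (∣ u ∣) {{∣-∣-nonNeg u}} (∣ v ∣) {{∣-∣-nonNeg v}}}}
           (proj₂ (cs (ε * (δ * δ)) 0<ε′) n m
             (ℕₚ.m⊔n≤o⇒n≤o M K N≤n) (ℕₚ.m⊔n≤o⇒n≤o M K N≤m)) ⟩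
    ε * (δ * δ) * (∣ u ∣ * ∣ v ∣)
      ≡⟨ ring₃ ε δ (∣ u ∣) (∣ v ∣) ⟩
    ε * ((δ * ∣ u ∣) * (δ * ∣ v ∣))
      ≤⟨ *-monoˡ-≤-nonNeg ε {{nonNegative (<⇒≤ 0<ε)}}
           (*-mono-≤-nonNeg {δ * ∣ u ∣} {1ℚ} {δ * ∣ v ∣} {1ℚ} (<⇒≤ (positive⁻¹ 1ℚ))
             (nonNegative⁻¹ _ {{nonNeg*nonNeg⇒nonNeg δ {{nonNegative (<⇒≤ 0<δ)}}
                                                     (∣ v ∣) {{∣-∣-nonNeg v}}}})
             (δ∣recip∣≤1 0<δ δ≤a) (δ∣recip∣≤1 0<δ δ≤b)) ⟩
    ε * (1ℚ * 1ℚ)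
      ≡⟨ *-identityʳ ε ⟩
    ε ∎
    where
    open ≤-Reasoning
    a = s m
    b = s n
    u = recip a
    v = recip b
    δ≤a = δ≤ m (ℕₚ.m⊔n≤o⇒m≤o M K N≤m)
    δ≤b = δ≤ n (ℕₚ.m⊔n≤o⇒m≤o M K N≤n)
    diff : u - v ≡ (b - a) * (u * v)
    diff = begin-equality
      u - v
        ≡⟨ cong₂ _-_ (sym (*-identityʳ u)) (sym (*-identityʳ v)) ⟩
      u * 1ℚ - v * 1ℚ
        ≡⟨ cong₂ (λ x y → u * x - v * y)
             (sym (recip-inverse (δ≤∣q∣⇒q≢0 0<δ δ≤b)))
             (sym (recip-inverse (δ≤∣q∣⇒q≢0 0<δ δ≤a))) ⟩
      u * (b * v) - v * (a * u)
        ≡⟨ ring₄ a b u v ⟩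
      (b - a) * (u * v) ∎

inverse : (x : ℝ) → Apart₀ x → ℝ
inverse x x#0 = mkℝ (λ n → recip (seq x n)) (recip-cauchy x x#0)

partialSum : (ℕ → ℚ) → ℕ → ℚ
partialSum a zero    = 0ℚ
partialSum a (suc n) = partialSum a n + a n

Convergent : (ℕ → ℚ) → Set
Convergent a = IsCauchy (partialSum a)

series : (a : ℕ → ℚ) → Convergent a → ℝ
series a conv = mkℝ (partialSum a) conv

IsRationalMultipleOf : ℝ → ℝ → Set
IsRationalMultipleOf x c = ∃[ q ] x ≈ℝ fromℚ q *ℝ c

SumIsRationalMultipleOf : (ℕ → ℚ) → ℝ → Set
SumIsRationalMultipleOf a c =
  Σ[ conv ∈ Convergent a ] IsRationalMultipleOf (series a conv) c

-- π, defined as 4 arctan 1 = 4 (1 - 1/3 + 1/5 - …)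

oddRecip : ℕ → ℚ
oddRecip n = + 1 / suc (2 ℕ.* n)

leibnizTerm : ℕ → ℚ
leibnizTerm n = (- 1ℚ) ^ℚ n * oddRecip n

1/-antimono : ∀ {m n} → m ℕ.≤ n → + 1 / suc n ≤ + 1 / suc m
1/-antimono {m} {n} m≤n = toℚᵘ-cancel-≤
  (ℚᵘₚ.≤-respˡ-≃ (ℚᵘₚ.≃-sym (toℚᵘ-fromℚᵘ (ℚᵘ.mkℚᵘ (+ 1) n)))
  (ℚᵘₚ.≤-respʳ-≃ (ℚᵘₚ.≃-sym (toℚᵘ-fromℚᵘ (ℚᵘ.mkℚᵘ (+ 1) m)))
  (ℚᵘ.*≤* (ℤₚ.*-monoˡ-≤-nonNeg (+ 1) (ℤ.+≤+ (s≤s m≤n))))))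

0<1/ : ∀ n → 0ℚ < + 1 / suc n
0<1/ n = positive⁻¹ _ {{normalize-pos 1 (suc n)}}

oddRecip-archimedean : ∀ ε → 0ℚ < ε → ∃[ N ] oddRecip N ≤ ε
oddRecip-archimedean ε@(mkℚ (+ suc a) d _) 0<ε = d , ≤-trans
  (1/-antimono (ℕₚ.m≤m+n d _))
  (toℚᵘ-cancel-≤ (ℚᵘₚ.≤-respˡ-≃ (ℚᵘₚ.≃-sym (toℚᵘ-fromℚᵘ (ℚᵘ.mkℚᵘ (+ 1) d)))
    (ℚᵘ.*≤* (ℤₚ.*-monoʳ-≤-nonNeg (+ suc d) (ℤ.+≤+ (s≤s (z≤n {a})))))))
oddRecip-archimedean (mkℚ (+ 0) _ _) (*<* (ℤ.+<+ ()))
oddRecip-archimedean (mkℚ -[1+ _ ] _ _) (*<* ())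

-- a m - a (m + 1) + a (m + 2) - …, with k terms
alternating : (ℕ → ℚ) → ℕ → ℕ → ℚ
alternating a zero    m = 0ℚ
alternating a (suc k) m = a m - alternating a k (suc m)

alternating-bounds : ∀ k m → 0ℚ ≤ alternating oddRecip k m
                           × alternating oddRecip k m ≤ oddRecip m
alternating-bounds zero    m = ≤-refl , <⇒≤ (0<1/ (2 ℕ.* m))
alternating-bounds (suc k) m = 0≤a-t , a-t≤a
  where
  0≤t = proj₁ (alternating-bounds k (suc m))
  t≤a = proj₂ (alternating-bounds k (suc m))
  a = oddRecip m
  t = alternating oddRecip k (suc m)
  t≤a′ : t ≤ a
  t≤a′ = ≤-trans t≤a (1/-antimono (ℕₚ.*-monoʳ-≤ 2 (ℕₚ.n≤1+n m)))
  0≤a-t : 0ℚ ≤ a - t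
  0≤a-t = subst (_≤ a - t) (+-inverseʳ t) (+-monoˡ-≤ (- t) t≤a′)
  a-t≤a : a - t ≤ a
  a-t≤a = subst (a - t ≤_) (+-identityʳ a) (+-monoʳ-≤ a (neg-antimono-≤ 0≤t))

leibniz-tail : ∀ k m → partialSum leibnizTerm (k ℕ.+ m)
  ≡ partialSum leibnizTerm m + (- 1ℚ) ^ℚ m * alternating oddRecip k m
leibniz-tail zero    m = ring₅ (partialSum leibnizTerm m) ((- 1ℚ) ^ℚ m)
leibniz-tail (suc k) m = trans
  (cong (partialSum leibnizTerm) (sym (ℕₚ.+-suc k m)))
  (trans (leibniz-tail k (suc m))
  (ring₆ (partialSum leibnizTerm m) ((- 1ℚ) ^ℚ m) (oddRecip m) (alternating oddRecip k (suc m))))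

∣-1^n∣≡1 : ∀ n → ∣ (- 1ℚ) ^ℚ n ∣ ≡ 1ℚ
∣-1^n∣≡1 zero    = refl
∣-1^n∣≡1 (suc n) = trans (∣p*q∣≡∣p∣*∣q∣ (- 1ℚ) ((- 1ℚ) ^ℚ n))
                         (cong (1ℚ *_) (∣-1^n∣≡1 n))

leibniz-near : ∀ N n → N ℕ.≤ n →
  ∣ partialSum leibnizTerm n - partialSum leibnizTerm N ∣ ≤ oddRecip N
leibniz-near N n N≤n = begin
  ∣ S n - S N ∣                ≡⟨ cong (λ i → ∣ S i - S N ∣) (sym (ℕₚ.m∸n+n≡m N≤n)) ⟩
  ∣ S (k ℕ.+ N) - S N ∣        ≡⟨ cong (λ x → ∣ x - S N ∣) (leibniz-tail k N) ⟩
  ∣ S N + s * t - S N ∣        ≡⟨ cong ∣_∣ (ring₇ (S N) (s * t)) ⟩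
  ∣ s * t ∣                    ≡⟨ ∣p*q∣≡∣p∣*∣q∣ s t ⟩
  ∣ s ∣ * ∣ t ∣                ≡⟨ cong₂ _*_ (∣-1^n∣≡1 N) (0≤p⇒∣p∣≡p (proj₁ (alternating-bounds k N))) ⟩
  1ℚ * t                       ≡⟨ *-identityˡ t ⟩
  t                            ≤⟨ proj₂ (alternating-bounds k N) ⟩
  oddRecip N                   ∎
  where
  open ≤-Reasoning
  S = partialSum leibnizTerm
  k = n ℕ.∸ N
  s = (- 1ℚ) ^ℚ N
  t = alternating oddRecip k N

leibniz-convergent : Convergent leibnizTerm
leibniz-convergent ε 0<ε = N , near
  where
  archimedean = oddRecip-archimedean (½ * ε) (0<x*y (positive⁻¹ ½) 0<ε)
  N = proj₁ archimedean
  small = proj₂ archimedean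
  S = partialSum leibnizTerm
  near : ∀ m n → N ℕ.≤ m → N ℕ.≤ n → ∣ S m - S n ∣ ≤ ε
  near m n N≤m N≤n = begin
    ∣ S m - S n ∣
      ≡⟨ cong ∣_∣ (ring₈ (S m) (S n) (S N)) ⟩
    ∣ (S m - S N) + (S N - S n) ∣
      ≤⟨ ∣p+q∣≤∣p∣+∣q∣ (S m - S N) (S N - S n) ⟩
    ∣ S m - S N ∣ + ∣ S N - S n ∣
      ≡⟨ cong (λ x → ∣ S m - S N ∣ + x) (∣x-y∣≡∣y-x∣ (S N) (S n)) ⟩
    ∣ S m - S N ∣ + ∣ S n - S N ∣
      ≤⟨ +-mono-≤ {∣ S m - S N ∣} {½ * ε} {∣ S n - S N ∣} {½ * ε}
           (≤-trans (leibniz-near N m N≤m) small) (≤-trans (leibniz-near N n N≤n) small) ⟩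
    ½ * ε + ½ * ε
      ≡⟨ ring₉ ε ⟩
    ε ∎
    where
    open ≤-Reasoning

π : ℝ
π = fromℚ (ℕ→ℚ 4) *ℝ series leibnizTerm leibniz-convergent

π-apart₀ : Apart₀ π
π-apart₀ = 1ℚ , positive⁻¹ 1ℚ , 2 , λ n 2≤n →
  ≤-trans (bound n 2≤n) (x≤∣x∣ (ℕ→ℚ 4 * S n))
  where
  open ≤-Reasoning
  S = partialSum leibnizTerm
  bound : ∀ n → 2 ℕ.≤ n → 1ℚ ≤ ℕ→ℚ 4 * S n
  bound n 2≤n = begin
    1ℚ                     ≤⟨ from-yes (1ℚ ≤? ℕ→ℚ 4 * S 2) ⟩
    ℕ→ℚ 4 * S 2            ≤⟨ *-monoˡ-≤-nonNeg (ℕ→ℚ 4) S2≤Sn ⟩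
    ℕ→ℚ 4 * S n            ∎
    where
    t = alternating oddRecip (n ℕ.∸ 2) 2
    S2≤Sn : S 2 ≤ S n
    S2≤Sn = begin
      S 2                       ≡⟨ sym (+-identityʳ (S 2)) ⟩
      S 2 + 0ℚ                  ≤⟨ +-monoʳ-≤ (S 2) (proj₁ (alternating-bounds (n ℕ.∸ 2) 2)) ⟩
      S 2 + t                   ≡⟨ cong (λ x → S 2 + x) (sym (*-identityˡ t)) ⟩
      S 2 + 1ℚ * t              ≡⟨ sym (leibniz-tail (n ℕ.∸ 2) 2) ⟩
      S (n ℕ.∸ 2 ℕ.+ 2)         ≡⟨ cong S (ℕₚ.m∸n+n≡m 2≤n) ⟩
      S n                       ∎

1/π : ℝ
1/π = inverse π π-apart₀

1/π² : ℝ
1/π² = 1/π *ℝ 1/π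

-- Integer polynomials, as lists of coefficients with the constant term first

coefficient : List ℤ → ℕ → ℤ
coefficient []      _       = + 0
coefficient (a ∷ _) zero    = a
coefficient (_ ∷ p) (suc i) = coefficient p i

HasDegree : List ℤ → ℕ → Set
HasDegree p d = coefficient p d ≢ + 0 × (∀ i → d ℕ.< i → coefficient p i ≡ + 0)

eval : List ℤ → ℚ → ℚ
eval p x = foldr (λ a v → ℤ→ℚ a + x * v) 0ℚ p

-- p = lc · ∏ (X - r) over distinct r, so that the listed numbers are all the
-- complex roots of p, each of multiplicity one.  Equality of polynomials is
-- expressed by equality of values, ℚ being infinite.
record HasSimpleRootsIn (A : ℚ → Set) (p : List ℤ) (d : ℕ) : Set where
  field
    roots         : List ℚ
    roots-unique  : Unique roots
    roots-in      : All A roots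
    factorisation : ∀ x → eval p x
                        ≡ ℤ→ℚ (coefficient p d) * foldr _*_ 1ℚ (map (λ r → x - r) roots)

data Admissible : ℚ → Set where
  negativeInteger     : ∀ k → Admissible (-[1+ k ] / 1)
  positiveHalfInteger : ∀ k → Admissible (+ suc (2 ℕ.* k) / 2)

nonNeg≢-[1+] : ∀ n k → + n ℤ.* + 1 ≢ -[1+ k ] ℤ.* + 1
nonNeg≢-[1+] n k eq
  with trans (sym (ℤₚ.*-identityʳ (+ n))) (trans eq (ℤₚ.*-identityʳ -[1+ k ]))
... | ()

even≢odd : ∀ n k → + n ℤ.* + 2 ≢ + suc (2 ℕ.* k) ℤ.* + 1
even≢odd n k eq = ℕₚ.even≢odd n k (trans (ℕₚ.*-comm 2 n)
  (ℤₚ.+-injective (trans (ℤₚ.pos-* n 2) (trans eq (ℤₚ.*-identityʳ (+ suc (2 ℕ.* k)))))))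

n-admissible≢0 : ∀ n {r} → Admissible r → ℕ→ℚ n - r ≢ 0ℚ
n-admissible≢0 n (negativeInteger k) eq = nonNeg≢-[1+] n k (ℚᵘₚ.drop-*≡*
  (/-injective-≃ (ℚᵘ.mkℚᵘ (+ n) 0) (ℚᵘ.mkℚᵘ -[1+ k ] 0)
    (x-y≡0⇒x≡y (+ n / 1) (-[1+ k ] / 1) eq)))
n-admissible≢0 n (positiveHalfInteger k) eq = even≢odd n k (ℚᵘₚ.drop-*≡*
  (/-injective-≃ (ℚᵘ.mkℚᵘ (+ n) 0) (ℚᵘ.mkℚᵘ (+ suc (2 ℕ.* k)) 1)
    (x-y≡0⇒x≡y (+ n / 1) (+ suc (2 ℕ.* k) / 2) eq)))

eval≢0 : ∀ {p d} → HasDegree p d → HasSimpleRootsIn Admissible p d →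
         ∀ n → NonZero (eval p (ℕ→ℚ n))
eval≢0 {p} {d} (lead≢0 , _) hr n = ≢-nonZero
  (subst (_≢ 0ℚ) (sym (factorisation (ℕ→ℚ n))) (x*y≢0 (ℤ→ℚ-≢0 lead≢0) (product≢0 roots-in)))
  where
  open HasSimpleRootsIn hr
  product≢0 : ∀ {rs} → All Admissible rs →
              foldr _*_ 1ℚ (map (λ r → ℕ→ℚ n - r) rs) ≢ 0ℚ
  product≢0 []       = 1≢0
  product≢0 (a ∷ as) = x*y≢0 (n-admissible≢0 n a) (product≢0 as)

1/eval : ∀ {p d} → HasDegree p d → HasSimpleRootsIn Admissible p d → ℕ → ℚ
1/eval {p} deg hr n = (1/ eval p (ℕ→ℚ n)) {{eval≢0 deg hr n}}

centralBinomial/4^ : ℕ → ℚ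
centralBinomial/4^ n = (+ ((2 ℕ.* n) C n) / (4 ℕ.^ n)) {{ℕₚ.m^n≢0 4 n}}

{-# OPTIONS --safe #-}
module Submission where

-- The symmetry x ↔ -½ - x pairs the root -k with the root k - ½, so 1/p(n) is a constant
-- times a product of r k n = 1/((n + k)(n - k + ½)) over distinct k ≥ 1.  As r i · r j is
-- a multiple of r i - r j for i ≠ j, it suffices to sum the functions r k and (r k)²
-- (and 1, for the first series).  Let bₙ = C(2n,n)/4ⁿ and q k n = 1/((n + k)(n - k - ½)).
-- Telescoping (-1)ⁿ (n bₙ)³ q k n, (n bₙ)⁴ q k n and (n bₙ)⁴ (q k n)² expresses the sums for
-- k + 1 by those for k, where the multiples of r k carry a factor k, so that the recursion
-- starts at k = 0; the boundary terms tend to 0, to lim (n bₙ²)² and to 0.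
--
-- What remains is Bauer's Σ (-1)ⁿ (4n + 1) bₙ³ = 2/π and Wallis' n bₙ² → 1/π.  The well-poised
-- series S(a) = Σ (-1)ⁿ (a + 2n) (a)ₙ (½)ₙ² / (a n! (a + ½)ₙ²) satisfies S(a) = ρ(a) S(a + 1)
-- and tends to 1 as a → ∞.  It is the Leibniz series at a = 1 and Bauer's series at a = ½,
-- and the products of the ρ(a + j) are Wallis products in both cases.

-- Limits are avoided: a sum is followed through its partial sums, which are compared at each index
-- n with a rational multiple of the n-th approximant of `1/π` or `1/π²`; convergence is read off
-- from this comparison at the very end. Likewise the partial sums of S(a) are compared with the
-- finite products of the ρ(a + j). Neither Wallis product is evaluated: those for a = ½ and a = 1
-- multiply to exactly (n + 1)/(2n + 1), so the values of S(½) and S(1) have product ½, and as π is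
-- defined as 4 S(1), Bauer's 2/π follows. The choice of n bₙ and q makes the telescoping work. As
-- (n + 1) bₙ₊₁ = (n + ½) bₙ, each difference is a power of bₙ times an expression in q k n and q k
-- (n + 1), and these two, r k n and r (k + 1) n are reciprocals of products of two out of the same
-- four linear factors. For fourth powers the constant function 1 has to stay out, because Σ (4n +
-- 1) bₙ⁴ diverges like the harmonic series. Every function summed there contains some r k, which is
-- where the positive degree of p enters.

open import Defs
open import Data.Empty using (⊥-elim)
open import Data.Integer.Base as ℤ using (ℤ; +_; -[1+_])
import Data.Integer.Properties as ℤₚ
open import Data.List.Base using (List; []; _∷_; foldr; map)
open import Data.List.Membership.Propositional using (_∈_)
open import Data.List.Membership.Propositional.Properties.WithK using (unique∧set⇒bag)
open import Data.List.Relation.Binary.BagAndSetEquality using (∼bag⇒↭)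
open import Data.List.Relation.Binary.Permutation.Propositional as ↭ using (_↭_)
open import Data.List.Relation.Unary.All using (All; []; _∷_)
open import Data.List.Relation.Unary.AllPairs using ([]; _∷_)
open import Data.List.Relation.Unary.Any using (here; there)
open import Data.List.Relation.Unary.Unique.Propositional using (Unique)
open import Data.Nat.Base as ℕ using (ℕ; zero; suc; z≤n; s≤s; _!)
open import Data.Nat.Combinatorics using (_C_; nCk≡n!/k![n-k]!; k![n∸k]!∣n!)
open import Data.Nat.Divisibility using (_∣_; divides; ∣⇒≤)
import Data.Nat.DivMod as ℕ
import Data.Nat.Properties as ℕₚ
import Data.Nat.Solver
open import Data.Product.Base using (∃-syntax; _×_; _,_; proj₁; proj₂)
open import Data.Rational
open import Data.Rational.Properties
open import Data.Rational.Solver using (module +-*-Solver)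
import Data.Rational.Unnormalised as ℚᵘ
import Data.Rational.Unnormalised.Properties as ℚᵘₚ
open import Data.Sum.Base using (inj₁; inj₂)
open import Function.Base using (_∘′_)
open import Function.Bundles using (mk⇔)
open import Relation.Binary.PropositionalEquality
  using (_≡_; _≢_; refl; sym; trans; cong; cong₂; subst; module ≡-Reasoning)
open import Relation.Nullary using (Dec; yes; no)
open +-*-Solver

-- Rational arithmetic

module _ where
  open import Relation.Binary.Reasoning.Setoid ℚᵘₚ.≃-setoid

  ℤ→ℚ-+ : ∀ i j → ℤ→ℚ (i ℤ.+ j) ≡ ℤ→ℚ i + ℤ→ℚ j
  ℤ→ℚ-+ i j = toℚᵘ-injective (begin
    toℚᵘ (ℤ→ℚ (i ℤ.+ j))                     ≈⟨ toℚᵘ-fromℚᵘ (ℚᵘ.mkℚᵘ (i ℤ.+ j) 0) ⟩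
    ℚᵘ.mkℚᵘ (i ℤ.+ j) 0                      ≈⟨ ℚᵘ.*≡* (cong (ℤ._* + 1)
                                                  (cong₂ ℤ._+_ (sym (ℤₚ.*-identityʳ i)) (sym (ℤₚ.*-identityʳ j)))) ⟩
    ℚᵘ.mkℚᵘ i 0 ℚᵘ.+ ℚᵘ.mkℚᵘ j 0             ≈⟨ ℚᵘₚ.+-cong (toℚᵘ-fromℚᵘ (ℚᵘ.mkℚᵘ i 0)) (toℚᵘ-fromℚᵘ (ℚᵘ.mkℚᵘ j 0)) ⟨
    toℚᵘ (ℤ→ℚ i) ℚᵘ.+ toℚᵘ (ℤ→ℚ j)           ≈⟨ toℚᵘ-homo-+ (ℤ→ℚ i) (ℤ→ℚ j) ⟨
    toℚᵘ (ℤ→ℚ i + ℤ→ℚ j)                     ∎)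

  ℤ→ℚ-* : ∀ i j → ℤ→ℚ (i ℤ.* j) ≡ ℤ→ℚ i * ℤ→ℚ j
  ℤ→ℚ-* i j = toℚᵘ-injective (begin
    toℚᵘ (ℤ→ℚ (i ℤ.* j))                     ≈⟨ toℚᵘ-fromℚᵘ (ℚᵘ.mkℚᵘ (i ℤ.* j) 0) ⟩
    ℚᵘ.mkℚᵘ i 0 ℚᵘ.* ℚᵘ.mkℚᵘ j 0             ≈⟨ ℚᵘₚ.*-cong (toℚᵘ-fromℚᵘ (ℚᵘ.mkℚᵘ i 0)) (toℚᵘ-fromℚᵘ (ℚᵘ.mkℚᵘ j 0)) ⟨
    toℚᵘ (ℤ→ℚ i) ℚᵘ.* toℚᵘ (ℤ→ℚ j)           ≈⟨ toℚᵘ-homo-* (ℤ→ℚ i) (ℤ→ℚ j) ⟨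
    toℚᵘ (ℤ→ℚ i * ℤ→ℚ j)                     ∎)

  i/n*n≡i : ∀ i n .{{_ : ℕ.NonZero n}} → i / n * ℕ→ℚ n ≡ ℤ→ℚ i
  i/n*n≡i i (suc n) = toℚᵘ-injective (begin
    toℚᵘ (i / suc n * ℕ→ℚ (suc n))                ≈⟨ toℚᵘ-homo-* (i / suc n) (ℕ→ℚ (suc n)) ⟩
    toℚᵘ (i / suc n) ℚᵘ.* toℚᵘ (ℕ→ℚ (suc n))      ≈⟨ ℚᵘₚ.*-cong (toℚᵘ-fromℚᵘ (ℚᵘ.mkℚᵘ i n)) (toℚᵘ-fromℚᵘ (ℚᵘ.mkℚᵘ (+ suc n) 0)) ⟩
    ℚᵘ.mkℚᵘ i n ℚᵘ.* ℚᵘ.mkℚᵘ (+ suc n) 0          ≈⟨ ℚᵘ.*≡* (trans (ℤₚ.*-identityʳ (i ℤ.* + suc n))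
                                                       (cong (i ℤ.*_) (cong (λ m → + suc m) (sym (ℕₚ.*-identityʳ n))))) ⟩
    ℚᵘ.mkℚᵘ i 0                                   ≈⟨ toℚᵘ-fromℚᵘ (ℚᵘ.mkℚᵘ i 0) ⟨
    toℚᵘ (ℤ→ℚ i)                                  ∎)

ℕ→ℚ-+ : ∀ m n → ℕ→ℚ (m ℕ.+ n) ≡ ℕ→ℚ m + ℕ→ℚ n
ℕ→ℚ-+ m n = ℤ→ℚ-+ (+ m) (+ n)

ℕ→ℚ-* : ∀ m n → ℕ→ℚ (m ℕ.* n) ≡ ℕ→ℚ m * ℕ→ℚ n
ℕ→ℚ-* m n = trans (cong ℤ→ℚ (ℤₚ.pos-* m n)) (ℤ→ℚ-* (+ m) (+ n))

ℕ→ℚ-suc : ∀ n → ℕ→ℚ (suc n) ≡ ℕ→ℚ n + 1ℚ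
ℕ→ℚ-suc n = trans (ℕ→ℚ-+ 1 n) (+-comm 1ℚ (ℕ→ℚ n))

0≤ℕ→ℚ : ∀ n → 0ℚ ≤ ℕ→ℚ n
0≤ℕ→ℚ n = nonNegative⁻¹ _ {{normalize-nonNeg n 1}}

0≤+ : ∀ {x y} → 0ℚ ≤ x → 0ℚ ≤ y → 0ℚ ≤ x + y
0≤+ = +-mono-≤ {0ℚ} {_} {0ℚ}

0≤* : ∀ {x y} → 0ℚ ≤ x → 0ℚ ≤ y → 0ℚ ≤ x * y
0≤* {x} {y} 0≤x 0≤y = nonNegative⁻¹ _
  {{nonNeg*nonNeg⇒nonNeg x {{nonNegative 0≤x}} y {{nonNegative 0≤y}}}}

0<+≤ : ∀ {x y} → 0ℚ < x → 0ℚ ≤ y → 0ℚ < x + y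
0<+≤ = +-mono-<-≤ {0ℚ} {_} {0ℚ}

x≤x+d : ∀ {x y} d → 0ℚ ≤ d → y ≡ x + d → x ≤ y
x≤x+d {x} d 0≤d refl = subst (_≤ x + d) (+-identityʳ x) (+-monoʳ-≤ x 0≤d)

*-monoˡ : ∀ {z x y} → 0ℚ ≤ z → x ≤ y → z * x ≤ z * y
*-monoˡ {z} 0≤z = *-monoˡ-≤-nonNeg z {{nonNegative 0≤z}}

0<⇒≢0 : ∀ {x} → 0ℚ < x → x ≢ 0ℚ
0<⇒≢0 0<x refl = <-irrefl refl 0<x

*-cancelʳ-≢0 : ∀ z {x y} → z ≢ 0ℚ → x * z ≡ y * z → x ≡ y
*-cancelʳ-≢0 z {x} {y} z≢0 eq = begin
  x                  ≡⟨ *-identityʳ x ⟨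
  x * 1ℚ             ≡⟨ cong (x *_) (recip-inverse z≢0) ⟨
  x * (z * recip z)  ≡⟨ *-assoc x z (recip z) ⟨
  x * z * recip z    ≡⟨ cong (_* recip z) eq ⟩
  y * z * recip z    ≡⟨ *-assoc y z (recip z) ⟩
  y * (z * recip z)  ≡⟨ cong (y *_) (recip-inverse z≢0) ⟩
  y * 1ℚ             ≡⟨ *-identityʳ y ⟩
  y                  ∎
  where open ≡-Reasoning

*-cancelʳ-≤ : ∀ z {x y} → 0ℚ < z → x * z ≤ y * z → x ≤ y
*-cancelʳ-≤ z 0<z = *-cancelʳ-≤-pos z {{positive 0<z}}

recip-inverseˡ : ∀ {q} → q ≢ 0ℚ → recip q * q ≡ 1ℚ
recip-inverseˡ {q} q≢0 = trans (*-comm (recip q) q) (recip-inverse q≢0)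

*-recip-cancel : ∀ x {d} → d ≢ 0ℚ → x * recip d * d ≡ x
*-recip-cancel x {d} d≢0 = trans (*-assoc x (recip d) d)
  (trans (cong (x *_) (recip-inverseˡ d≢0)) (*-identityʳ x))

recip-unique : ∀ x y → x * y ≡ 1ℚ → recip x ≡ y
recip-unique x y xy≡1 = *-cancelʳ-≢0 x x≢0
  (trans (recip-inverseˡ x≢0) (trans (sym xy≡1) (*-comm x y)))
  where
  x≢0 : x ≢ 0ℚ
  x≢0 refl = 1≢0 (trans (sym xy≡1) (*-zeroˡ y))

-- Total because `recip 0ℚ` is `0ℚ`; this lets `q l n` be split into its two factors even at n = l =
-- 0.
recip-* : ∀ x y → recip (x * y) ≡ recip x * recip y
recip-* x y = go (x ≟ 0ℚ) (y ≟ 0ℚ)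
  where
  open ≡-Reasoning
  go : Dec (x ≡ 0ℚ) → Dec (y ≡ 0ℚ) → recip (x * y) ≡ recip x * recip y
  go (yes refl) _ = trans (cong recip (*-zeroˡ y)) (sym (*-zeroˡ (recip y)))
  go (no _) (yes refl) = trans (cong recip (*-zeroʳ x)) (sym (*-zeroʳ (recip x)))
  go (no x≢0) (no y≢0) = recip-unique (x * y) (recip x * recip y) (begin
    x * y * (recip x * recip y)      ≡⟨ solve 4 (λ x y i j → x :* y :* (i :* j) := (x :* i) :* (y :* j)) refl x y (recip x) (recip y) ⟩
    (x * recip x) * (y * recip y)    ≡⟨ cong₂ _*_ (recip-inverse x≢0) (recip-inverse y≢0) ⟩
    1ℚ * 1ℚ                          ≡⟨⟩
    1ℚ                               ∎)

0<recip : ∀ {x} → 0ℚ < x → 0ℚ < recip x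
0<recip {x} 0<x = subst (0ℚ <_) (sym (recip-unique x (1/ x) (*-inverseʳ x)))
  (positive⁻¹ (1/ x) {{1/pos⇒pos x {{positive 0<x}}}})
  where
  instance
    nz : NonZero x
    nz = pos⇒nonZero x {{positive 0<x}}

-- Null sequences

Eventually : (ℕ → Set) → Set
Eventually P = ∃[ N ] ∀ n → N ℕ.≤ n → P n

always : ∀ {P : ℕ → Set} → (∀ n → P n) → Eventually P
always h = 0 , λ n _ → h n

infixr 2 _∧ₑ_
_∧ₑ_ : ∀ {P Q : ℕ → Set} → Eventually P → Eventually Q → Eventually (λ n → P n × Q n)
(M , p) ∧ₑ (N , q) = M ℕ.⊔ N , λ n h → p n (ℕₚ.m⊔n≤o⇒m≤o M N h) , q n (ℕₚ.m⊔n≤o⇒n≤o M N h)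

mapₑ : ∀ {P Q : ℕ → Set} → (∀ n → P n → Q n) → Eventually P → Eventually Q
mapₑ f (N , p) = N , λ n h → f n (p n h)

-- `x ≈ℝ y` unfolds to `Null` of the difference of the approximants, so the comparisons below are
-- already equalities of reals.
Null : (ℕ → ℚ) → Set
Null s = ∀ ε → 0ℚ < ε → Eventually (λ n → ∣ s n ∣ ≤ ε)

½ε+½ε : ∀ ε → ½ * ε + ½ * ε ≡ ε
½ε+½ε = solve 1 (λ e → con ½ :* e :+ con ½ :* e := e) refl

0<½* : ∀ {ε} → 0ℚ < ε → 0ℚ < ½ * ε
0<½* = 0<x*y (positive⁻¹ ½)

null-dominated : ∀ {s t} → Eventually (λ n → ∣ s n ∣ ≤ ∣ t n ∣) → Null t → Null s
null-dominated s≤t t0 ε 0<ε = mapₑ (λ _ (p , q) → ≤-trans p q) (s≤t ∧ₑ t0 ε 0<ε)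

null-≗ : ∀ {s t} → (∀ n → s n ≡ t n) → Null t → Null s
null-≗ eq = null-dominated (always λ n → ≤-reflexive (cong ∣_∣ (eq n)))

null-+ : ∀ {s t} → Null s → Null t → Null (λ n → s n + t n)
null-+ {s} {t} s0 t0 ε 0<ε = mapₑ
  (λ n (p , q) → subst (∣ s n + t n ∣ ≤_) (½ε+½ε ε) (≤-trans (∣p+q∣≤∣p∣+∣q∣ (s n) (t n)) (+-mono-≤ p q)))
  (s0 (½ * ε) (0<½* 0<ε) ∧ₑ t0 (½ * ε) (0<½* 0<ε))

null-bounded-* : ∀ {b s} → Bound b → Null s → Null (λ n → b n * s n)
null-bounded-* {b} {s} (B , 0<B , b≤B) s0 ε 0<ε = mapₑ near
  (b≤B ∧ₑ s0 (ε * recip B) (0<x*y 0<ε (0<recip 0<B)))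
  where
  near : ∀ n → ∣ b n ∣ ≤ B × ∣ s n ∣ ≤ ε * recip B → ∣ b n * s n ∣ ≤ ε
  near n (p , q) = begin
    ∣ b n * s n ∣      ≡⟨ ∣p*q∣≡∣p∣*∣q∣ (b n) (s n) ⟩
    ∣ b n ∣ * ∣ s n ∣  ≤⟨ *-mono-≤-nonNeg (<⇒≤ 0<B) (0≤∣p∣ (s n)) p q ⟩
    B * (ε * recip B)  ≡⟨ solve 3 (λ b e i → b :* (e :* i) := e :* (b :* i)) refl B ε (recip B) ⟩
    ε * (B * recip B)  ≡⟨ cong (ε *_) (recip-inverse (0<⇒≢0 0<B)) ⟩
    ε * 1ℚ             ≡⟨ *-identityʳ ε ⟩
    ε                  ∎
    where open ≤-Reasoning

bound-const : ∀ c → Bound (λ _ → c)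
bound-const c = ∣ c ∣ + 1ℚ
  , positive⁻¹ _ {{nonNeg+pos⇒pos (∣ c ∣) {{∣-∣-nonNeg c}} 1ℚ}}
  , always λ _ → x≤x+d 1ℚ (<⇒≤ (positive⁻¹ 1ℚ)) refl

null-scale : ∀ c {s} → Null s → Null (λ n → c * s n)
null-scale c = null-bounded-* (bound-const c)

null-zero : Null (λ _ → 0ℚ)
null-zero ε 0<ε = always λ _ → <⇒≤ 0<ε

≤1-bound : ∀ {s} → (∀ n → 0ℚ ≤ s n) → (∀ n → s n ≤ 1ℚ) → Bound s
≤1-bound {s} 0≤s s≤1 = 1ℚ , positive⁻¹ 1ℚ , always λ n → subst (_≤ 1ℚ) (sym (0≤p⇒∣p∣≡p (0≤s n))) (s≤1 n)

null-bound : ∀ {s} → Null s → Bound s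
null-bound s0 = 1ℚ , positive⁻¹ 1ℚ , s0 1ℚ (positive⁻¹ 1ℚ)

bound-* : ∀ {s t} → Bound s → Bound t → Bound (λ n → s n * t n)
bound-* {s} {t} (A , 0<A , s≤A) (B , 0<B , t≤B) = A * B , 0<x*y 0<A 0<B
  , mapₑ (λ n (p , q) → subst (_≤ A * B) (sym (∣p*q∣≡∣p∣*∣q∣ (s n) (t n)))
           (*-mono-≤-nonNeg (<⇒≤ 0<A) (0≤∣p∣ (t n)) p q)) (s≤A ∧ₑ t≤B)

-- Avoids square roots: if ε ≤ s n, then s n · ε ≤ (s n)² ≤ ε², and ε cancels. It serves for b,
-- whose square is the accessible quantity.
null-square : ∀ {s} → (∀ n → 0ℚ ≤ s n) → Null (λ n → s n * s n) → Null s
null-square {s} 0≤s s²0 ε 0<ε = mapₑ near (s²0 (ε * ε) (0<x*y 0<ε 0<ε))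
  where
  near : ∀ n → ∣ s n * s n ∣ ≤ ε * ε → ∣ s n ∣ ≤ ε
  near n h with ≤-total (s n) ε
  ... | inj₁ s≤ε = subst (_≤ ε) (sym (0≤p⇒∣p∣≡p (0≤s n))) s≤ε
  ... | inj₂ ε≤s = subst (_≤ ε) (sym (0≤p⇒∣p∣≡p (0≤s n)))
    (*-cancelʳ-≤ ε 0<ε (≤-trans (*-monoˡ (0≤s n) ε≤s)
      (≤-trans (≤-reflexive (sym (0≤p⇒∣p∣≡p (0≤* (0≤s n) (0≤s n))))) h)))

null-oddRecip : Null oddRecip
null-oddRecip ε 0<ε with oddRecip-archimedean ε 0<ε
... | N , small = N , λ n N≤n → subst (_≤ ε) (sym (0≤p⇒∣p∣≡p (<⇒≤ (0<1/ (2 ℕ.* n)))))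
  (≤-trans (1/-antimono (ℕₚ.*-monoʳ-≤ 2 N≤n)) small)

oddRecip-inverse : ∀ n → oddRecip n * (ℕ→ℚ 2 * ℕ→ℚ n + 1ℚ) ≡ 1ℚ
oddRecip-inverse n = trans
  (cong (oddRecip n *_) (sym (trans (ℕ→ℚ-suc (2 ℕ.* n)) (cong (_+ 1ℚ) (ℕ→ℚ-* 2 n)))))
  (i/n*n≡i (+ 1) (suc (2 ℕ.* n)))

-- The source of all convergence claims in the theorem: the partial sums stay close to the
-- approximants of a real number. The error is split as ¼ε + ½ε + ¼ε.
null-cauchy : ∀ {s t} → Null (λ n → s n - t n) → IsCauchy t → IsCauchy s
null-cauchy {s} {t} s-t tc ε 0<ε = proj₁ both , near
  where
  ε₄ = ½ * (½ * ε)
  0<ε₄ = 0<½* (0<½* 0<ε)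
  K = proj₁ (tc (½ * ε) (0<½* 0<ε))
  both = (K , λ n K≤n → K≤n) ∧ₑ s-t ε₄ 0<ε₄
  near : ∀ m n → proj₁ both ℕ.≤ m → proj₁ both ℕ.≤ n → ∣ s m - s n ∣ ≤ ε
  near m n hm hn = begin
    ∣ s m - s n ∣
      ≡⟨ cong ∣_∣ (solve 4 (λ a b c d → a :- b := (a :- c) :+ (c :- d) :- (b :- d)) refl (s m) (s n) (t m) (t n)) ⟩
    ∣ (s m - t m) + (t m - t n) - (s n - t n) ∣
      ≤⟨ ∣p-q∣≤∣p∣+∣q∣ ((s m - t m) + (t m - t n)) (s n - t n) ⟩
    ∣ (s m - t m) + (t m - t n) ∣ + ∣ s n - t n ∣
      ≤⟨ +-mono-≤ (≤-trans (∣p+q∣≤∣p∣+∣q∣ (s m - t m) (t m - t n))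
           (+-mono-≤ (proj₂ (proj₂ both m hm)) (proj₂ (tc (½ * ε) (0<½* 0<ε)) m n (proj₁ (proj₂ both m hm)) (proj₁ (proj₂ both n hn)))))
           (proj₂ (proj₂ both n hn)) ⟩
    ε₄ + ½ * ε + ε₄
      ≡⟨ solve 1 (λ e → con ½ :* (con ½ :* e) :+ con ½ :* e :+ con ½ :* (con ½ :* e) := e) refl ε ⟩
    ε ∎
    where open ≤-Reasoning

-- The hypothesis forces s (and p) to be Cauchy: compare two values of s with the same p M.
null-diagonal : ∀ {s p : ℕ → ℚ} →
  (∀ ε → 0ℚ < ε → Eventually (λ M → Eventually (λ N → ∣ s N - p M ∣ ≤ ε))) →
  Null (λ n → s n - p n)
null-diagonal {s} {p} close ε 0<ε = proj₁ both , near
  where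
  ε₄ = ½ * (½ * ε)
  0<ε₄ = 0<½* (0<½* 0<ε)
  M = proj₁ (close ε₄ 0<ε₄)
  column = proj₂ (close ε₄ 0<ε₄)
  both = (M , λ n M≤n → M≤n) ∧ₑ column M ℕₚ.≤-refl
  near : ∀ n → proj₁ both ℕ.≤ n → ∣ s n - p n ∣ ≤ ε
  near n h = begin
    ∣ s n - p n ∣
      ≡⟨ cong ∣_∣ (solve 4 (λ a b c d → a :- b := (a :- c) :+ (d :- b) :- (d :- c)) refl (s n) (p n) (p M) (s N)) ⟩
    ∣ (s n - p M) + (s N - p n) - (s N - p M) ∣
      ≤⟨ ∣p-q∣≤∣p∣+∣q∣ ((s n - p M) + (s N - p n)) (s N - p M) ⟩
    ∣ (s n - p M) + (s N - p n) ∣ + ∣ s N - p M ∣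
      ≤⟨ +-mono-≤ (≤-trans (∣p+q∣≤∣p∣+∣q∣ (s n - p M) (s N - p n)) (+-mono-≤ (proj₂ (proj₂ both n h)) (proj₁ atN)))
           (proj₂ atN) ⟩
    ε₄ + ε₄ + ε₄
      ≤⟨ x≤x+d ε₄ (<⇒≤ 0<ε₄) (solve 1 (λ e → e := con ½ :* (con ½ :* e) :+ con ½ :* (con ½ :* e) :+ con ½ :* (con ½ :* e) :+ con ½ :* (con ½ :* e)) refl ε) ⟩
    ε ∎
    where
    open ≤-Reasoning
    joint = column n (proj₁ (proj₂ both n h)) ∧ₑ column M ℕₚ.≤-refl
    N = proj₁ joint
    atN = proj₂ joint N ℕₚ.≤-refl

-- The well-poised series S(a)

ρ : ℚ → ℚ
ρ a = a * (a + 1ℚ) * recip ((a + ½) * (a + ½))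

-- The unsigned term (a)ₙ (½)ₙ² / (a n! (a + ½)ₙ²) without its linear factor a + 2n, given by the
-- ratio of consecutive terms. The initial value 1/a makes the first term of the series 1.
w : ℚ → ℕ → ℚ
w a zero    = recip a
w a (suc n) = w a n * ((a + ℕ→ℚ n) * ((ℕ→ℚ n + ½) * (ℕ→ℚ n + ½)))
            * recip ((ℕ→ℚ n + 1ℚ) * ((a + ℕ→ℚ n + ½) * (a + ℕ→ℚ n + ½)))

0<½ : 0ℚ < ½
0<½ = positive⁻¹ ½

0<1 : 0ℚ < 1ℚ
0<1 = positive⁻¹ 1ℚ

0<n+1 : ∀ n → 0ℚ < ℕ→ℚ n + 1ℚ
0<n+1 n = +-mono-≤-< {0ℚ} {_} {0ℚ} (0≤ℕ→ℚ n) 0<1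

module _ {a : ℚ} (0<a : 0ℚ < a) (n : ℕ) where

  0<a+n : 0ℚ < a + ℕ→ℚ n
  0<a+n = 0<+≤ 0<a (0≤ℕ→ℚ n)

  0<a+n+½ : 0ℚ < a + ℕ→ℚ n + ½
  0<a+n+½ = 0<+≤ 0<a+n (<⇒≤ 0<½)

  0<[a+n+½]² : 0ℚ < (a + ℕ→ℚ n + ½) * (a + ℕ→ℚ n + ½)
  0<[a+n+½]² = 0<x*y 0<a+n+½ 0<a+n+½

  0<w-denominator : 0ℚ < (ℕ→ℚ n + 1ℚ) * ((a + ℕ→ℚ n + ½) * (a + ℕ→ℚ n + ½))
  0<w-denominator = 0<x*y (0<n+1 n) 0<[a+n+½]²

  w-suc : w a (suc n) * ((ℕ→ℚ n + 1ℚ) * ((a + ℕ→ℚ n + ½) * (a + ℕ→ℚ n + ½)))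
        ≡ w a n * ((a + ℕ→ℚ n) * ((ℕ→ℚ n + ½) * (ℕ→ℚ n + ½)))
  w-suc = *-recip-cancel (w a n * ((a + ℕ→ℚ n) * ((ℕ→ℚ n + ½) * (ℕ→ℚ n + ½)))) (0<⇒≢0 0<w-denominator)

0<w : ∀ {a} → 0ℚ < a → ∀ n → 0ℚ < w a n
0<w 0<a zero    = 0<recip 0<a
0<w 0<a (suc n) = 0<x*y (0<x*y (0<w 0<a n) (0<x*y (0<a+n 0<a n) (0<x*y 0<n+½ 0<n+½)))
                        (0<recip (0<w-denominator 0<a n))
  where
  0<n+½ : 0ℚ < ℕ→ℚ n + ½
  0<n+½ = +-mono-≤-< {0ℚ} {_} {0ℚ} (0≤ℕ→ℚ n) 0<½

0<a+1 : ∀ {a} → 0ℚ < a → 0ℚ < a + 1ℚ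
0<a+1 0<a = 0<+≤ 0<a (<⇒≤ 0<1)

0<[a+½]² : ∀ {a} → 0ℚ < a → 0ℚ < (a + ½) * (a + ½)
0<[a+½]² {a} 0<a = 0<x*y 0<a+½ 0<a+½
  where
  0<a+½ : 0ℚ < a + ½
  0<a+½ = 0<+≤ 0<a (<⇒≤ 0<½)

0<ρ : ∀ {a} → 0ℚ < a → 0ℚ < ρ a
0<ρ {a} 0<a = 0<x*y (0<x*y 0<a (0<a+1 0<a)) (0<recip (0<[a+½]² 0<a))

ρ-def : ∀ {a} → 0ℚ < a → ρ a * ((a + ½) * (a + ½)) ≡ a * (a + 1ℚ)
ρ-def {a} 0<a = *-recip-cancel (a * (a + 1ℚ)) (0<⇒≢0 (0<[a+½]² 0<a))

ρ≤1 : ∀ {a} → 0ℚ < a → ρ a ≤ 1ℚ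
ρ≤1 {a} 0<a = *-cancelʳ-≤ ((a + ½) * (a + ½)) (0<[a+½]² 0<a)
  (≤-trans (≤-reflexive (ρ-def 0<a)) (x≤x+d (½ * ½) (<⇒≤ (0<x*y 0<½ 0<½))
    (solve 1 (λ a → con 1ℚ :* ((a :+ con ½) :* (a :+ con ½)) := a :* (a :+ con 1ℚ) :+ con ½ :* con ½) refl a)))

-- Raising a by one shifts the Pochhammer symbols: (a + 1)ₙ = (a)ₙ (a + n)/a and (a + 3/2)ₙ = (a +
-- ½)ₙ (a + n + ½)/(a + ½). Up to a, the factors free of n cancel against `ρ a`.
w-shift : ∀ {a} → 0ℚ < a → ∀ n →
  ρ a * w (a + 1ℚ) n * ((a + ℕ→ℚ n + ½) * (a + ℕ→ℚ n + ½)) ≡ a * (a + ℕ→ℚ n) * w a n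
w-shift {a} 0<a zero = begin
  ρ a * i * ((a + 0ℚ + ½) * (a + 0ℚ + ½))
    ≡⟨ solve 3 (λ r i a → r :* i :* ((a :+ con 0ℚ :+ con ½) :* (a :+ con 0ℚ :+ con ½))
                       := r :* ((a :+ con ½) :* (a :+ con ½)) :* i) refl (ρ a) i a ⟩
  ρ a * ((a + ½) * (a + ½)) * i
    ≡⟨ cong (_* i) (ρ-def 0<a) ⟩
  a * (a + 1ℚ) * i
    ≡⟨ *-assoc a (a + 1ℚ) i ⟩
  a * ((a + 1ℚ) * i)
    ≡⟨ cong (a *_) (trans (recip-inverse (0<⇒≢0 (0<a+1 0<a))) (sym (recip-inverse (0<⇒≢0 0<a)))) ⟩
  a * (a * recip a)
    ≡⟨ solve 2 (λ a i → a :* (a :* i) := a :* (a :+ con 0ℚ) :* i) refl a (recip a) ⟩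
  a * (a + 0ℚ) * recip a ∎
  where
  open ≡-Reasoning
  i = recip (a + 1ℚ)
w-shift {a} 0<a (suc m) = subst
  (λ ν → ρ a * w (a + 1ℚ) (suc m) * ((a + ν + ½) * (a + ν + ½)) ≡ a * (a + ν) * w a (suc m))
  (sym (ℕ→ℚ-suc m)) (*-cancelʳ-≢0 (d * e) (0<⇒≢0 (0<x*y 0<d 0<e)) (begin
  ρ a * w (a + 1ℚ) (suc m) * ((a + (n + 1ℚ) + ½) * (a + (n + 1ℚ) + ½)) * (d * e)
    ≡⟨ solve 6 (λ r v a n d e → r :* v :* ((a :+ (n :+ con 1ℚ) :+ con ½) :* (a :+ (n :+ con 1ℚ) :+ con ½)) :* (d :* e)
                       := r :* (v :* d) :* e :* ((a :+ (n :+ con 1ℚ) :+ con ½) :* (a :+ (n :+ con 1ℚ) :+ con ½)))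
         refl (ρ a) (w (a + 1ℚ) (suc m)) a n d e ⟩
  ρ a * (w (a + 1ℚ) (suc m) * d) * e * ((a + (n + 1ℚ) + ½) * (a + (n + 1ℚ) + ½))
    ≡⟨ cong (λ z → ρ a * z * e * ((a + (n + 1ℚ) + ½) * (a + (n + 1ℚ) + ½))) (w-suc (0<a+1 0<a) m) ⟩
  ρ a * (w (a + 1ℚ) m * ((a + 1ℚ + n) * ((n + ½) * (n + ½)))) * e * ((a + (n + 1ℚ) + ½) * (a + (n + 1ℚ) + ½))
    ≡⟨ solve 5 (λ r v a n e → r :* (v :* ((a :+ con 1ℚ :+ n) :* ((n :+ con ½) :* (n :+ con ½)))) :* e :* ((a :+ (n :+ con 1ℚ) :+ con ½) :* (a :+ (n :+ con 1ℚ) :+ con ½))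
                       := (r :* v :* e) :* ((a :+ con 1ℚ :+ n) :* ((n :+ con ½) :* (n :+ con ½))) :* ((a :+ (n :+ con 1ℚ) :+ con ½) :* (a :+ (n :+ con 1ℚ) :+ con ½)))
         refl (ρ a) (w (a + 1ℚ) m) a n e ⟩
  (ρ a * w (a + 1ℚ) m * e) * ((a + 1ℚ + n) * ((n + ½) * (n + ½))) * ((a + (n + 1ℚ) + ½) * (a + (n + 1ℚ) + ½))
    ≡⟨ cong (λ z → z * ((a + 1ℚ + n) * ((n + ½) * (n + ½))) * ((a + (n + 1ℚ) + ½) * (a + (n + 1ℚ) + ½))) (w-shift 0<a m) ⟩
  a * (a + n) * w a m * ((a + 1ℚ + n) * ((n + ½) * (n + ½))) * ((a + (n + 1ℚ) + ½) * (a + (n + 1ℚ) + ½))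
    ≡⟨ solve 3 (λ v a n → a :* (a :+ n) :* v :* ((a :+ con 1ℚ :+ n) :* ((n :+ con ½) :* (n :+ con ½))) :* ((a :+ (n :+ con 1ℚ) :+ con ½) :* (a :+ (n :+ con 1ℚ) :+ con ½))
                       := a :* (a :+ (n :+ con 1ℚ)) :* (v :* ((a :+ n) :* ((n :+ con ½) :* (n :+ con ½)))) :* ((a :+ con 1ℚ :+ n :+ con ½) :* (a :+ con 1ℚ :+ n :+ con ½)))
         refl (w a m) a n ⟩
  a * (a + (n + 1ℚ)) * (w a m * ((a + n) * ((n + ½) * (n + ½)))) * f
    ≡⟨ cong (λ z → a * (a + (n + 1ℚ)) * z * f) (w-suc 0<a m) ⟨
  a * (a + (n + 1ℚ)) * (w a (suc m) * ((n + 1ℚ) * e)) * f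
    ≡⟨ solve 5 (λ a n v e f → a :* (a :+ (n :+ con 1ℚ)) :* (v :* ((n :+ con 1ℚ) :* e)) :* f
                            := a :* (a :+ (n :+ con 1ℚ)) :* v :* ((n :+ con 1ℚ) :* f :* e)) refl a n (w a (suc m)) e f ⟩
  a * (a + (n + 1ℚ)) * w a (suc m) * (d * e) ∎))
  where
  open ≡-Reasoning
  n = ℕ→ℚ m
  e = (a + n + ½) * (a + n + ½)
  f = (a + 1ℚ + n + ½) * (a + 1ℚ + n + ½)
  d = (n + 1ℚ) * f
  0<e = 0<[a+n+½]² 0<a m
  0<d = 0<w-denominator (0<a+1 0<a) m

-- By `w-shift` this is a (a + n) ≤ (a + n + ½)². Iterated, it bounds the boundary term of every
-- shift of a by that of the first one.
ρw≤w : ∀ {a} → 0ℚ < a → ∀ n → ρ a * w (a + 1ℚ) n ≤ w a n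
ρw≤w {a} 0<a m = *-cancelʳ-≤ ((a + n + ½) * (a + n + ½)) (0<[a+n+½]² 0<a m)
  (≤-trans (≤-reflexive (w-shift 0<a m)) (x≤x+d
    ((a * n + a + n * n + n + ½ * ½) * w a m)
    (0≤* (0≤+ (0≤+ (0≤+ (0≤+ (0≤* 0≤a 0≤n) 0≤a) (0≤* 0≤n 0≤n)) 0≤n) (<⇒≤ (0<x*y 0<½ 0<½))) (<⇒≤ (0<w 0<a m)))
    (solve 3 (λ a n v → v :* ((a :+ n :+ con ½) :* (a :+ n :+ con ½))
      := a :* (a :+ n) :* v :+ (a :* n :+ a :+ n :* n :+ n :+ con ½ :* con ½) :* v) refl a n (w a m))))
  where
  n = ℕ→ℚ m
  0≤a = <⇒≤ 0<a
  0≤n = 0≤ℕ→ℚ m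

magnitude : ℚ → ℕ → ℚ
magnitude a n = (a + ℕ→ℚ 2 * ℕ→ℚ n) * w a n

signed : (ℕ → ℚ) → ℕ → ℚ
signed f n = (- 1ℚ) ^ℚ n * f n

S : ℚ → ℕ → ℚ
S a = partialSum (signed (magnitude a))

-- A WZ pair in (a , N), summed over the second variable.
S-shift : ∀ {a} → 0ℚ < a → ∀ N → ρ a * S (a + 1ℚ) N ≡ S a N + (- 1ℚ) ^ℚ N * (ℕ→ℚ N * w a N)
S-shift {a} 0<a zero = solve 2 (λ r v → r :* con 0ℚ := con 0ℚ :+ con 1ℚ :* (con 0ℚ :* v)) refl (ρ a) (w a 0)
S-shift {a} 0<a (suc m) = subst
  (λ ν → ρ a * S (a + 1ℚ) (suc m) ≡ S a (suc m) + (- 1ℚ) ^ℚ suc m * (ν * w a (suc m)))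
  (sym (ℕ→ℚ-suc m)) (begin
  ρ a * (S (a + 1ℚ) m + s * ((a + 1ℚ + ℕ→ℚ 2 * n) * w (a + 1ℚ) m))
    ≡⟨ *-distribˡ-+ (ρ a) (S (a + 1ℚ) m) _ ⟩
  ρ a * S (a + 1ℚ) m + ρ a * (s * ((a + 1ℚ + ℕ→ℚ 2 * n) * w (a + 1ℚ) m))
    ≡⟨ cong₂ _+_ (S-shift 0<a m) (solve 4 (λ r s y v → r :* (s :* (y :* v)) := s :* (y :* (r :* v))) refl (ρ a) s (a + 1ℚ + ℕ→ℚ 2 * n) (w (a + 1ℚ) m)) ⟩
  S a m + s * (n * w a m) + s * ((a + 1ℚ + ℕ→ℚ 2 * n) * (ρ a * w (a + 1ℚ) m))
    ≡⟨ cong (λ z → S a m + s * (n * w a m) + s * z) key ⟩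
  S a m + s * (n * w a m) + s * ((a + ℕ→ℚ 2 * n) * w a m - n * w a m - (n + 1ℚ) * w a (suc m))
    ≡⟨ solve 6 (λ S s n u v y → S :+ s :* (n :* u) :+ s :* (y :* u :- n :* u :- (n :+ con 1ℚ) :* v)
                := S :+ s :* (y :* u) :+ con (- 1ℚ) :* s :* ((n :+ con 1ℚ) :* v)) refl (S a m) s n (w a m) (w a (suc m)) (a + ℕ→ℚ 2 * n) ⟩
  S a m + s * ((a + ℕ→ℚ 2 * n) * w a m) + - 1ℚ * s * ((n + 1ℚ) * w a (suc m)) ∎)
  where
  open ≡-Reasoning
  n = ℕ→ℚ m
  s = (- 1ℚ) ^ℚ m
  e = (a + n + ½) * (a + n + ½)
  key : (a + 1ℚ + ℕ→ℚ 2 * n) * (ρ a * w (a + 1ℚ) m)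
      ≡ (a + ℕ→ℚ 2 * n) * w a m - n * w a m - (n + 1ℚ) * w a (suc m)
  key = *-cancelʳ-≢0 e (0<⇒≢0 (0<[a+n+½]² 0<a m)) (begin
    (a + 1ℚ + ℕ→ℚ 2 * n) * (ρ a * w (a + 1ℚ) m) * e
      ≡⟨ *-assoc (a + 1ℚ + ℕ→ℚ 2 * n) (ρ a * w (a + 1ℚ) m) e ⟩
    (a + 1ℚ + ℕ→ℚ 2 * n) * (ρ a * w (a + 1ℚ) m * e)
      ≡⟨ cong ((a + 1ℚ + ℕ→ℚ 2 * n) *_) (w-shift 0<a m) ⟩
    (a + 1ℚ + ℕ→ℚ 2 * n) * (a * (a + n) * w a m)
      ≡⟨ solve 3 (λ a n u → (a :+ con 1ℚ :+ con (ℕ→ℚ 2) :* n) :* (a :* (a :+ n) :* u)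
           := ((a :+ con (ℕ→ℚ 2) :* n) :* u :- n :* u) :* ((a :+ n :+ con ½) :* (a :+ n :+ con ½))
              :- u :* ((a :+ n) :* ((n :+ con ½) :* (n :+ con ½)))) refl a n (w a m) ⟩
    ((a + ℕ→ℚ 2 * n) * w a m - n * w a m) * e - w a m * ((a + n) * ((n + ½) * (n + ½)))
      ≡⟨ cong (λ z → ((a + ℕ→ℚ 2 * n) * w a m - n * w a m) * e - z) (w-suc 0<a m) ⟨
    ((a + ℕ→ℚ 2 * n) * w a m - n * w a m) * e - w a (suc m) * ((n + 1ℚ) * e)
      ≡⟨ solve 4 (λ y e v n → y :* e :- v :* (n :* e) := (y :- n :* v) :* e)
           refl ((a + ℕ→ℚ 2 * n) * w a m - n * w a m) e (w a (suc m)) (n + 1ℚ) ⟩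
    ((a + ℕ→ℚ 2 * n) * w a m - n * w a m - (n + 1ℚ) * w a (suc m)) * e ∎)

P : ℚ → ℕ → ℚ
P a zero    = 1ℚ
P a (suc j) = P a j * ρ (a + ℕ→ℚ j)

module _ {a : ℚ} (0<a : 0ℚ < a) where

  0≤P : ∀ j → 0ℚ ≤ P a j
  0≤P zero    = <⇒≤ 0<1
  0≤P (suc j) = 0≤* (0≤P j) (<⇒≤ (0<ρ (0<a+n 0<a j)))

  P≤1 : ∀ j → P a j ≤ 1ℚ
  P≤1 zero    = ≤-refl
  P≤1 (suc j) = *-mono-≤-nonNeg {P a j} {1ℚ} {ρ (a + ℕ→ℚ j)} {1ℚ} (<⇒≤ 0<1)
    (<⇒≤ (0<ρ (0<a+n 0<a j))) (P≤1 j) (ρ≤1 (0<a+n 0<a j))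

  a+suc : ∀ j → a + ℕ→ℚ (suc j) ≡ a + ℕ→ℚ j + 1ℚ
  a+suc j = trans (cong (λ y → a + y) (ℕ→ℚ-suc j)) (sym (+-assoc a (ℕ→ℚ j) 1ℚ))

  Pw≤w : ∀ j N → P a j * w (a + ℕ→ℚ j) N ≤ w a N
  Pw≤w zero    N = ≤-reflexive (trans (*-identityˡ _) (cong (λ b → w b N) (+-identityʳ a)))
  Pw≤w (suc j) N = begin
    P a j * ρ b * w (a + ℕ→ℚ (suc j)) N  ≡⟨ cong (λ c → P a j * ρ b * w c N) (a+suc j) ⟩
    P a j * ρ b * w (b + 1ℚ) N           ≡⟨ *-assoc (P a j) (ρ b) (w (b + 1ℚ) N) ⟩
    P a j * (ρ b * w (b + 1ℚ) N)         ≤⟨ *-monoˡ (0≤P j) (ρw≤w (0<a+n 0<a j) N) ⟩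
    P a j * w b N                        ≤⟨ Pw≤w j N ⟩
    w a N                                ∎
    where
    open ≤-Reasoning
    b = a + ℕ→ℚ j

  -- Each of the j shifts leaves one boundary term of `S-shift`, and `Pw≤w` bounds each of them by
  -- the term at a.
  S-P*S : ∀ j N → ∣ S a N - P a j * S (a + ℕ→ℚ j) N ∣ ≤ ℕ→ℚ j * (ℕ→ℚ N * w a N)
  S-P*S zero    N = ≤-reflexive (begin
    ∣ S a N - 1ℚ * S (a + 0ℚ) N ∣  ≡⟨ cong (λ b → ∣ S a N - 1ℚ * S b N ∣) (+-identityʳ a) ⟩
    ∣ S a N - 1ℚ * S a N ∣         ≡⟨ cong ∣_∣ (solve 1 (λ s → s :- con 1ℚ :* s := con 0ℚ) refl (S a N)) ⟩
    0ℚ                             ≡⟨ *-zeroˡ (ℕ→ℚ N * w a N) ⟨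
    0ℚ * (ℕ→ℚ N * w a N)           ∎)
    where open ≡-Reasoning
  S-P*S (suc j) N = begin
    ∣ S a N - P a j * ρ b * S (a + ℕ→ℚ (suc j)) N ∣
      ≡⟨ cong (λ c → ∣ S a N - P a j * ρ b * S c N ∣) (a+suc j) ⟩
    ∣ S a N - P a j * ρ b * S (b + 1ℚ) N ∣
      ≡⟨ cong (λ z → ∣ S a N - z ∣) (trans (*-assoc (P a j) (ρ b) (S (b + 1ℚ) N)) (cong (P a j *_) (S-shift 0<b N))) ⟩
    ∣ S a N - P a j * (S b N + s * (ℕ→ℚ N * w b N)) ∣
      ≡⟨ cong ∣_∣ (solve 6 (λ S p T s n v → S :- p :* (T :+ s :* (n :* v)) := (S :- p :* T) :- s :* (n :* (p :* v)))
           refl (S a N) (P a j) (S b N) s (ℕ→ℚ N) (w b N)) ⟩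
    ∣ (S a N - P a j * S b N) - s * y ∣
      ≤⟨ ∣p-q∣≤∣p∣+∣q∣ (S a N - P a j * S b N) (s * y) ⟩
    ∣ S a N - P a j * S b N ∣ + ∣ s * y ∣
      ≡⟨ cong (λ y → ∣ S a N - P a j * S b N ∣ + y) (trans (∣p*q∣≡∣p∣*∣q∣ s y) (trans (cong₂ _*_ (∣-1^n∣≡1 N) (0≤p⇒∣p∣≡p 0≤y)) (*-identityˡ y))) ⟩
    ∣ S a N - P a j * S b N ∣ + y
      ≤⟨ +-mono-≤ (S-P*S j N) (*-monoˡ (0≤ℕ→ℚ N) (Pw≤w j N)) ⟩
    ℕ→ℚ j * (ℕ→ℚ N * w a N) + ℕ→ℚ N * w a N
      ≡⟨ solve 2 (λ j y → j :* y :+ y := (j :+ con 1ℚ) :* y) refl (ℕ→ℚ j) (ℕ→ℚ N * w a N) ⟩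
    (ℕ→ℚ j + 1ℚ) * (ℕ→ℚ N * w a N)
      ≡⟨ cong (_* (ℕ→ℚ N * w a N)) (ℕ→ℚ-suc j) ⟨
    ℕ→ℚ (suc j) * (ℕ→ℚ N * w a N) ∎
    where
    open ≤-Reasoning
    b = a + ℕ→ℚ j
    0<b = 0<a+n 0<a j
    s = (- 1ℚ) ^ℚ N
    y = ℕ→ℚ N * (P a j * w b N)
    0≤y : 0ℚ ≤ y
    0≤y = 0≤* (0≤ℕ→ℚ N) (0≤* (0≤P j) (<⇒≤ (0<w 0<b N)))

signed-sum-suc : ∀ f N → partialSum (signed f) (suc N) ≡ f 0 - partialSum (signed (λ n → f (suc n))) N
signed-sum-suc f zero    = solve 1 (λ y → con 0ℚ :+ con 1ℚ :* y := y :- con 0ℚ) refl (f 0)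
signed-sum-suc f (suc N) = trans (cong (_+ - 1ℚ * s * f (suc N)) (signed-sum-suc f N))
  (solve 4 (λ y S s z → (y :- S) :+ con (- 1ℚ) :* s :* z := y :- (S :+ s :* z)) refl
    (f 0) (partialSum (signed (λ n → f (suc n))) N) s (f (suc N)))
  where s = (- 1ℚ) ^ℚ N

-- Leibniz' estimate. The induction peels off the first term, so that the rest is the same statement
-- for the shifted `f`.
signed-sum-bounds : ∀ f → (∀ n → 0ℚ ≤ f n) → (∀ n → f (suc n) ≤ f n) →
  ∀ N → 0ℚ ≤ partialSum (signed f) N × partialSum (signed f) N ≤ f 0
signed-sum-bounds f 0≤f f↓ zero    = ≤-refl , 0≤f 0
signed-sum-bounds f 0≤f f↓ (suc N) =
    subst (0ℚ ≤_) (sym (signed-sum-suc f N))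
      (subst (_≤ f 0 - T) (+-inverseʳ T) (+-monoˡ-≤ (- T) (≤-trans (proj₂ ih) (f↓ 0))))
  , subst (_≤ f 0) (sym (signed-sum-suc f N)) (x≤x+d T (proj₁ ih) (solve 2 (λ y t → y := (y :- t) :+ t) refl (f 0) T))
  where
  T = partialSum (signed (λ n → f (suc n))) N
  ih = signed-sum-bounds (λ n → f (suc n)) (λ n → 0≤f (suc n)) (λ n → f↓ (suc n)) N

module _ {a : ℚ} (1≤a : 1ℚ ≤ a) where

  private
    0<a : 0ℚ < a
    0<a = <-≤-trans 0<1 1≤a
    0≤a = <⇒≤ 0<a
    0≤a-1 : 0ℚ ≤ a - 1ℚ
    0≤a-1 = subst (_≤ a - 1ℚ) (+-inverseʳ 1ℚ) (+-monoˡ-≤ (- 1ℚ) 1≤a)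

  0≤magnitude : ∀ n → 0ℚ ≤ magnitude a n
  0≤magnitude n = 0≤* (0≤+ 0≤a (0≤* (0≤ℕ→ℚ 2) (0≤ℕ→ℚ n))) (<⇒≤ (0<w 0<a n))

  -- (a + 2n + 2)(n + ½) ≤ (a + 2n)(a + n + ½) and (a + n)(n + ½) ≤ (n + 1)(a + n + ½) when a ≥ 1
  magnitude-decreasing : ∀ n → magnitude a (suc n) ≤ magnitude a n
  magnitude-decreasing m = subst (λ ν → (a + ℕ→ℚ 2 * ν) * w a (suc m) ≤ magnitude a m) (sym (ℕ→ℚ-suc m)) (*-cancelʳ-≤ d (0<w-denominator 0<a m) (begin
    (a + ℕ→ℚ 2 * (n + 1ℚ)) * w a (suc m) * d
      ≡⟨ trans (*-assoc (a + ℕ→ℚ 2 * (n + 1ℚ)) (w a (suc m)) d) (cong ((a + ℕ→ℚ 2 * (n + 1ℚ)) *_) (w-suc 0<a m)) ⟩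
    (a + ℕ→ℚ 2 * (n + 1ℚ)) * (w a m * ((a + n) * ((n + ½) * (n + ½))))
      ≡⟨ solve 3 (λ a n v → (a :+ con (ℕ→ℚ 2) :* (n :+ con 1ℚ)) :* (v :* ((a :+ n) :* ((n :+ con ½) :* (n :+ con ½))))
           := v :* ((a :+ con (ℕ→ℚ 2) :* (n :+ con 1ℚ)) :* (n :+ con ½) :* ((a :+ n) :* (n :+ con ½)))) refl a n (w a m) ⟩
    w a m * ((a + ℕ→ℚ 2 * (n + 1ℚ)) * (n + ½) * ((a + n) * (n + ½)))
      ≤⟨ *-monoˡ (<⇒≤ (0<w 0<a m)) (*-mono-≤-nonNeg
           {(a + ℕ→ℚ 2 * (n + 1ℚ)) * (n + ½)} {(a + ℕ→ℚ 2 * n) * (a + n + ½)}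
           {(a + n) * (n + ½)} {(n + 1ℚ) * (a + n + ½)}
           (0≤* 0≤a+2n 0≤a+n+½) (0≤* (0≤+ 0≤a 0≤n) 0≤n+½)
           (x≤x+d (ℕ→ℚ 2 * (a - 1ℚ) * n + (a - 1ℚ) * (a + 1ℚ))
             (0≤+ (0≤* (0≤* (0≤ℕ→ℚ 2) 0≤a-1) 0≤n) (0≤* 0≤a-1 (<⇒≤ (0<a+1 0<a))))
             (solve 2 (λ a n → (a :+ con (ℕ→ℚ 2) :* n) :* (a :+ n :+ con ½)
               := (a :+ con (ℕ→ℚ 2) :* (n :+ con 1ℚ)) :* (n :+ con ½)
                  :+ (con (ℕ→ℚ 2) :* (a :- con 1ℚ) :* n :+ (a :- con 1ℚ) :* (a :+ con 1ℚ))) refl a n))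
           (x≤x+d (n + ½ * a + ½)
             (0≤+ (0≤+ 0≤n (0≤* (<⇒≤ 0<½) 0≤a)) (<⇒≤ 0<½))
             (solve 2 (λ a n → (n :+ con 1ℚ) :* (a :+ n :+ con ½)
               := (a :+ n) :* (n :+ con ½) :+ (n :+ con ½ :* a :+ con ½)) refl a n))) ⟩
    w a m * ((a + ℕ→ℚ 2 * n) * (a + n + ½) * ((n + 1ℚ) * (a + n + ½)))
      ≡⟨ solve 4 (λ v y z n → v :* (y :* z :* (n :* z)) := y :* v :* (n :* (z :* z))) refl (w a m) (a + ℕ→ℚ 2 * n) (a + n + ½) (n + 1ℚ) ⟩
    (a + ℕ→ℚ 2 * n) * w a m * d ∎))
    where
    open ≤-Reasoning
    n = ℕ→ℚ m
    d = (n + 1ℚ) * ((a + n + ½) * (a + n + ½))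
    0≤n = 0≤ℕ→ℚ m
    0≤n+½ = 0≤+ 0≤n (<⇒≤ 0<½)
    0≤a+2n = 0≤+ 0≤a (0≤* (0≤ℕ→ℚ 2) 0≤n)
    0≤a+n+½ = <⇒≤ (0<a+n+½ 0<a m)

  magnitude-0 : magnitude a 0 ≡ 1ℚ
  magnitude-0 = trans (cong (_* recip a) (+-identityʳ a)) (recip-inverse (0<⇒≢0 0<a))

  -- The second term is (a + 2)/(4 (a + ½)²), and a (a + 2) ≤ (2a + 1)².
  magnitude-1 : magnitude a 1 ≤ recip a
  magnitude-1 = *-cancelʳ-≤ (d * a) (0<x*y (0<w-denominator 0<a 0) 0<a) (begin
    (a + ℕ→ℚ 2) * w a 1 * (d * a)
      ≡⟨ solve 4 (λ y v d a → y :* v :* (d :* a) := y :* a :* (v :* d)) refl (a + ℕ→ℚ 2) (w a 1) d a ⟩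
    (a + ℕ→ℚ 2) * a * (w a 1 * d)
      ≡⟨ cong ((a + ℕ→ℚ 2) * a *_) (w-suc 0<a 0) ⟩
    (a + ℕ→ℚ 2) * a * (i * ((a + 0ℚ) * ((0ℚ + ½) * (0ℚ + ½))))
      ≡⟨ solve 2 (λ a i → (a :+ con (ℕ→ℚ 2)) :* a :* (i :* ((a :+ con 0ℚ) :* ((con 0ℚ :+ con ½) :* (con 0ℚ :+ con ½))))
           := (a :* i) :* (con ½ :* con ½ :* (a :* (a :+ con (ℕ→ℚ 2))))) refl a i ⟩
    (a * i) * (½ * ½ * (a * (a + ℕ→ℚ 2)))
      ≡⟨ trans (cong (_* (½ * ½ * (a * (a + ℕ→ℚ 2)))) (recip-inverse (0<⇒≢0 0<a))) (*-identityˡ _) ⟩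
    ½ * ½ * (a * (a + ℕ→ℚ 2))
      ≤⟨ x≤x+d (½ * ½ * (ℕ→ℚ 3 * (a * a) + ℕ→ℚ 2 * a + 1ℚ))
           (0≤* (<⇒≤ (0<x*y 0<½ 0<½)) (0≤+ (0≤+ (0≤* (0≤ℕ→ℚ 3) (0≤* 0≤a 0≤a)) (0≤* (0≤ℕ→ℚ 2) 0≤a)) (<⇒≤ 0<1)))
           (solve 1 (λ a → (con 0ℚ :+ con 1ℚ) :* ((a :+ con 0ℚ :+ con ½) :* (a :+ con 0ℚ :+ con ½))
              := con ½ :* con ½ :* (a :* (a :+ con (ℕ→ℚ 2)))
                 :+ con ½ :* con ½ :* (con (ℕ→ℚ 3) :* (a :* a) :+ con (ℕ→ℚ 2) :* a :+ con 1ℚ)) refl a) ⟩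
    d
      ≡⟨ trans (*-comm i (d * a)) (trans (*-assoc d a i) (trans (cong (d *_) (recip-inverse (0<⇒≢0 0<a))) (*-identityʳ d))) ⟨
    i * (d * a) ∎)
    where
    open ≤-Reasoning
    i = recip a
    d = (0ℚ + 1ℚ) * ((a + 0ℚ + ½) * (a + 0ℚ + ½))

  -- The first term is 1 and the alternating rest is at most its own first term. The bound is
  -- uniform in N, since a will grow while N is still free; `suc N` ensures that the first term is
  -- present.
  ∣S-1∣≤1/a : ∀ N → ∣ S a (suc N) - 1ℚ ∣ ≤ recip a
  ∣S-1∣≤1/a N = begin
    ∣ S a (suc N) - 1ℚ ∣  ≡⟨ cong (λ y → ∣ y - 1ℚ ∣) (trans (signed-sum-suc (magnitude a) N) (cong (_- T) magnitude-0)) ⟩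
    ∣ 1ℚ - T - 1ℚ ∣       ≡⟨ cong ∣_∣ (solve 1 (λ t → con 1ℚ :- t :- con 1ℚ := :- t) refl T) ⟩
    ∣ - T ∣               ≡⟨ ∣-p∣≡∣p∣ T ⟩
    ∣ T ∣                 ≡⟨ 0≤p⇒∣p∣≡p (proj₁ bounds) ⟩
    T                     ≤⟨ proj₂ bounds ⟩
    magnitude a 1                 ≤⟨ magnitude-1 ⟩
    recip a               ∎
    where
    open ≤-Reasoning
    T = partialSum (signed (λ n → magnitude a (suc n))) N
    bounds = signed-sum-bounds (λ n → magnitude a (suc n)) (λ n → 0≤magnitude (suc n)) (λ n → magnitude-decreasing (suc n)) N

module _ {a : ℚ} (½≤a : ½ ≤ a) (Nw→0 : Null (λ N → ℕ→ℚ N * w a N)) where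

  private
    0<a : 0ℚ < a
    0<a = <-≤-trans 0<½ ½≤a

  -- Shift M times, then replace S(a + M) by 1. For fixed M the first error vanishes as N grows, and
  -- the second vanishes as M grows: the iterated limit that `null-diagonal` makes diagonal. A
  -- positive M gives a + M ≥ 1, from where on the terms decrease.
  ∣S-P∣≤ : ∀ M N → ∣ S a (suc N) - P a (suc M) ∣
    ≤ ℕ→ℚ (suc M) * (ℕ→ℚ (suc N) * w a (suc N)) + recip (a + ℕ→ℚ (suc M))
  ∣S-P∣≤ M′ N′ = begin
    ∣ S a N - P a M ∣
      ≡⟨ cong ∣_∣ (solve 3 (λ s p t → s :- p := (s :- p :* t) :+ p :* (t :- con 1ℚ)) refl (S a N) (P a M) (S b N)) ⟩
    ∣ (S a N - P a M * S b N) + P a M * (S b N - 1ℚ) ∣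
      ≤⟨ ∣p+q∣≤∣p∣+∣q∣ (S a N - P a M * S b N) (P a M * (S b N - 1ℚ)) ⟩
    ∣ S a N - P a M * S b N ∣ + ∣ P a M * (S b N - 1ℚ) ∣
      ≤⟨ +-mono-≤ (S-P*S 0<a M N) (begin
           ∣ P a M * (S b N - 1ℚ) ∣      ≡⟨ ∣p*q∣≡∣p∣*∣q∣ (P a M) (S b N - 1ℚ) ⟩
           ∣ P a M ∣ * ∣ S b N - 1ℚ ∣    ≡⟨ cong (_* ∣ S b N - 1ℚ ∣) (0≤p⇒∣p∣≡p (0≤P 0<a M)) ⟩
           P a M * ∣ S b N - 1ℚ ∣        ≤⟨ *-mono-≤-nonNeg {P a M} {1ℚ} {∣ S b N - 1ℚ ∣} {recip b} (<⇒≤ 0<1) (0≤∣p∣ (S b N - 1ℚ)) (P≤1 0<a M) (∣S-1∣≤1/a 1≤b N′) ⟩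
           1ℚ * recip b                  ≡⟨ *-identityˡ (recip b) ⟩
           recip b                       ∎) ⟩
    ℕ→ℚ M * (ℕ→ℚ N * w a N) + recip b ∎
    where
    open ≤-Reasoning
    M = suc M′
    N = suc N′
    b = a + ℕ→ℚ M
    1≤b : 1ℚ ≤ b
    1≤b = ≤-trans (≤-reflexive (sym (+-identityˡ 1ℚ))) (+-mono-≤ (<⇒≤ 0<a) (x≤x+d (ℕ→ℚ M′) (0≤ℕ→ℚ M′) (ℕ→ℚ-+ 1 M′)))

  recip≤oddRecip : ∀ M → recip (a + ℕ→ℚ M) ≤ ℕ→ℚ 2 * oddRecip M
  recip≤oddRecip M = *-cancelʳ-≤ b 0<b (begin
    recip b * b                              ≡⟨ recip-inverseˡ (0<⇒≢0 0<b) ⟩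
    1ℚ                                       ≡⟨ oddRecip-inverse M ⟨
    oddRecip M * (ℕ→ℚ 2 * ℕ→ℚ M + 1ℚ)        ≡⟨ solve 2 (λ o m → o :* (con (ℕ→ℚ 2) :* m :+ con 1ℚ) := con (ℕ→ℚ 2) :* o :* (con ½ :+ m)) refl (oddRecip M) (ℕ→ℚ M) ⟩
    ℕ→ℚ 2 * oddRecip M * (½ + ℕ→ℚ M)         ≤⟨ *-monoˡ (0≤* (0≤ℕ→ℚ 2) (<⇒≤ (0<1/ (2 ℕ.* M)))) (+-monoˡ-≤ (ℕ→ℚ M) ½≤a) ⟩
    ℕ→ℚ 2 * oddRecip M * b                   ∎)
    where
    open ≤-Reasoning
    b = a + ℕ→ℚ M
    0<b = 0<a+n 0<a M

  S-P→0 : Null (λ n → S a n - P a n)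
  S-P→0 = null-diagonal {S a} {P a} λ ε 0<ε →
    mapₑ (λ { zero (() , _)
            ; (suc M) (_ , small) → mapₑ
                (λ { zero (() , _)
                   ; (suc N) (_ , tiny) → subst (∣ S a (suc N) - P a (suc M) ∣ ≤_) (½ε+½ε ε)
                       (≤-trans (∣S-P∣≤ M N) (+-mono-≤ {_} {½ * ε} {_} {½ * ε} (≤-trans (x≤∣x∣ _) tiny)
                         (≤-trans (recip≤oddRecip (suc M)) (≤-trans (x≤∣x∣ _) small)))) })
                ((1 , λ N 1≤N → 1≤N) ∧ₑ null-scale (ℕ→ℚ (suc M)) Nw→0 (½ * ε) (0<½* 0<ε)) })
      ((1 , λ M 1≤M → 1≤M) ∧ₑ null-scale (ℕ→ℚ 2) null-oddRecip (½ * ε) (0<½* 0<ε))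

-- The values a = ½ and a = 1

centralBinomial : ℕ → ℕ
centralBinomial n = (2 ℕ.* n) C n

centralBinomial-! : ∀ n → centralBinomial n ℕ.* (n ! ℕ.* n !) ≡ (2 ℕ.* n) !
centralBinomial-! n = subst (λ k → centralBinomial n ℕ.* (n ! ℕ.* k !) ≡ (2 ℕ.* n) !)
  (trans (ℕₚ.m+n∸m≡n n (n ℕ.+ 0)) (ℕₚ.+-identityʳ n))
  (trans (cong (ℕ._* (n ! ℕ.* (2 ℕ.* n ℕ.∸ n) !)) (nCk≡n!/k![n-k]! n≤2n))
         (ℕ.m/n*n≡m {{n ℕₚ.!* (2 ℕ.* n ℕ.∸ n) !≢0}} (k![n∸k]!∣n! n≤2n)))
  where n≤2n = ℕₚ.m≤m+n n (n ℕ.+ 0)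

centralBinomial-suc : ∀ n → centralBinomial (suc n) ℕ.* suc n ≡ 2 ℕ.* suc (2 ℕ.* n) ℕ.* centralBinomial n
centralBinomial-suc n = ℕₚ.*-cancelʳ-≡ _ _ (suc n ℕ.* (n ! ℕ.* n !)) {{nz}} (begin
  C′ ℕ.* suc n ℕ.* (suc n ℕ.* (n ! ℕ.* n !))
    ≡⟨ N.solve 3 (λ c m f → c N.:* m N.:* (m N.:* (f N.:* f)) N.:= c N.:* ((m N.:* f) N.:* (m N.:* f))) refl C′ (suc n) (n !) ⟩
  C′ ℕ.* (suc n ! ℕ.* suc n !)
    ≡⟨ centralBinomial-! (suc n) ⟩
  (2 ℕ.* suc n) !
    ≡⟨ cong _! (cong suc (ℕₚ.+-suc n (n ℕ.+ 0))) ⟩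
  suc (suc (2 ℕ.* n)) ℕ.* (suc (2 ℕ.* n) ℕ.* (2 ℕ.* n) !)
    ≡⟨ cong (λ f → suc (suc (2 ℕ.* n)) ℕ.* (suc (2 ℕ.* n) ℕ.* f)) (centralBinomial-! n) ⟨
  suc (suc (2 ℕ.* n)) ℕ.* (suc (2 ℕ.* n) ℕ.* (C₀ ℕ.* (n ! ℕ.* n !)))
    ≡⟨ N.solve 3 (λ n c f → (N.con 2 N.:+ N.con 2 N.:* n) N.:* ((N.con 1 N.:+ N.con 2 N.:* n) N.:* (c N.:* (f N.:* f)))
         N.:= N.con 2 N.:* (N.con 1 N.:+ N.con 2 N.:* n) N.:* c N.:* ((N.con 1 N.:+ n) N.:* (f N.:* f))) refl n C₀ (n !) ⟩
  2 ℕ.* suc (2 ℕ.* n) ℕ.* C₀ ℕ.* (suc n ℕ.* (n ! ℕ.* n !)) ∎)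
  where
  module N = Data.Nat.Solver.+-*-Solver
  open ≡-Reasoning
  C₀ = centralBinomial n
  C′ = centralBinomial (suc n)
  nz = ℕₚ.m*n≢0 (suc n) (n ! ℕ.* n !) {{_}} {{n ℕₚ.!* n !≢0}}

b : ℕ → ℚ
b = centralBinomial/4^

b-suc : ∀ n → (ℕ→ℚ n + 1ℚ) * b (suc n) ≡ (ℕ→ℚ n + ½) * b n
b-suc n = *-cancelʳ-≢0 (ℕ→ℚ 4 * f) (0<⇒≢0 (0<x*y (positive⁻¹ (ℕ→ℚ 4)) 0<f)) (begin
  (ℕ→ℚ n + 1ℚ) * b (suc n) * (ℕ→ℚ 4 * f)
    ≡⟨ solve 3 (λ n y f → n :* y :* f := y :* f :* n) refl (ℕ→ℚ n + 1ℚ) (b (suc n)) (ℕ→ℚ 4 * f) ⟩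
  b (suc n) * (ℕ→ℚ 4 * f) * (ℕ→ℚ n + 1ℚ)
    ≡⟨ cong₂ (λ g h → b (suc n) * g * h) (ℕ→ℚ-* 4 (4 ℕ.^ n)) (ℕ→ℚ-suc n) ⟨
  b (suc n) * ℕ→ℚ (4 ℕ.^ suc n) * ℕ→ℚ (suc n)
    ≡⟨ cong (_* ℕ→ℚ (suc n)) (i/n*n≡i (+ centralBinomial (suc n)) (4 ℕ.^ suc n) {{ℕₚ.m^n≢0 4 (suc n)}}) ⟩
  ℕ→ℚ (centralBinomial (suc n)) * ℕ→ℚ (suc n)
    ≡⟨ ℕ→ℚ-* (centralBinomial (suc n)) (suc n) ⟨
  ℕ→ℚ (centralBinomial (suc n) ℕ.* suc n)
    ≡⟨ cong ℕ→ℚ (centralBinomial-suc n) ⟩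
  ℕ→ℚ (2 ℕ.* suc (2 ℕ.* n) ℕ.* centralBinomial n)
    ≡⟨ trans (ℕ→ℚ-* (2 ℕ.* suc (2 ℕ.* n)) (centralBinomial n)) (cong (_* ℕ→ℚ (centralBinomial n)) (ℕ→ℚ-* 2 (suc (2 ℕ.* n)))) ⟩
  ℕ→ℚ 2 * ℕ→ℚ (suc (2 ℕ.* n)) * ℕ→ℚ (centralBinomial n)
    ≡⟨ cong₂ (λ g h → ℕ→ℚ 2 * g * h) (trans (ℕ→ℚ-suc (2 ℕ.* n)) (cong (_+ 1ℚ) (ℕ→ℚ-* 2 n)))
         (sym (i/n*n≡i (+ centralBinomial n) (4 ℕ.^ n) {{ℕₚ.m^n≢0 4 n}})) ⟩
  ℕ→ℚ 2 * (ℕ→ℚ 2 * ℕ→ℚ n + 1ℚ) * (b n * f)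
    ≡⟨ solve 3 (λ n y f → con (ℕ→ℚ 2) :* (con (ℕ→ℚ 2) :* n :+ con 1ℚ) :* (y :* f) := (n :+ con ½) :* y :* (con (ℕ→ℚ 4) :* f)) refl (ℕ→ℚ n) (b n) f ⟩
  (ℕ→ℚ n + ½) * b n * (ℕ→ℚ 4 * f) ∎)
  where
  open ≡-Reasoning
  f = ℕ→ℚ (4 ℕ.^ n)
  0<f : 0ℚ < f
  0<f = positive⁻¹ f {{normalize-pos (4 ℕ.^ n) 1 {{_}} {{ℕₚ.m^n≢0 4 n}}}}

0≤b : ∀ n → 0ℚ ≤ b n
0≤b n = nonNegative⁻¹ (b n) {{normalize-nonNeg (centralBinomial n) (4 ℕ.^ n) {{ℕₚ.m^n≢0 4 n}}}}

n+1≢0 : ∀ n → ℕ→ℚ n + 1ℚ ≢ 0ℚ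
n+1≢0 n = 0<⇒≢0 (0<n+1 n)

-- Wallis' product: the factors are ρ(½ + m) = (m + ½)(m + 3/2)/(m + 1)², and b (m + 1) is b m times
-- (m + ½)/(m + 1).
P½ : ∀ n → P ½ n ≡ b n * b n * (ℕ→ℚ 2 * ℕ→ℚ n + 1ℚ)
P½ zero = refl
P½ (suc m) = subst (λ ν → P ½ (suc m) ≡ b (suc m) * b (suc m) * (ℕ→ℚ 2 * ν + 1ℚ)) (sym (ℕ→ℚ-suc m)) (*-cancelʳ-≢0 ((n + 1ℚ) * (n + 1ℚ)) (x*y≢0 (n+1≢0 m) (n+1≢0 m)) (begin
  P ½ m * ρ (½ + n) * ((n + 1ℚ) * (n + 1ℚ))
    ≡⟨ solve 3 (λ p r n → p :* r :* ((n :+ con 1ℚ) :* (n :+ con 1ℚ)) := p :* (r :* ((con ½ :+ n :+ con ½) :* (con ½ :+ n :+ con ½)))) refl (P ½ m) (ρ (½ + n)) n ⟩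
  P ½ m * (ρ (½ + n) * ((½ + n + ½) * (½ + n + ½)))
    ≡⟨ cong₂ _*_ (P½ m) (ρ-def (0<a+n 0<½ m)) ⟩
  b m * b m * (ℕ→ℚ 2 * n + 1ℚ) * ((½ + n) * (½ + n + 1ℚ))
    ≡⟨ solve 2 (λ y n → y :* y :* (con (ℕ→ℚ 2) :* n :+ con 1ℚ) :* ((con ½ :+ n) :* (con ½ :+ n :+ con 1ℚ))
         := ((n :+ con ½) :* y) :* ((n :+ con ½) :* y) :* (con (ℕ→ℚ 2) :* (n :+ con 1ℚ) :+ con 1ℚ)) refl (b m) n ⟩
  ((n + ½) * b m) * ((n + ½) * b m) * (ℕ→ℚ 2 * (n + 1ℚ) + 1ℚ)
    ≡⟨ cong (λ y → y * y * (ℕ→ℚ 2 * (n + 1ℚ) + 1ℚ)) (b-suc m) ⟨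
  ((n + 1ℚ) * b (suc m)) * ((n + 1ℚ) * b (suc m)) * (ℕ→ℚ 2 * (n + 1ℚ) + 1ℚ)
    ≡⟨ solve 3 (λ y n z → (n :* y) :* (n :* y) :* z := y :* y :* z :* (n :* n)) refl (b (suc m)) (n + 1ℚ) (ℕ→ℚ 2 * (n + 1ℚ) + 1ℚ) ⟩
  b (suc m) * b (suc m) * (ℕ→ℚ 2 * (n + 1ℚ) + 1ℚ) * ((n + 1ℚ) * (n + 1ℚ)) ∎))
  where
  open ≡-Reasoning
  n = ℕ→ℚ m

-- The factors of the two products telescope against each other: ρ(½ + m) ρ(1 + m) = ((m + ½)/(m +
-- 3/2)) ((m + 2)/(m + 1)).
P₁*P½ : ∀ n → P ½ n * P 1ℚ n * (ℕ→ℚ 2 * ℕ→ℚ n + 1ℚ) ≡ ℕ→ℚ n + 1ℚ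
P₁*P½ zero = refl
P₁*P½ (suc m) = subst (λ ν → P ½ (suc m) * P 1ℚ (suc m) * (ℕ→ℚ 2 * ν + 1ℚ) ≡ ν + 1ℚ) (sym (ℕ→ℚ-suc m)) (*-cancelʳ-≢0 (d * e) (x*y≢0 (0<⇒≢0 (0<[a+n+½]² 0<½ m)) (0<⇒≢0 (0<[a+n+½]² 0<1 m))) (begin
  P ½ m * ρ (½ + n) * (P 1ℚ m * ρ (1ℚ + n)) * (ℕ→ℚ 2 * (n + 1ℚ) + 1ℚ) * (d * e)
    ≡⟨ solve 7 (λ p r q s z d e → p :* r :* (q :* s) :* z :* (d :* e) := p :* q :* ((r :* d) :* (s :* e)) :* z) refl
         (P ½ m) (ρ (½ + n)) (P 1ℚ m) (ρ (1ℚ + n)) (ℕ→ℚ 2 * (n + 1ℚ) + 1ℚ) d e ⟩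
  P ½ m * P 1ℚ m * ((ρ (½ + n) * d) * (ρ (1ℚ + n) * e)) * (ℕ→ℚ 2 * (n + 1ℚ) + 1ℚ)
    ≡⟨ cong₂ (λ y z → P ½ m * P 1ℚ m * (y * z) * (ℕ→ℚ 2 * (n + 1ℚ) + 1ℚ)) (ρ-def (0<a+n 0<½ m)) (ρ-def (0<a+n 0<1 m)) ⟩
  P ½ m * P 1ℚ m * (((½ + n) * (½ + n + 1ℚ)) * ((1ℚ + n) * (1ℚ + n + 1ℚ))) * (ℕ→ℚ 2 * (n + 1ℚ) + 1ℚ)
    ≡⟨ solve 3 (λ p q n → p :* q :* (((con ½ :+ n) :* (con ½ :+ n :+ con 1ℚ)) :* ((con 1ℚ :+ n) :* (con 1ℚ :+ n :+ con 1ℚ))) :* (con (ℕ→ℚ 2) :* (n :+ con 1ℚ) :+ con 1ℚ)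
         := p :* q :* (con (ℕ→ℚ 2) :* n :+ con 1ℚ) :* ((n :+ con 1ℚ) :* (n :+ con 1ℚ :+ con 1ℚ) :* ((con 1ℚ :+ n :+ con ½) :* (con 1ℚ :+ n :+ con ½)))) refl (P ½ m) (P 1ℚ m) n ⟩
  P ½ m * P 1ℚ m * (ℕ→ℚ 2 * n + 1ℚ) * ((n + 1ℚ) * (n + 1ℚ + 1ℚ) * e)
    ≡⟨ cong (_* ((n + 1ℚ) * (n + 1ℚ + 1ℚ) * e)) (P₁*P½ m) ⟩
  (n + 1ℚ) * ((n + 1ℚ) * (n + 1ℚ + 1ℚ) * e)
    ≡⟨ solve 2 (λ n e → (n :+ con 1ℚ) :* ((n :+ con 1ℚ) :* (n :+ con 1ℚ :+ con 1ℚ) :* e)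
         := (n :+ con 1ℚ :+ con 1ℚ) :* ((con ½ :+ n :+ con ½) :* (con ½ :+ n :+ con ½) :* e)) refl n e ⟩
  (n + 1ℚ + 1ℚ) * (d * e) ∎))
  where
  open ≡-Reasoning
  n = ℕ→ℚ m
  d = (½ + n + ½) * (½ + n + ½)
  e = (1ℚ + n + ½) * (1ℚ + n + ½)

-- At a = ½ the symbols (a)ₙ and (½)ₙ coincide and (a + ½)ₙ is n!, which leaves 2 ((½)ₙ/n!)³.
w½ : ∀ n → w ½ n ≡ ℕ→ℚ 2 * b n ^ℚ 3
w½ zero = refl
w½ (suc m) = *-cancelʳ-≢0 d (0<⇒≢0 (0<w-denominator 0<½ m)) (begin
  w ½ (suc m) * d
    ≡⟨ w-suc 0<½ m ⟩
  w ½ m * ((½ + n) * ((n + ½) * (n + ½)))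
    ≡⟨ cong (_* ((½ + n) * ((n + ½) * (n + ½)))) (w½ m) ⟩
  ℕ→ℚ 2 * b m ^ℚ 3 * ((½ + n) * ((n + ½) * (n + ½)))
    ≡⟨ solve 2 (λ y n → con (ℕ→ℚ 2) :* (y :* (y :* (y :* con 1ℚ))) :* ((con ½ :+ n) :* ((n :+ con ½) :* (n :+ con ½)))
         := con (ℕ→ℚ 2) :* (((n :+ con ½) :* y) :* (((n :+ con ½) :* y) :* ((n :+ con ½) :* y)))) refl (b m) n ⟩
  ℕ→ℚ 2 * (((n + ½) * b m) * (((n + ½) * b m) * ((n + ½) * b m)))
    ≡⟨ cong (λ y → ℕ→ℚ 2 * (y * (y * y))) (b-suc m) ⟨
  ℕ→ℚ 2 * (((n + 1ℚ) * b (suc m)) * (((n + 1ℚ) * b (suc m)) * ((n + 1ℚ) * b (suc m))))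
    ≡⟨ solve 2 (λ y n → con (ℕ→ℚ 2) :* (((n :+ con 1ℚ) :* y) :* (((n :+ con 1ℚ) :* y) :* ((n :+ con 1ℚ) :* y)))
         := con (ℕ→ℚ 2) :* (y :* (y :* (y :* con 1ℚ))) :* ((n :+ con 1ℚ) :* ((con ½ :+ n :+ con ½) :* (con ½ :+ n :+ con ½)))) refl (b (suc m)) n ⟩
  ℕ→ℚ 2 * b (suc m) ^ℚ 3 * d ∎)
  where
  open ≡-Reasoning
  n = ℕ→ℚ m
  d = (n + 1ℚ) * ((½ + n + ½) * (½ + n + ½))

0<2n+1 : ∀ n → 0ℚ < ℕ→ℚ 2 * ℕ→ℚ n + 1ℚ
0<2n+1 n = +-mono-≤-< {0ℚ} {_} {0ℚ} (0≤* (0≤ℕ→ℚ 2) (0≤ℕ→ℚ n)) 0<1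

-- At a = 1 the symbol (a)ₙ cancels n!, which leaves ((½)ₙ/(3/2)ₙ)², a telescoping product.
w₁ : ∀ n → w 1ℚ n ≡ oddRecip n * oddRecip n
w₁ zero = refl
w₁ (suc m) = *-cancelʳ-≢0 (d * (k * k)) (x*y≢0 (0<⇒≢0 (0<w-denominator 0<1 m)) (x*y≢0 k≢0 k≢0)) (begin
  w 1ℚ (suc m) * (d * (k * k))
    ≡⟨ trans (sym (*-assoc (w 1ℚ (suc m)) d (k * k))) (cong (_* (k * k)) (w-suc 0<1 m)) ⟩
  w 1ℚ m * ((1ℚ + n) * ((n + ½) * (n + ½))) * (k * k)
    ≡⟨ cong (λ y → y * ((1ℚ + n) * ((n + ½) * (n + ½))) * (k * k)) (w₁ m) ⟩
  oddRecip m * oddRecip m * ((1ℚ + n) * ((n + ½) * (n + ½))) * (k * k)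
    ≡⟨ solve 2 (λ o n → let k = con (ℕ→ℚ 2) :* (n :+ con 1ℚ) :+ con 1ℚ in
           o :* o :* ((con 1ℚ :+ n) :* ((n :+ con ½) :* (n :+ con ½))) :* (k :* k)
         := (o :* (con (ℕ→ℚ 2) :* n :+ con 1ℚ)) :* (o :* (con (ℕ→ℚ 2) :* n :+ con 1ℚ)) :* ((n :+ con 1ℚ) :* ((con 1ℚ :+ n :+ con ½) :* (con 1ℚ :+ n :+ con ½)))) refl (oddRecip m) n ⟩
  (oddRecip m * (ℕ→ℚ 2 * n + 1ℚ)) * (oddRecip m * (ℕ→ℚ 2 * n + 1ℚ)) * d
    ≡⟨ cong (λ y → y * y * d) (trans (oddRecip-inverse m) (sym inverse′)) ⟩
  (oddRecip (suc m) * k) * (oddRecip (suc m) * k) * d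
    ≡⟨ solve 3 (λ o k d → (o :* k) :* (o :* k) :* d := o :* o :* (d :* (k :* k))) refl (oddRecip (suc m)) k d ⟩
  oddRecip (suc m) * oddRecip (suc m) * (d * (k * k)) ∎)
  where
  open ≡-Reasoning
  n = ℕ→ℚ m
  d = (n + 1ℚ) * ((1ℚ + n + ½) * (1ℚ + n + ½))
  k = ℕ→ℚ 2 * (n + 1ℚ) + 1ℚ
  inverse′ : oddRecip (suc m) * k ≡ 1ℚ
  inverse′ = subst (λ y → oddRecip (suc m) * (ℕ→ℚ 2 * y + 1ℚ) ≡ 1ℚ) (ℕ→ℚ-suc m) (oddRecip-inverse (suc m))
  k≢0 : k ≢ 0ℚ
  k≢0 k≡0 = 1≢0 (trans (sym inverse′) (trans (cong (oddRecip (suc m) *_) k≡0) (*-zeroʳ (oddRecip (suc m)))))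

magnitude₁ : ∀ n → magnitude 1ℚ n ≡ oddRecip n
magnitude₁ m = trans (cong ((1ℚ + ℕ→ℚ 2 * n) *_) (w₁ m))
  (trans (solve 2 (λ o n → (con 1ℚ :+ con (ℕ→ℚ 2) :* n) :* (o :* o) := o :* (con (ℕ→ℚ 2) :* n :+ con 1ℚ) :* o) refl (oddRecip m) n)
  (trans (cong (_* oddRecip m) (oddRecip-inverse m)) (*-identityˡ (oddRecip m))))
  where n = ℕ→ℚ m

partialSum-cong : ∀ {f g} → (∀ n → f n ≡ g n) → ∀ N → partialSum f N ≡ partialSum g N
partialSum-cong f≗g zero    = refl
partialSum-cong f≗g (suc N) = cong₂ _+_ (partialSum-cong f≗g N) (f≗g N)

0≤oddRecip : ∀ n → 0ℚ ≤ oddRecip n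
0≤oddRecip n = <⇒≤ (0<1/ (2 ℕ.* n))

P½-bound : Bound (P ½)
P½-bound = ≤1-bound {P ½} (0≤P 0<½) (P≤1 0<½)

-- Separates the bounded Wallis product from the decay 1/(2n + 1): b tends to 0, and n b² inherits a
-- bound and a limit.
b²≡P½*oddRecip : ∀ n → b n * b n ≡ P ½ n * oddRecip n
b²≡P½*oddRecip n = sym (begin
  P ½ n * oddRecip n                                       ≡⟨ cong (_* oddRecip n) (P½ n) ⟩
  b n * b n * k * oddRecip n                               ≡⟨ solve 3 (λ y k o → y :* k :* o := y :* (o :* k)) refl (b n * b n) k (oddRecip n) ⟩
  b n * b n * (oddRecip n * k)                             ≡⟨ cong (b n * b n *_) (oddRecip-inverse n) ⟩
  b n * b n * 1ℚ                                           ≡⟨ *-identityʳ (b n * b n) ⟩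
  b n * b n                                                ∎)
  where
  open ≡-Reasoning
  k = ℕ→ℚ 2 * ℕ→ℚ n + 1ℚ

null-b : Null b
null-b = null-square 0≤b (null-≗ b²≡P½*oddRecip (null-bounded-* P½-bound null-oddRecip))

n*oddRecip-bound : Bound (λ n → ℕ→ℚ n * oddRecip n)
n*oddRecip-bound = ≤1-bound (λ n → 0≤* (0≤ℕ→ℚ n) (0≤oddRecip n)) (λ n → subst (ℕ→ℚ n * oddRecip n ≤_) (oddRecip-inverse n)
  (x≤x+d ((ℕ→ℚ n + 1ℚ) * oddRecip n) (0≤* (<⇒≤ (0<n+1 n)) (0≤oddRecip n))
    (solve 2 (λ o n → o :* (con (ℕ→ℚ 2) :* n :+ con 1ℚ) := n :* o :+ (n :+ con 1ℚ) :* o) refl (oddRecip n) (ℕ→ℚ n))))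

leibniz-P₁ : Null (λ N → partialSum leibnizTerm N - P 1ℚ N)
leibniz-P₁ = null-≗ (λ N → cong (_- P 1ℚ N) (partialSum-cong (λ n → cong ((- 1ℚ) ^ℚ n *_) (sym (magnitude₁ n))) N))
  (S-P→0 {1ℚ} (x≤x+d ½ (<⇒≤ 0<½) refl)
    (null-≗ (λ n → trans (cong (ℕ→ℚ n *_) (w₁ n)) (sym (*-assoc (ℕ→ℚ n) (oddRecip n) (oddRecip n))))
      (null-bounded-* n*oddRecip-bound null-oddRecip)))

bauer-P½ : Null (λ N → S ½ N - P ½ N)
bauer-P½ = S-P→0 {½} ≤-refl
  (null-≗ (λ n → begin
      ℕ→ℚ n * w ½ n                                          ≡⟨ cong (ℕ→ℚ n *_) (w½ n) ⟩
      ℕ→ℚ n * (ℕ→ℚ 2 * b n ^ℚ 3)                             ≡⟨ solve 2 (λ n y → n :* (con (ℕ→ℚ 2) :* (y :* (y :* (y :* con 1ℚ)))) := con (ℕ→ℚ 2) :* n :* (y :* y) :* y) refl (ℕ→ℚ n) (b n) ⟩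
      ℕ→ℚ 2 * ℕ→ℚ n * (b n * b n) * b n                      ≡⟨ cong (λ y → ℕ→ℚ 2 * ℕ→ℚ n * y * b n) (b²≡P½*oddRecip n) ⟩
      ℕ→ℚ 2 * ℕ→ℚ n * (P ½ n * oddRecip n) * b n             ≡⟨ solve 4 (λ n p o y → con (ℕ→ℚ 2) :* n :* (p :* o) :* y := con (ℕ→ℚ 2) :* (p :* (n :* o)) :* y) refl (ℕ→ℚ n) (P ½ n) (oddRecip n) (b n) ⟩
      ℕ→ℚ 2 * (P ½ n * (ℕ→ℚ n * oddRecip n)) * b n           ∎)
    (null-bounded-* (bound-* (bound-const (ℕ→ℚ 2)) (bound-* P½-bound n*oddRecip-bound)) null-b))
  where open ≡-Reasoning

-- Let L be the Leibniz partial sum. Once the approximants of π are bounded away from 0, their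
-- reciprocal i satisfies 4 L i = 1. As P ½ · P 1 = (n + 1)/(2n + 1), the difference equals i (4 P ½
-- (L - P 1) + 2/(2n + 1)).
P½-2/π : Null (λ N → P ½ N - ℕ→ℚ 2 * seq 1/π N)
P½-2/π = null-dominated
  (mapₑ (λ n h → ≤-reflexive (cong ∣_∣ (eq n h))) (proj₂ (proj₂ π-apart₀)))
  (null-bounded-* (cauchy-bound (seq 1/π) (cauchy 1/π))
    (null-+ (null-bounded-* (bound-* (bound-const (ℕ→ℚ 4)) P½-bound) leibniz-P₁) (null-scale (ℕ→ℚ 2) null-oddRecip)))
  where
  open ≡-Reasoning
  P½P₁ : ∀ n → P ½ n * P 1ℚ n ≡ oddRecip n * (ℕ→ℚ n + 1ℚ)
  P½P₁ n = *-cancelʳ-≢0 k (0<⇒≢0 (0<2n+1 n)) (begin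
    P ½ n * P 1ℚ n * k                ≡⟨ P₁*P½ n ⟩
    ℕ→ℚ n + 1ℚ                        ≡⟨ *-identityˡ (ℕ→ℚ n + 1ℚ) ⟨
    1ℚ * (ℕ→ℚ n + 1ℚ)                 ≡⟨ cong (_* (ℕ→ℚ n + 1ℚ)) (oddRecip-inverse n) ⟨
    oddRecip n * k * (ℕ→ℚ n + 1ℚ)     ≡⟨ solve 3 (λ o k n → o :* k :* n := o :* n :* k) refl (oddRecip n) k (ℕ→ℚ n + 1ℚ) ⟩
    oddRecip n * (ℕ→ℚ n + 1ℚ) * k     ∎)
    where k = ℕ→ℚ 2 * ℕ→ℚ n + 1ℚ
  eq : ∀ n → 1ℚ ≤ ∣ seq π n ∣ → P ½ n - ℕ→ℚ 2 * seq 1/π n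
     ≡ seq 1/π n * (ℕ→ℚ 4 * P ½ n * (partialSum leibnizTerm n - P 1ℚ n) + ℕ→ℚ 2 * oddRecip n)
  eq n 1≤π = begin
    p - ℕ→ℚ 2 * i
      ≡⟨ solve 2 (λ p i → p :- con (ℕ→ℚ 2) :* i := p :* con 1ℚ :- con (ℕ→ℚ 2) :* i :* con 1ℚ) refl p i ⟩
    p * 1ℚ - ℕ→ℚ 2 * i * 1ℚ
      ≡⟨ cong₂ (λ y z → p * y - ℕ→ℚ 2 * i * z) (recip-inverse (δ≤∣q∣⇒q≢0 0<1 1≤π)) (oddRecip-inverse n) ⟨
    p * (ℕ→ℚ 4 * L * i) - ℕ→ℚ 2 * i * (o * (ℕ→ℚ 2 * ℕ→ℚ n + 1ℚ))
      ≡⟨ solve 5 (λ p L i o n → p :* (con (ℕ→ℚ 4) :* L :* i) :- con (ℕ→ℚ 2) :* i :* (o :* (con (ℕ→ℚ 2) :* n :+ con 1ℚ))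
           := i :* (con (ℕ→ℚ 4) :* p :* L :- con (ℕ→ℚ 4) :* (o :* (n :+ con 1ℚ)) :+ con (ℕ→ℚ 2) :* o)) refl p L i o (ℕ→ℚ n) ⟩
    i * (ℕ→ℚ 4 * p * L - ℕ→ℚ 4 * (o * (ℕ→ℚ n + 1ℚ)) + ℕ→ℚ 2 * o)
      ≡⟨ cong (λ y → i * (ℕ→ℚ 4 * p * L - ℕ→ℚ 4 * y + ℕ→ℚ 2 * o)) (P½P₁ n) ⟨
    i * (ℕ→ℚ 4 * p * L - ℕ→ℚ 4 * (p * q) + ℕ→ℚ 2 * o)
      ≡⟨ solve 5 (λ p L i o q → i :* (con (ℕ→ℚ 4) :* p :* L :- con (ℕ→ℚ 4) :* (p :* q) :+ con (ℕ→ℚ 2) :* o)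
           := i :* (con (ℕ→ℚ 4) :* p :* (L :- q) :+ con (ℕ→ℚ 2) :* o)) refl p L i o q ⟩
    i * (ℕ→ℚ 4 * p * (L - q) + ℕ→ℚ 2 * o) ∎
    where
    p = P ½ n
    q = P 1ℚ n
    L = partialSum leibnizTerm n
    i = seq 1/π n
    o = oddRecip n

-- Telescoping

r : ℕ → ℕ → ℚ
r k n = recip ((ℕ→ℚ n + ℕ→ℚ k) * (ℕ→ℚ n - ℕ→ℚ k + ½))

q : ℕ → ℕ → ℚ
q k n = recip ((ℕ→ℚ n + ℕ→ℚ k) * (ℕ→ℚ n - ℕ→ℚ k - ½))

halfInteger : ∀ k → + suc (2 ℕ.* k) / 2 ≡ ℕ→ℚ k + ½
halfInteger k = *-cancelʳ-≢0 (ℕ→ℚ 2) (0<⇒≢0 (positive⁻¹ (ℕ→ℚ 2))) (begin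
  + suc (2 ℕ.* k) / 2 * ℕ→ℚ 2    ≡⟨ i/n*n≡i (+ suc (2 ℕ.* k)) 2 ⟩
  ℕ→ℚ (suc (2 ℕ.* k))            ≡⟨ trans (ℕ→ℚ-suc (2 ℕ.* k)) (cong (_+ 1ℚ) (ℕ→ℚ-* 2 k)) ⟩
  ℕ→ℚ 2 * ℕ→ℚ k + 1ℚ             ≡⟨ solve 1 (λ k → con (ℕ→ℚ 2) :* k :+ con 1ℚ := (k :+ con ½) :* con (ℕ→ℚ 2)) refl (ℕ→ℚ k) ⟩
  (ℕ→ℚ k + ½) * ℕ→ℚ 2            ∎)
  where open ≡-Reasoning

n-k-½≢0 : ∀ n k → ℕ→ℚ n - ℕ→ℚ k - ½ ≢ 0ℚ
n-k-½≢0 n k eq = n-admissible≢0 n (positiveHalfInteger k) (trans (cong (λ y → ℕ→ℚ n - y) (halfInteger k))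
  (trans (solve 2 (λ n k → n :- (k :+ con ½) := n :- k :- con ½) refl (ℕ→ℚ n) (ℕ→ℚ k)) eq))

n-k+½≢0 : ∀ n k → ℕ→ℚ n - ℕ→ℚ k + ½ ≢ 0ℚ
n-k+½≢0 n k eq = n-k-½≢0 (suc n) k (trans (cong (λ y → y - ℕ→ℚ k - ½) (ℕ→ℚ-suc n))
  (trans (solve 2 (λ n k → n :+ con 1ℚ :- k :- con ½ := n :- k :+ con ½) refl (ℕ→ℚ n) (ℕ→ℚ k)) eq))

n+k≢0 : ∀ n k → (n ≡ 0 → k ≢ 0) → ℕ→ℚ n + ℕ→ℚ k ≢ 0ℚ
n+k≢0 zero    zero    h = ⊥-elim (h refl refl)
n+k≢0 zero    (suc k) h = 0<⇒≢0 (subst (0ℚ <_) (trans (sym (ℕ→ℚ-suc k)) (sym (+-identityˡ (ℕ→ℚ (suc k))))) (0<n+1 k))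
n+k≢0 (suc n) k       h = 0<⇒≢0 (0<+≤ (subst (0ℚ <_) (sym (ℕ→ℚ-suc n)) (0<n+1 n)) (0≤ℕ→ℚ k))

-- Brings the fractions to a common denominator, after which the identities below are polynomial.
recip-expand : ∀ d e D → e ≢ 0ℚ → d * e ≡ D → recip d ≡ e * recip D
recip-expand d e D e≢0 refl = sym (begin
  e * recip (d * e)          ≡⟨ cong (e *_) (recip-* d e) ⟩
  e * (recip d * recip e)    ≡⟨ solve 3 (λ e i j → e :* (i :* j) := i :* (e :* j)) refl e (recip d) (recip e) ⟩
  recip d * (e * recip e)    ≡⟨ cong (recip d *_) (recip-inverse e≢0) ⟩
  recip d * 1ℚ               ≡⟨ *-identityʳ (recip d) ⟩
  recip d                    ∎)
  where open ≡-Reasoning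

-- With U = (n + ½)² q k (n + 1) and V = n² q k n, the first two describe U - V and U + V. These
-- combine to (n + ½) U + n V for the cubes and to U² - V² for the squares of q; the differences
-- carry the weight 4n + 1. As named types, they can be shared by the generic case and the case n =
-- k = 0.
DifferenceIdentity₂ SumIdentity₂ DifferenceIdentity₄ : ℕ → ℕ → Set
DifferenceIdentity₂ m l = let n = ℕ→ℚ m; k = ℕ→ℚ l in
  (ℕ→ℚ 4 * k + 1ℚ) * ((n + ½) * (n + ½) * q l (suc m) - n * n * q l m)
    ≡ (ℕ→ℚ 4 * n + 1ℚ) * (k * k * r l m - (k + ½) * (k + ½) * r (suc l) m)
SumIdentity₂ m l = let n = ℕ→ℚ m; k = ℕ→ℚ l in
  (ℕ→ℚ 4 * k + 1ℚ) * ((n + ½) * (n + ½) * q l (suc m) + n * n * q l m)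
    ≡ ℕ→ℚ 2 * (ℕ→ℚ 4 * k + 1ℚ) + k * k * (ℕ→ℚ 4 * k - 1ℚ) * r l m + (k + ½) * (k + ½) * (ℕ→ℚ 4 * k + ℕ→ℚ 3) * r (suc l) m
DifferenceIdentity₄ m l = let n = ℕ→ℚ m; k = ℕ→ℚ l in
  (ℕ→ℚ 4 * k + 1ℚ) * ((n + ½) ^ℚ 4 * q l (suc m) - n ^ℚ 4 * q l m)
    ≡ (ℕ→ℚ 4 * n + 1ℚ) * (k ^ℚ 4 * r l m - (k + ½) ^ℚ 4 * r (suc l) m)

module _ (m l : ℕ) (≢0 : m ≡ 0 → l ≢ 0) where

  private
    n = ℕ→ℚ m
    k = ℕ→ℚ l
    -- The four linear factors: q l m = 1/(s t), q l (m + 1) = 1/(u v), r l m = 1/(s v) and r (l +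
    -- 1) m = 1/(t u).
    s = n + k
    t = n - k - ½
    u = n + k + 1ℚ
    v = n - k + ½
    J = recip (s * t * (u * v))
    s≢0 = n+k≢0 m l ≢0
    t≢0 = n-k-½≢0 m l
    u≢0 : u ≢ 0ℚ
    u≢0 = 0<⇒≢0 (0<+≤ (0<n+1 m) (0≤ℕ→ℚ l)) ∘′ trans (solve 2 (λ n k → n :+ con 1ℚ :+ k := n :+ k :+ con 1ℚ) refl n k)
    v≢0 = n-k+½≢0 m l

    rₖ : r l m ≡ t * u * J
    rₖ = recip-expand (s * v) (t * u) (s * t * (u * v)) (x*y≢0 t≢0 u≢0)
      (solve 4 (λ s t u v → s :* v :* (t :* u) := s :* t :* (u :* v)) refl s t u v)

    rₖ₊₁ : r (suc l) m ≡ s * v * J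
    rₖ₊₁ = trans (cong (λ y → recip ((n + y) * (n - y + ½))) (ℕ→ℚ-suc l))
      (recip-expand ((n + (k + 1ℚ)) * (n - (k + 1ℚ) + ½)) (s * v) (s * t * (u * v)) (x*y≢0 s≢0 v≢0)
        (solve 2 (λ n k → (n :+ (k :+ con 1ℚ)) :* (n :- (k :+ con 1ℚ) :+ con ½) :* ((n :+ k) :* (n :- k :+ con ½))
           := (n :+ k) :* (n :- k :- con ½) :* ((n :+ k :+ con 1ℚ) :* (n :- k :+ con ½))) refl n k))

    qₙ : q l m ≡ u * v * J
    qₙ = recip-expand (s * t) (u * v) (s * t * (u * v)) (x*y≢0 u≢0 v≢0) refl

    qₙ₊₁ : q l (suc m) ≡ s * t * J
    qₙ₊₁ = trans (cong (λ y → recip ((y + k) * (y - k - ½))) (ℕ→ℚ-suc m))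
      (recip-expand ((n + 1ℚ + k) * (n + 1ℚ - k - ½)) (s * t) (s * t * (u * v)) (x*y≢0 s≢0 t≢0)
        (solve 2 (λ n k → (n :+ con 1ℚ :+ k) :* (n :+ con 1ℚ :- k :- con ½) :* ((n :+ k) :* (n :- k :- con ½))
           := (n :+ k) :* (n :- k :- con ½) :* ((n :+ k :+ con 1ℚ) :* (n :- k :+ con ½))) refl n k))

    J-inverse : s * t * (u * v) * J ≡ 1ℚ
    J-inverse = recip-inverse (x*y≢0 (x*y≢0 s≢0 t≢0) (x*y≢0 u≢0 v≢0))

  open ≡-Reasoning

  difference₂′ : DifferenceIdentity₂ m l
  difference₂′ = begin
    (ℕ→ℚ 4 * k + 1ℚ) * ((n + ½) * (n + ½) * q l (suc m) - n * n * q l m)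
      ≡⟨ cong₂ (λ y z → (ℕ→ℚ 4 * k + 1ℚ) * ((n + ½) * (n + ½) * y - n * n * z)) qₙ₊₁ qₙ ⟩
    (ℕ→ℚ 4 * k + 1ℚ) * ((n + ½) * (n + ½) * (s * t * J) - n * n * (u * v * J))
      ≡⟨ solve 3 (λ n k J → let s = n :+ k; t = n :- k :- con ½; u = n :+ k :+ con 1ℚ; v = n :- k :+ con ½ in
           (con (ℕ→ℚ 4) :* k :+ con 1ℚ) :* ((n :+ con ½) :* (n :+ con ½) :* (s :* t :* J) :- n :* n :* (u :* v :* J))
           := (con (ℕ→ℚ 4) :* n :+ con 1ℚ) :* (k :* k :* (t :* u :* J) :- (k :+ con ½) :* (k :+ con ½) :* (s :* v :* J))) refl n k J ⟩
    (ℕ→ℚ 4 * n + 1ℚ) * (k * k * (t * u * J) - (k + ½) * (k + ½) * (s * v * J))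
      ≡⟨ cong₂ (λ y z → (ℕ→ℚ 4 * n + 1ℚ) * (k * k * y - (k + ½) * (k + ½) * z)) rₖ rₖ₊₁ ⟨
    (ℕ→ℚ 4 * n + 1ℚ) * (k * k * r l m - (k + ½) * (k + ½) * r (suc l) m) ∎

  sum₂′ : SumIdentity₂ m l
  sum₂′ = begin
    (ℕ→ℚ 4 * k + 1ℚ) * ((n + ½) * (n + ½) * q l (suc m) + n * n * q l m)
      ≡⟨ cong₂ (λ y z → (ℕ→ℚ 4 * k + 1ℚ) * ((n + ½) * (n + ½) * y + n * n * z)) qₙ₊₁ qₙ ⟩
    (ℕ→ℚ 4 * k + 1ℚ) * ((n + ½) * (n + ½) * (s * t * J) + n * n * (u * v * J))
      -- The constant summand is first carried as a multiple of s t u v J, so that the ring solver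
      -- sees every term as a multiple of J; J is identified as an inverse only afterwards.
      ≡⟨ solve 3 (λ n k J → let s = n :+ k; t = n :- k :- con ½; u = n :+ k :+ con 1ℚ; v = n :- k :+ con ½ in
           (con (ℕ→ℚ 4) :* k :+ con 1ℚ) :* ((n :+ con ½) :* (n :+ con ½) :* (s :* t :* J) :+ n :* n :* (u :* v :* J))
           := con (ℕ→ℚ 2) :* (con (ℕ→ℚ 4) :* k :+ con 1ℚ) :* (s :* t :* (u :* v) :* J)
              :+ k :* k :* (con (ℕ→ℚ 4) :* k :- con 1ℚ) :* (t :* u :* J)
              :+ (k :+ con ½) :* (k :+ con ½) :* (con (ℕ→ℚ 4) :* k :+ con (ℕ→ℚ 3)) :* (s :* v :* J)) refl n k J ⟩
    ℕ→ℚ 2 * (ℕ→ℚ 4 * k + 1ℚ) * (s * t * (u * v) * J) + k * k * (ℕ→ℚ 4 * k - 1ℚ) * (t * u * J) + (k + ½) * (k + ½) * (ℕ→ℚ 4 * k + ℕ→ℚ 3) * (s * v * J)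
      ≡⟨ cong (λ y → y + k * k * (ℕ→ℚ 4 * k - 1ℚ) * (t * u * J) + (k + ½) * (k + ½) * (ℕ→ℚ 4 * k + ℕ→ℚ 3) * (s * v * J))
           (trans (cong (ℕ→ℚ 2 * (ℕ→ℚ 4 * k + 1ℚ) *_) J-inverse) (*-identityʳ (ℕ→ℚ 2 * (ℕ→ℚ 4 * k + 1ℚ)))) ⟩
    ℕ→ℚ 2 * (ℕ→ℚ 4 * k + 1ℚ) + k * k * (ℕ→ℚ 4 * k - 1ℚ) * (t * u * J) + (k + ½) * (k + ½) * (ℕ→ℚ 4 * k + ℕ→ℚ 3) * (s * v * J)
      ≡⟨ cong₂ (λ y z → ℕ→ℚ 2 * (ℕ→ℚ 4 * k + 1ℚ) + k * k * (ℕ→ℚ 4 * k - 1ℚ) * y + (k + ½) * (k + ½) * (ℕ→ℚ 4 * k + ℕ→ℚ 3) * z) rₖ rₖ₊₁ ⟨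
    ℕ→ℚ 2 * (ℕ→ℚ 4 * k + 1ℚ) + k * k * (ℕ→ℚ 4 * k - 1ℚ) * r l m + (k + ½) * (k + ½) * (ℕ→ℚ 4 * k + ℕ→ℚ 3) * r (suc l) m ∎

  difference₄′ : DifferenceIdentity₄ m l
  difference₄′ = begin
    (ℕ→ℚ 4 * k + 1ℚ) * ((n + ½) ^ℚ 4 * q l (suc m) - n ^ℚ 4 * q l m)
      ≡⟨ cong₂ (λ y z → (ℕ→ℚ 4 * k + 1ℚ) * ((n + ½) ^ℚ 4 * y - n ^ℚ 4 * z)) qₙ₊₁ qₙ ⟩
    (ℕ→ℚ 4 * k + 1ℚ) * ((n + ½) ^ℚ 4 * (s * t * J) - n ^ℚ 4 * (u * v * J))
      ≡⟨ solve 3 (λ n k J → let s = n :+ k; t = n :- k :- con ½; u = n :+ k :+ con 1ℚ; v = n :- k :+ con ½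
                                4th = λ y → y :* (y :* (y :* (y :* con 1ℚ))) in
           (con (ℕ→ℚ 4) :* k :+ con 1ℚ) :* (4th (n :+ con ½) :* (s :* t :* J) :- 4th n :* (u :* v :* J))
           := (con (ℕ→ℚ 4) :* n :+ con 1ℚ) :* (4th k :* (t :* u :* J) :- 4th (k :+ con ½) :* (s :* v :* J))) refl n k J ⟩
    (ℕ→ℚ 4 * n + 1ℚ) * (k ^ℚ 4 * (t * u * J) - (k + ½) ^ℚ 4 * (s * v * J))
      ≡⟨ cong₂ (λ y z → (ℕ→ℚ 4 * n + 1ℚ) * (k ^ℚ 4 * y - (k + ½) ^ℚ 4 * z)) rₖ rₖ₊₁ ⟨
    (ℕ→ℚ 4 * n + 1ℚ) * (k ^ℚ 4 * r l m - (k + ½) ^ℚ 4 * r (suc l) m) ∎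

-- At n = k = 0 the factor n + k of r and q vanishes; the identities survive because recip 0 = 0
-- and because r l m enters only through multiples of k.
unless-both-zero : (T : ℕ → ℕ → Set) → T 0 0 → (∀ m l → (m ≡ 0 → l ≢ 0) → T m l) → ∀ m l → T m l
unless-both-zero T t₀₀ t zero    zero    = t₀₀
unless-both-zero T t₀₀ t zero    (suc l) = t 0 (suc l) λ _ ()
unless-both-zero T t₀₀ t (suc m) l       = t (suc m) l λ ()

difference₂ : ∀ m l → DifferenceIdentity₂ m l
difference₂ = unless-both-zero DifferenceIdentity₂ refl difference₂′

sum₂ : ∀ m l → SumIdentity₂ m l
sum₂ = unless-both-zero SumIdentity₂ refl sum₂′

difference₄ : ∀ m l → DifferenceIdentity₄ m l
difference₄ = unless-both-zero DifferenceIdentity₄ refl difference₄′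

-- Sums comparable to a rational multiple of a given sequence.

IsMultiple : (ℕ → ℚ) → (ℕ → ℚ) → Set
IsMultiple c s = ∃[ t ] Null (λ n → s n - t * c n)

-- The recursion in k and the partial fractions only form linear combinations, so they are carried
-- out for any class of functions closed under these. `resp-≗` stands in for function
-- extensionality.
record Subspace (V : (ℕ → ℚ) → Set) : Set where
  field
    resp-≗ : ∀ {f g} → (∀ n → f n ≡ g n) → V f → V g
    add    : ∀ {f g} → V f → V g → V (λ n → f n + g n)
    scale  : ∀ c {f} → V f → V (λ n → c * f n)

  -- Each step of the recursion in k ends here: the telescoped relation is solved for its one new
  -- function.
  solve-for : ∀ c {f g} → c ≢ 0ℚ → V f → V (λ n → f n + c * g n) → V g
  solve-for c {f} {g} c≢0 Vf Vfg = resp-≗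
    (λ n → begin
      recip c * (f n + c * g n) + - recip c * f n  ≡⟨ solve 4 (λ i f c g → i :* (f :+ c :* g) :+ (:- i) :* f := i :* c :* g) refl (recip c) (f n) c (g n) ⟩
      recip c * c * g n                            ≡⟨ cong (_* g n) (recip-inverseˡ c≢0) ⟩
      1ℚ * g n                                     ≡⟨ *-identityˡ (g n) ⟩
      g n                                          ∎)
    (add (scale (recip c) Vfg) (scale (- recip c) Vf))
    where open ≡-Reasoning

partialSum-+ : ∀ f g N → partialSum (λ n → f n + g n) N ≡ partialSum f N + partialSum g N
partialSum-+ f g zero    = refl
partialSum-+ f g (suc N) = trans (cong (_+ (f N + g N)) (partialSum-+ f g N))
  (solve 4 (λ F G f g → F :+ G :+ (f :+ g) := F :+ f :+ (G :+ g)) refl (partialSum f N) (partialSum g N) (f N) (g N))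

partialSum-* : ∀ c f N → partialSum (λ n → c * f n) N ≡ c * partialSum f N
partialSum-* c f zero    = sym (*-zeroʳ c)
partialSum-* c f (suc N) = trans (cong (_+ c * f N) (partialSum-* c f N)) (sym (*-distribˡ-+ c (partialSum f N) (f N)))

telescope : ∀ (f H : ℕ → ℚ) → H 0 ≡ 0ℚ → (∀ n → H (suc n) ≡ H n + f n) → ∀ N → partialSum f N ≡ H N
telescope f H H₀ step zero    = sym H₀
telescope f H H₀ step (suc N) = trans (cong (_+ f N) (telescope f H H₀ step N)) (sym (step N))

-- The weight ω is kept apart from h so that the condition is linear in h.
SumsTo : (ℕ → ℚ) → (ℕ → ℚ) → (ℕ → ℚ) → Set
SumsTo ω c h = IsMultiple c (partialSum (λ n → ω n * h n))

module _ (ω c : ℕ → ℚ) where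
  open Subspace

  sumsTo-subspace : Subspace (SumsTo ω c)
  resp-≗ sumsTo-subspace f≗g (t , s0) = t
    , null-≗ (λ N → cong (_- t * c N) (partialSum-cong (λ n → cong (ω n *_) (sym (f≗g n))) N)) s0
  add sumsTo-subspace {f} {g} (t , s0) (t′ , s0′) = t + t′
    , null-≗ (λ N → trans (cong (_- (t + t′) * c N)
          (trans (partialSum-cong (λ n → *-distribˡ-+ (ω n) (f n) (g n)) N) (partialSum-+ (λ n → ω n * f n) (λ n → ω n * g n) N)))
        (solve 5 (λ F G t t′ c → F :+ G :- (t :+ t′) :* c := (F :- t :* c) :+ (G :- t′ :* c)) refl
          (partialSum (λ n → ω n * f n) N) (partialSum (λ n → ω n * g n) N) t t′ (c N)))
      (null-+ s0 s0′)
  scale sumsTo-subspace a {f} (t , s0) = a * t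
    , null-≗ (λ N → trans (cong (_- a * t * c N)
          (trans (partialSum-cong (λ n → solve 3 (λ w a f → w :* (a :* f) := a :* (w :* f)) refl (ω n) a (f n)) N) (partialSum-* a (λ n → ω n * f n) N)))
        (solve 4 (λ a F t c → a :* F :- a :* t :* c := a :* (F :- t :* c)) refl a (partialSum (λ n → ω n * f n) N) t (c N)))
      (null-scale a s0)

null⇒multiple : ∀ {c s} → Null s → IsMultiple c s
null⇒multiple {c} {s} s0 = 0ℚ , null-≗ (λ n → solve 2 (λ s c → s :- con 0ℚ :* c := s) refl (s n) (c n)) s0

4n+1 : ℕ → ℚ
4n+1 n = ℕ→ℚ 4 * ℕ→ℚ n + 1ℚ

ω₃ : ℕ → ℚ
ω₃ n = (- 1ℚ) ^ℚ n * 4n+1 n * b n ^ℚ 3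

ω₄ : ℕ → ℚ
ω₄ n = 4n+1 n * b n ^ℚ 4

Sum₃ Sum₄ : (ℕ → ℚ) → Set
Sum₃ = SumsTo ω₃ (seq 1/π)
Sum₄ = SumsTo ω₄ (seq 1/π²)

telescoping-sum : ∀ (ω H h c : ℕ → ℚ) t → H 0 ≡ 0ℚ → (∀ n → H (suc n) ≡ H n + ω n * h n) →
  Null (λ n → H n - t * c n) → SumsTo ω c h
telescoping-sum ω H h c t H₀ step H→ = t
  , null-≗ (λ N → cong (_- t * c N) (telescope (λ n → ω n * h n) H H₀ step N)) H→

module V₃ = Subspace (sumsTo-subspace ω₃ (seq 1/π))
module V₄ = Subspace (sumsTo-subspace ω₄ (seq 1/π²))

-- Behaviour of the boundary terms.

nb : ℕ → ℚ
nb n = ℕ→ℚ n * b n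

-- Why n b n is telescoped rather than b n: its successor is again a multiple of b n, so b n factors
-- out of each difference, and its vanishing at 0 removes the lower boundary term.
nb-suc : ∀ n → nb (suc n) ≡ (ℕ→ℚ n + ½) * b n
nb-suc n = trans (cong (_* b (suc n)) (ℕ→ℚ-suc n)) (b-suc n)

-- The threshold ¼ (2n + 1) = ½ n + ¼ grows at half the speed of n, so that n - k - ½ lies above it
-- from n = 2 (k + 1) on.
null-recip : ∀ (d : ℕ → ℚ) → Eventually (λ n → ½ * ½ * (ℕ→ℚ 2 * ℕ→ℚ n + 1ℚ) ≤ d n) → Null (λ n → recip (d n))
null-recip d d≥ = null-dominated {λ n → recip (d n)} {λ n → ℕ→ℚ 4 * oddRecip n} (mapₑ near d≥) (null-scale (ℕ→ℚ 4) null-oddRecip)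
  where
  near : ∀ n → ½ * ½ * (ℕ→ℚ 2 * ℕ→ℚ n + 1ℚ) ≤ d n → ∣ recip (d n) ∣ ≤ ∣ ℕ→ℚ 4 * oddRecip n ∣
  near n h = ≤-trans (≤-reflexive (0≤p⇒∣p∣≡p (<⇒≤ (0<recip 0<d)))) (≤-trans (*-cancelʳ-≤ (d n) 0<d (begin
      recip (d n) * d n                                            ≡⟨ recip-inverseˡ (0<⇒≢0 0<d) ⟩
      1ℚ                                                           ≡⟨ oddRecip-inverse n ⟨
      oddRecip n * k                                               ≡⟨ solve 2 (λ o k → o :* k := con (ℕ→ℚ 4) :* o :* (con ½ :* con ½ :* k)) refl (oddRecip n) k ⟩
      ℕ→ℚ 4 * oddRecip n * (½ * ½ * k)                             ≤⟨ *-monoˡ (0≤* (0≤ℕ→ℚ 4) (0≤oddRecip n)) h ⟩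
      ℕ→ℚ 4 * oddRecip n * d n                                     ∎)) (x≤∣x∣ (ℕ→ℚ 4 * oddRecip n)))
    where
    open ≤-Reasoning
    k = ℕ→ℚ 2 * ℕ→ℚ n + 1ℚ
    0<d : 0ℚ < d n
    0<d = <-≤-trans (0<x*y (positive⁻¹ (½ * ½)) (0<2n+1 n)) h

bound-limit : ∀ s c → Null (λ n → s n - c) → Bound s
bound-limit s c s→c = 1ℚ + ∣ c ∣ , 0<+≤ 0<1 (0≤∣p∣ c) , mapₑ
  (λ n h → subst (λ y → ∣ y ∣ ≤ 1ℚ + ∣ c ∣) (solve 2 (λ y c → y :- c :+ c := y) refl (s n) c)
    (≤-trans (∣p+q∣≤∣p∣+∣q∣ (s n - c) c) (+-monoˡ-≤ ∣ c ∣ h)))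
  (s→c 1ℚ 0<1)

null-*-difference : ∀ (s t c d : ℕ → ℚ) → Bound c → Bound d →
  Null (λ n → s n - c n) → Null (λ n → t n - d n) → Null (λ n → s n * t n - c n * d n)
null-*-difference s t c d c< d< s~c t~d = null-≗
  (λ n → solve 4 (λ s t c d → s :* t :- c :* d := (s :- c) :* (t :- d) :+ (c :* (t :- d) :+ d :* (s :- c))) refl (s n) (t n) (c n) (d n))
  (null-+ (null-bounded-* (null-bound s~c) t~d) (null-+ (null-bounded-* c< t~d) (null-bounded-* d< s~c)))

nb²-bound : Bound (λ n → P ½ n * (ℕ→ℚ n * oddRecip n))
nb²-bound = bound-* P½-bound n*oddRecip-bound

n*oddRecip→½ : Null (λ n → ℕ→ℚ n * oddRecip n - ½)
n*oddRecip→½ = null-≗ (λ n → trans (cong (λ y → ℕ→ℚ n * oddRecip n - ½ * y) (sym (oddRecip-inverse n)))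
    (solve 2 (λ n o → n :* o :- con ½ :* (o :* (con (ℕ→ℚ 2) :* n :+ con 1ℚ)) := con (- ½) :* o) refl (ℕ→ℚ n) (oddRecip n)))
  (null-scale (- ½) null-oddRecip)

module _ (l : ℕ) where

  private
    k = ℕ→ℚ l

  null-1/[n+k] : Null (λ n → recip (ℕ→ℚ n + k))
  null-1/[n+k] = null-recip (λ n → ℕ→ℚ n + k) (1 , λ { (suc n) _ → x≤x+d (½ * ℕ→ℚ n + ½ * ½ + k)
    (0≤+ (0≤+ (0≤* (<⇒≤ 0<½) (0≤ℕ→ℚ n)) (<⇒≤ (0<x*y 0<½ 0<½))) (0≤ℕ→ℚ l))
    (subst (λ y → y + k ≡ ½ * ½ * (ℕ→ℚ 2 * y + 1ℚ) + (½ * ℕ→ℚ n + ½ * ½ + k)) (sym (ℕ→ℚ-suc n))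
      (solve 2 (λ n k → n :+ con 1ℚ :+ k := con ½ :* con ½ :* (con (ℕ→ℚ 2) :* (n :+ con 1ℚ) :+ con 1ℚ) :+ (con ½ :* n :+ con ½ :* con ½ :+ k)) refl (ℕ→ℚ n) k)) })

  null-1/[n-k-½] : Null (λ n → recip (ℕ→ℚ n - k - ½))
  null-1/[n-k-½] = null-recip (λ n → ℕ→ℚ n - k - ½) (2 ℕ.* suc l , λ n h → x≤x+d (½ * ℕ→ℚ (n ℕ.∸ 2 ℕ.* suc l) + ½ * ½)
    (0≤+ (0≤* (<⇒≤ 0<½) (0≤ℕ→ℚ (n ℕ.∸ 2 ℕ.* suc l))) (<⇒≤ (0<x*y 0<½ 0<½)))
    (subst (λ y → y - k - ½ ≡ ½ * ½ * (ℕ→ℚ 2 * y + 1ℚ) + (½ * ℕ→ℚ (n ℕ.∸ 2 ℕ.* suc l) + ½ * ½)) (expand n h)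
      (solve 2 (λ j k → let n = j :+ con (ℕ→ℚ 2) :* (k :+ con 1ℚ) in
        n :- k :- con ½ := con ½ :* con ½ :* (con (ℕ→ℚ 2) :* n :+ con 1ℚ) :+ (con ½ :* j :+ con ½ :* con ½)) refl (ℕ→ℚ (n ℕ.∸ 2 ℕ.* suc l)) k)))
    where
    expand : ∀ n → 2 ℕ.* suc l ℕ.≤ n → ℕ→ℚ (n ℕ.∸ 2 ℕ.* suc l) + ℕ→ℚ 2 * (k + 1ℚ) ≡ ℕ→ℚ n
    expand n h = trans (cong (λ y → ℕ→ℚ (n ℕ.∸ 2 ℕ.* suc l) + y) (sym (trans (ℕ→ℚ-* 2 (suc l)) (cong (ℕ→ℚ 2 *_) (ℕ→ℚ-suc l)))))
      (trans (sym (ℕ→ℚ-+ (n ℕ.∸ 2 ℕ.* suc l) (2 ℕ.* suc l))) (cong ℕ→ℚ (ℕₚ.m∸n+n≡m h)))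

  n/[n+k]→1 : Null (λ n → ℕ→ℚ n * recip (ℕ→ℚ n + k) - 1ℚ)
  n/[n+k]→1 = null-dominated {λ n → ℕ→ℚ n * recip (ℕ→ℚ n + k) - 1ℚ} {λ n → - k * recip (ℕ→ℚ n + k)} (1 , λ n 1≤n → ≤-reflexive (cong ∣_∣ (eq n 1≤n))) (null-scale (- k) null-1/[n+k])
    where
    eq : ∀ n → 1 ℕ.≤ n → ℕ→ℚ n * recip (ℕ→ℚ n + k) - 1ℚ ≡ - k * recip (ℕ→ℚ n + k)
    eq n 1≤n = trans (cong (λ y → ℕ→ℚ n * recip (ℕ→ℚ n + k) - y) (sym (recip-inverse (n+k≢0 n l λ { refl → ⊥-elim (ℕₚ.<-irrefl refl 1≤n) }))))
      (solve 3 (λ n k i → n :* i :- (n :+ k) :* i := (:- k) :* i) refl (ℕ→ℚ n) k (recip (ℕ→ℚ n + k)))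

  n/[n-k-½]→1 : Null (λ n → ℕ→ℚ n * recip (ℕ→ℚ n - k - ½) - 1ℚ)
  n/[n-k-½]→1 = null-≗ (λ n → trans (cong (λ y → ℕ→ℚ n * recip (ℕ→ℚ n - k - ½) - y) (sym (recip-inverse (n-k-½≢0 n l))))
      (solve 3 (λ n k i → n :* i :- (n :- k :- con ½) :* i := (k :+ con ½) :* i) refl (ℕ→ℚ n) k (recip (ℕ→ℚ n - k - ½))))
    (null-scale (k + ½) null-1/[n-k-½])

  n²q→1 : Null (λ n → ℕ→ℚ n * ℕ→ℚ n * q l n - 1ℚ)
  n²q→1 = null-≗ (λ n → cong (_- 1ℚ) (trans (cong (ℕ→ℚ n * ℕ→ℚ n *_) (recip-* (ℕ→ℚ n + k) (ℕ→ℚ n - k - ½)))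
      (solve 3 (λ n i j → n :* n :* (i :* j) := (n :* i) :* (n :* j)) refl (ℕ→ℚ n) (recip (ℕ→ℚ n + k)) (recip (ℕ→ℚ n - k - ½)))))
    (null-*-difference (λ n → ℕ→ℚ n * recip (ℕ→ℚ n + k)) (λ n → ℕ→ℚ n * recip (ℕ→ℚ n - k - ½)) (λ _ → 1ℚ) (λ _ → 1ℚ) (bound-const 1ℚ) (bound-const 1ℚ) n/[n+k]→1 n/[n-k-½]→1)

  n²q-bound : Bound (λ n → ℕ→ℚ n * ℕ→ℚ n * q l n)
  n²q-bound = bound-limit (λ n → ℕ→ℚ n * ℕ→ℚ n * q l n) 1ℚ n²q→1

  -- n b² and n² q are bounded, and one factor b remains.
  null-nb³q : Null (λ n → nb n ^ℚ 3 * q l n)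
  null-nb³q = null-≗ (λ n → begin
      nb n ^ℚ 3 * q l n
        ≡⟨ solve 3 (λ n y q → let z = n :* y in z :* (z :* (z :* con 1ℚ)) :* q := (y :* y :* n) :* (n :* n :* q) :* y) refl (ℕ→ℚ n) (b n) (q l n) ⟩
      (b n * b n * ℕ→ℚ n) * (ℕ→ℚ n * ℕ→ℚ n * q l n) * b n
        ≡⟨ cong (λ y → y * (ℕ→ℚ n * ℕ→ℚ n * q l n) * b n) (trans (cong (_* ℕ→ℚ n) (b²≡P½*oddRecip n))
             (solve 3 (λ p o n → p :* o :* n := p :* (n :* o)) refl (P ½ n) (oddRecip n) (ℕ→ℚ n))) ⟩
      (P ½ n * (ℕ→ℚ n * oddRecip n)) * (ℕ→ℚ n * ℕ→ℚ n * q l n) * b n ∎)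
    (null-bounded-* (bound-* nb²-bound n²q-bound) null-b)
    where open ≡-Reasoning

  null-nb⁴q² : Null (λ n → nb n ^ℚ 4 * (q l n * q l n))
  null-nb⁴q² = null-≗
      (λ n → solve 3 (λ n y q → let z = n :* y; u = n :* n :* q in z :* (z :* (z :* (z :* con 1ℚ))) :* (q :* q) := (u :* u) :* (y :* (y :* (y :* y)))) refl (ℕ→ℚ n) (b n) (q l n))
    (null-bounded-* (bound-* n²q-bound n²q-bound) (null-bounded-* b< (null-bounded-* b< (null-bounded-* b< null-b))))
    where b< = null-bound null-b

  -- n b² is P ½ · n/(2n + 1), close to (2/π) · ½, and n² q tends to 1. This boundary term is the
  -- only source of π in the fourth-power sums.
  nb⁴q→1/π² : Null (λ n → nb n ^ℚ 4 * q l n - seq 1/π² n)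
  nb⁴q→1/π² = null-≗ eq
    (null-*-difference (λ n → P ½ n * P ½ n) (λ n → (ℕ→ℚ n * oddRecip n) * (ℕ→ℚ n * oddRecip n) * (ℕ→ℚ n * ℕ→ℚ n * q l n))
      (λ n → 2/π n * 2/π n) (λ _ → ½ * ½ * 1ℚ) (bound-* 2/π< 2/π<) (bound-const (½ * ½ * 1ℚ))
      (null-*-difference (P ½) (P ½) 2/π 2/π 2/π< 2/π< P½-2/π P½-2/π)
      (null-*-difference (λ n → (ℕ→ℚ n * oddRecip n) * (ℕ→ℚ n * oddRecip n)) (λ n → ℕ→ℚ n * ℕ→ℚ n * q l n) (λ _ → ½ * ½) (λ _ → 1ℚ) (bound-const (½ * ½)) (bound-const 1ℚ)
        (null-*-difference (λ n → ℕ→ℚ n * oddRecip n) (λ n → ℕ→ℚ n * oddRecip n) (λ _ → ½) (λ _ → ½) (bound-const ½) (bound-const ½) n*oddRecip→½ n*oddRecip→½) n²q→1))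
    where
    open ≡-Reasoning
    2/π : ℕ → ℚ
    2/π n = ℕ→ℚ 2 * seq 1/π n
    2/π< : Bound 2/π
    2/π< = bound-* (bound-const (ℕ→ℚ 2)) (cauchy-bound (seq 1/π) (cauchy 1/π))
    eq : ∀ n → nb n ^ℚ 4 * q l n - seq 1/π² n
      ≡ (P ½ n * P ½ n) * ((ℕ→ℚ n * oddRecip n) * (ℕ→ℚ n * oddRecip n) * (ℕ→ℚ n * ℕ→ℚ n * q l n))
        - (ℕ→ℚ 2 * seq 1/π n) * (ℕ→ℚ 2 * seq 1/π n) * (½ * ½ * 1ℚ)
    eq n = begin
      nb n ^ℚ 4 * q l n - i * i
        ≡⟨ solve 4 (λ n y q i → let z = n :* y in z :* (z :* (z :* (z :* con 1ℚ))) :* q :- i :* i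
             := (y :* y) :* (y :* y) :* (n :* n) :* (n :* n :* q) :- (con (ℕ→ℚ 2) :* i) :* (con (ℕ→ℚ 2) :* i) :* con (½ * ½ * 1ℚ)) refl (ℕ→ℚ n) (b n) (q l n) i ⟩
      (b n * b n) * (b n * b n) * (ℕ→ℚ n * ℕ→ℚ n) * (ℕ→ℚ n * ℕ→ℚ n * q l n) - limit
        ≡⟨ cong (λ y → y * y * (ℕ→ℚ n * ℕ→ℚ n) * (ℕ→ℚ n * ℕ→ℚ n * q l n) - limit) (b²≡P½*oddRecip n) ⟩
      (P ½ n * oddRecip n) * (P ½ n * oddRecip n) * (ℕ→ℚ n * ℕ→ℚ n) * (ℕ→ℚ n * ℕ→ℚ n * q l n) - limit
        ≡⟨ cong (_- limit) (solve 4 (λ p o n q → (p :* o) :* (p :* o) :* (n :* n) :* (n :* n :* q) := (p :* p) :* ((n :* o) :* (n :* o) :* (n :* n :* q))) refl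
             (P ½ n) (oddRecip n) (ℕ→ℚ n) (q l n)) ⟩
      (P ½ n * P ½ n) * ((ℕ→ℚ n * oddRecip n) * (ℕ→ℚ n * oddRecip n) * (ℕ→ℚ n * ℕ→ℚ n * q l n)) - limit ∎
      where
      i = seq 1/π n
      limit = (ℕ→ℚ 2 * i) * (ℕ→ℚ 2 * i) * (½ * ½ * 1ℚ)

-- Products of two of the functions r k.

r-inverse : ∀ l n → (ℕ→ℚ n + ℕ→ℚ (suc l)) * (ℕ→ℚ n - ℕ→ℚ (suc l) + ½) * r (suc l) n ≡ 1ℚ
r-inverse l n = recip-inverse (x*y≢0 (n+k≢0 n (suc l) λ _ ()) (n-k+½≢0 n (suc l)))

-- Each denominator (n + k)(n - k + ½) is n² + ½ n plus a constant, so two of them differ by a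
-- number free of n, namely (k - l)(k + l - ½).
resolvent : ∀ i j n → let k = ℕ→ℚ (suc i); l = ℕ→ℚ (suc j) in
  (k - l) * (k + l - ½) * (r (suc i) n * r (suc j) n) ≡ r (suc i) n - r (suc j) n
resolvent i j m = begin
  (k - l) * (k + l - ½) * (x * y)
    ≡⟨ solve 5 (λ n k l x y → (k :- l) :* (k :+ l :- con ½) :* (x :* y)
         := ((n :+ l) :* (n :- l :+ con ½) :* y) :* x :- ((n :+ k) :* (n :- k :+ con ½) :* x) :* y) refl n k l x y ⟩
  ((n + l) * (n - l + ½) * y) * x - ((n + k) * (n - k + ½) * x) * y
    ≡⟨ cong₂ (λ u v → u * x - v * y) (r-inverse j m) (r-inverse i m) ⟩
  1ℚ * x - 1ℚ * y
    ≡⟨ cong₂ _-_ (*-identityˡ x) (*-identityˡ y) ⟩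
  x - y ∎
  where
  open ≡-Reasoning
  n = ℕ→ℚ m
  k = ℕ→ℚ (suc i)
  l = ℕ→ℚ (suc j)
  x = r (suc i) m
  y = r (suc j) m

-- For neighbours the constant of `resolvent` is -½ (4k + 1). The extra factor l extends the
-- relation to l = 0, where r 0 has a pole at n = 0.
resolvent-suc : ∀ l n → (ℕ→ℚ 4 * ℕ→ℚ l + 1ℚ) * (ℕ→ℚ l * (r l n * r (suc l) n)) ≡ ℕ→ℚ 2 * (ℕ→ℚ l * r (suc l) n - ℕ→ℚ l * r l n)
resolvent-suc zero    n = solve 2 (λ x y → (con (ℕ→ℚ 4 * 0ℚ + 1ℚ)) :* (con 0ℚ :* (x :* y)) := con (ℕ→ℚ 2) :* (con 0ℚ :* y :- con 0ℚ :* x)) refl (r 0 n) (r 1 n)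
resolvent-suc (suc i) n = begin
  (ℕ→ℚ 4 * κ + 1ℚ) * (κ * (x * y))
    ≡⟨ solve 3 (λ k x y → (con (ℕ→ℚ 4) :* k :+ con 1ℚ) :* (k :* (x :* y))
         := con (- (ℕ→ℚ 2)) :* k :* ((k :- (k :+ con 1ℚ)) :* (k :+ (k :+ con 1ℚ) :- con ½) :* (x :* y))) refl κ x y ⟩
  - (ℕ→ℚ 2) * κ * ((κ - (κ + 1ℚ)) * (κ + (κ + 1ℚ) - ½) * (x * y))
    ≡⟨ cong (λ z → - (ℕ→ℚ 2) * κ * ((κ - z) * (κ + z - ½) * (x * y))) (ℕ→ℚ-suc (suc i)) ⟨
  - (ℕ→ℚ 2) * κ * ((κ - ℕ→ℚ (suc (suc i))) * (κ + ℕ→ℚ (suc (suc i)) - ½) * (x * y))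
    ≡⟨ cong (- (ℕ→ℚ 2) * κ *_) (resolvent i (suc i) n) ⟩
  - (ℕ→ℚ 2) * κ * (x - y)
    ≡⟨ solve 3 (λ k x y → con (- (ℕ→ℚ 2)) :* k :* (x :- y) := con (ℕ→ℚ 2) :* (k :* y :- k :* x)) refl κ x y ⟩
  ℕ→ℚ 2 * (κ * y - κ * x) ∎
  where
  open ≡-Reasoning
  κ = ℕ→ℚ (suc i)
  x = r (suc i) n
  y = r (suc (suc i)) n

-- The recursion from k to k + 1.

module _ (l : ℕ) where

  private
    k = ℕ→ℚ l
    c = ℕ→ℚ 4 * k + 1ℚ

  0<4k+1 : 0ℚ < c
  0<4k+1 = +-mono-≤-< {0ℚ} {_} {0ℚ} (0≤* (0≤ℕ→ℚ 4) (0≤ℕ→ℚ l)) 0<1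

  0<k+½ : 0ℚ < k + ½
  0<k+½ = +-mono-≤-< {0ℚ} {_} {0ℚ} (0≤ℕ→ℚ l) 0<½

  open ≡-Reasoning

  H₃ : ℕ → ℚ
  H₃ n = - c * (- 1ℚ) ^ℚ n * (nb n ^ℚ 3 * q l n)

  H₃-step : ∀ n → H₃ (suc n) ≡ H₃ n
    + ω₃ n * (½ * c * 1ℚ + k * k * (k * r l n) + (k + ½) ^ℚ 3 * r (suc l) n)
  H₃-step m = begin
    - c * (- 1ℚ * s) * (nb (suc m) ^ℚ 3 * Q′)
      ≡⟨ cong (λ z → - c * (- 1ℚ * s) * (z ^ℚ 3 * Q′)) (nb-suc m) ⟩
    - c * (- 1ℚ * s) * (((n + ½) * y) ^ℚ 3 * Q′)
      -- The alternating sign turns the difference into the sum (n + ½) U + n V, which is (n + ¼)(U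
      -- + V) + ¼ (U - V); the factor n + ¼ supplies the weight 4n + 1.
      ≡⟨ solve 6 (λ c s n y Q′ Q → let x = n :* y; x′ = (n :+ con ½) :* y
                                       U = (n :+ con ½) :* (n :+ con ½) :* Q′; V = n :* n :* Q in
           (:- c) :* (con (- 1ℚ) :* s) :* (x′ :* (x′ :* (x′ :* con 1ℚ)) :* Q′)
           := (:- c) :* s :* (x :* (x :* (x :* con 1ℚ)) :* Q)
              :+ s :* (y :* (y :* y)) :* ((n :+ con (½ * ½)) :* (c :* (U :+ V)) :+ con (½ * ½) :* (c :* (U :- V)))) refl c s n y Q′ Q ⟩
    H₃ m + s * (y * (y * y)) * ((n + ½ * ½) * (c * ((n + ½) * (n + ½) * Q′ + n * n * Q)) + ½ * ½ * (c * ((n + ½) * (n + ½) * Q′ - n * n * Q)))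
      ≡⟨ cong₂ (λ u v → H₃ m + s * (y * (y * y)) * ((n + ½ * ½) * u + ½ * ½ * v)) (sum₂ m l) (difference₂ m l) ⟩
    H₃ m + s * (y * (y * y)) * ((n + ½ * ½) * (ℕ→ℚ 2 * c + k * k * (ℕ→ℚ 4 * k - 1ℚ) * R + (k + ½) * (k + ½) * (ℕ→ℚ 4 * k + ℕ→ℚ 3) * R′)
      + ½ * ½ * ((ℕ→ℚ 4 * n + 1ℚ) * (k * k * R - (k + ½) * (k + ½) * R′)))
      ≡⟨ cong (λ z → H₃ m + z) (solve 6 (λ s y n k R R′ → let c = con (ℕ→ℚ 4) :* k :+ con 1ℚ; t = k :+ con ½ in
           s :* (y :* (y :* y)) :* ((n :+ con (½ * ½)) :* (con (ℕ→ℚ 2) :* c :+ k :* k :* (con (ℕ→ℚ 4) :* k :- con 1ℚ) :* R :+ t :* t :* (con (ℕ→ℚ 4) :* k :+ con (ℕ→ℚ 3)) :* R′)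
             :+ con (½ * ½) :* ((con (ℕ→ℚ 4) :* n :+ con 1ℚ) :* (k :* k :* R :- t :* t :* R′)))
           := s :* (con (ℕ→ℚ 4) :* n :+ con 1ℚ) :* (y :* (y :* (y :* con 1ℚ))) :* (con ½ :* c :* con 1ℚ :+ k :* k :* (k :* R) :+ t :* (t :* (t :* con 1ℚ)) :* R′)) refl s y n k R R′) ⟩
    H₃ m + ω₃ m * (½ * c * 1ℚ + k * k * (k * R) + (k + ½) ^ℚ 3 * R′) ∎
    where
    n = ℕ→ℚ m
    s = (- 1ℚ) ^ℚ m
    y = b m
    Q = q l m
    Q′ = q l (suc m)
    R = r l m
    R′ = r (suc l) m

  H₄ : ℕ → ℚ
  H₄ n = c * (nb n ^ℚ 4 * q l n)

  H₄-step : ∀ n → H₄ (suc n) ≡ H₄ n + ω₄ n * (k ^ℚ 3 * (k * r l n) + - ((k + ½) ^ℚ 4) * r (suc l) n)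
  H₄-step m = begin
    c * (nb (suc m) ^ℚ 4 * Q′)
      ≡⟨ cong (λ z → c * (z ^ℚ 4 * Q′)) (nb-suc m) ⟩
    c * (((n + ½) * y) ^ℚ 4 * Q′)
      ≡⟨ solve 5 (λ c n y Q′ Q → let 4th = λ z → z :* (z :* (z :* (z :* con 1ℚ))) in
           c :* (4th ((n :+ con ½) :* y) :* Q′) := c :* (4th (n :* y) :* Q) :+ 4th y :* (c :* (4th (n :+ con ½) :* Q′ :- 4th n :* Q))) refl c n y Q′ Q ⟩
    H₄ m + y ^ℚ 4 * (c * ((n + ½) ^ℚ 4 * Q′ - n ^ℚ 4 * Q))
      ≡⟨ cong (λ z → H₄ m + y ^ℚ 4 * z) (difference₄ m l) ⟩
    H₄ m + y ^ℚ 4 * ((ℕ→ℚ 4 * n + 1ℚ) * (k ^ℚ 4 * R - (k + ½) ^ℚ 4 * R′))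
      ≡⟨ cong (λ z → H₄ m + z) (solve 6 (λ Y N k K R R′ → Y :* (N :* (k :* (k :* (k :* (k :* con 1ℚ))) :* R :- K :* R′))
           := N :* Y :* (k :* (k :* (k :* con 1ℚ)) :* (k :* R) :+ (:- K) :* R′)) refl (y ^ℚ 4) (ℕ→ℚ 4 * n + 1ℚ) k ((k + ½) ^ℚ 4) R R′) ⟩
    H₄ m + ω₄ m * (k ^ℚ 3 * (k * R) + - ((k + ½) ^ℚ 4) * R′) ∎
    where
    n = ℕ→ℚ m
    y = b m
    Q = q l m
    Q′ = q l (suc m)
    R = r l m
    R′ = r (suc l) m

  H₄₂ : ℕ → ℚ
  H₄₂ n = c * c * (nb n ^ℚ 4 * (q l n * q l n))

  -- U² - V² is (U - V)(U + V): `difference₂` supplies the weight 4n + 1, and the product with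
  -- `sum₂` is quadratic in r k and r (k + 1) without a constant term.
  H₄₂-step : ∀ n → H₄₂ (suc n) ≡ H₄₂ n + ω₄ n *
    ((k * k * r l n - (k + ½) * (k + ½) * r (suc l) n)
     * (ℕ→ℚ 2 * c + k * k * (ℕ→ℚ 4 * k - 1ℚ) * r l n + (k + ½) * (k + ½) * (ℕ→ℚ 4 * k + ℕ→ℚ 3) * r (suc l) n))
  H₄₂-step m = begin
    c * c * (nb (suc m) ^ℚ 4 * (Q′ * Q′))
      ≡⟨ cong (λ z → c * c * (z ^ℚ 4 * (Q′ * Q′))) (nb-suc m) ⟩
    c * c * (((n + ½) * y) ^ℚ 4 * (Q′ * Q′))
      ≡⟨ solve 5 (λ c n y Q′ Q → let 4th = λ z → z :* (z :* (z :* (z :* con 1ℚ)))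
                                     U = (n :+ con ½) :* (n :+ con ½) :* Q′; V = n :* n :* Q in
           c :* c :* (4th ((n :+ con ½) :* y) :* (Q′ :* Q′))
           := c :* c :* (4th (n :* y) :* (Q :* Q)) :+ 4th y :* ((c :* (U :- V)) :* (c :* (U :+ V)))) refl c n y Q′ Q ⟩
    H₄₂ m + y ^ℚ 4 * ((c * ((n + ½) * (n + ½) * Q′ - n * n * Q)) * (c * ((n + ½) * (n + ½) * Q′ + n * n * Q)))
      ≡⟨ cong₂ (λ u v → H₄₂ m + y ^ℚ 4 * (u * v)) (difference₂ m l) (sum₂ m l) ⟩
    H₄₂ m + y ^ℚ 4 * ((ℕ→ℚ 4 * n + 1ℚ) * D * S′)
      ≡⟨ cong (λ z → H₄₂ m + z) (solve 4 (λ Y N D S → Y :* (N :* D :* S) := N :* Y :* (D :* S)) refl (y ^ℚ 4) (ℕ→ℚ 4 * n + 1ℚ) D S′) ⟩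
    H₄₂ m + ω₄ m * (D * S′) ∎
    where
    n = ℕ→ℚ m
    y = b m
    Q = q l m
    Q′ = q l (suc m)
    R = r l m
    R′ = r (suc l) m
    D = k * k * R - (k + ½) * (k + ½) * R′
    S′ = ℕ→ℚ 2 * c + k * k * (ℕ→ℚ 4 * k - 1ℚ) * R + (k + ½) * (k + ½) * (ℕ→ℚ 4 * k + ℕ→ℚ 3) * R′

  -- The boundary term tends to 0, so 1/π enters only through the function 1, that is Bauer's
  -- series. The second hypothesis contains the factor k and is void at k = 0.
  sum₃-r-suc : Sum₃ (λ _ → 1ℚ) → Sum₃ (λ n → k * r l n) → Sum₃ (r (suc l))
  sum₃-r-suc V1 Vkr = V₃.solve-for ((k + ½) ^ℚ 3) {λ n → ½ * c * 1ℚ + k * k * (k * r l n)} {r (suc l)}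
    (0<⇒≢0 (0<x*y 0<k+½ (0<x*y 0<k+½ (0<x*y 0<k+½ 0<1))))
    (V₃.add (V₃.scale (½ * c) V1) (V₃.scale (k * k) Vkr))
    (telescoping-sum ω₃ H₃ (λ n → ½ * c * 1ℚ + k * k * (k * r l n) + (k + ½) ^ℚ 3 * r (suc l) n) (seq 1/π) 0ℚ
      (solve 2 (λ c q → (:- c) :* con 1ℚ :* (con 0ℚ :* q) := con 0ℚ) refl c (q l 0))
      H₃-step
      (proj₂ (null⇒multiple {seq 1/π} (null-bounded-* (bound-* (bound-const (- c)) sign<) (null-nb³q l)))))
    where
    sign< : Bound (λ n → (- 1ℚ) ^ℚ n)
    sign< = 1ℚ , 0<1 , always λ n → ≤-reflexive (∣-1^n∣≡1 n)

  -- Here the boundary term survives and contributes (4k + 1)/π².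
  sum₄-r-suc : Sum₄ (λ n → k * r l n) → Sum₄ (r (suc l))
  sum₄-r-suc Vkr = V₄.solve-for (- ((k + ½) ^ℚ 4)) {λ n → k ^ℚ 3 * (k * r l n)} {r (suc l)}
    (λ eq → 0<⇒≢0 (0<x*y 0<k+½ (0<x*y 0<k+½ (0<x*y 0<k+½ (0<x*y 0<k+½ 0<1)))) (neg-injective eq))
    (V₄.scale (k ^ℚ 3) Vkr)
    (telescoping-sum ω₄ H₄ (λ n → k ^ℚ 3 * (k * r l n) + - ((k + ½) ^ℚ 4) * r (suc l) n) (seq 1/π²) c
      (solve 2 (λ c q → c :* (con 0ℚ :* q) := con 0ℚ) refl c (q l 0))
      H₄-step
      (null-≗ (λ n → solve 3 (λ c x i → c :* x :- c :* i := c :* (x :- i)) refl c (nb n ^ℚ 4 * q l n) (seq 1/π² n)) (null-scale c (nb⁴q→1/π² l))))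

  -- Expanding the telescoped product leaves squares, linear terms and one cross term r k · r (k +
  -- 1), which `resolvent-suc` makes linear. Only the square of r (k + 1) is then new.
  sum₄-r²-suc : Sum₄ (λ n → k * r l n) → Sum₄ (r (suc l)) → Sum₄ (λ n → k * (r l n * r l n)) →
    Sum₄ (λ n → r (suc l) n * r (suc l) n)
  sum₄-r²-suc Vkr Vr′ Vkr² = V₄.solve-for (- (K * K * (ℕ→ℚ 4 * k + ℕ→ℚ 3))) {rest} {λ n → r (suc l) n * r (suc l) n}
    (λ eq → 0<⇒≢0 (0<x*y (0<x*y 0<K 0<K) 0<4k+3) (neg-injective eq))
    Vrest
    (V₄.resp-≗ expand (telescoping-sum ω₄ H₄₂ product (seq 1/π²) 0ℚ
      (solve 2 (λ c q → c :* c :* (con 0ℚ :* (q :* q)) := con 0ℚ) refl c (q l 0))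
      H₄₂-step
      (proj₂ (null⇒multiple {seq 1/π²} (null-scale (c * c) (null-nb⁴q² l))))))
    where
    K = (k + ½) * (k + ½)
    0<K : 0ℚ < K
    0<K = 0<x*y 0<k+½ 0<k+½
    0<4k+3 : 0ℚ < ℕ→ℚ 4 * k + ℕ→ℚ 3
    0<4k+3 = +-mono-≤-< {0ℚ} {_} {0ℚ} (0≤* (0≤ℕ→ℚ 4) (0≤ℕ→ℚ l)) (positive⁻¹ (ℕ→ℚ 3))
    product rest : ℕ → ℚ
    product n = (k * k * r l n - K * r (suc l) n)
              * (ℕ→ℚ 2 * c + k * k * (ℕ→ℚ 4 * k - 1ℚ) * r l n + K * (ℕ→ℚ 4 * k + ℕ→ℚ 3) * r (suc l) n)
    -- the summands 8 … recip c come from k r r′ = 2 (k r′ - k r) / c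
    C₁ = ℕ→ℚ 2 * c * k - ℕ→ℚ 8 * k * K * recip c
    C₂ = ℕ→ℚ 8 * (k * k) * K * recip c - ℕ→ℚ 2 * c * K
    C₃ = k * k * k * (ℕ→ℚ 4 * k - 1ℚ)
    rest n = C₁ * (k * r l n) + C₂ * r (suc l) n + C₃ * (k * (r l n * r l n))
    Vrest : Sum₄ rest
    Vrest = V₄.add (V₄.add (V₄.scale C₁ Vkr) (V₄.scale C₂ Vr′)) (V₄.scale C₃ Vkr²)
    cross : ∀ n → k * (r l n * r (suc l) n) ≡ recip c * (ℕ→ℚ 2 * (k * r (suc l) n - k * r l n))
    cross n = begin
      z                      ≡⟨ *-identityˡ z ⟨
      1ℚ * z                 ≡⟨ cong (_* z) (recip-inverseˡ (0<⇒≢0 0<4k+1)) ⟨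
      recip c * c * z        ≡⟨ *-assoc (recip c) c z ⟩
      recip c * (c * z)      ≡⟨ cong (recip c *_) (resolvent-suc l n) ⟩
      recip c * (ℕ→ℚ 2 * (k * r (suc l) n - k * r l n)) ∎
      where z = k * (r l n * r (suc l) n)
    expand : ∀ n → product n ≡ rest n + - (K * K * (ℕ→ℚ 4 * k + ℕ→ℚ 3)) * (r (suc l) n * r (suc l) n)
    expand n = begin
      product n
        ≡⟨ solve 5 (λ k K c x y →
             (k :* k :* x :- K :* y) :* (con (ℕ→ℚ 2) :* c :+ k :* k :* (con (ℕ→ℚ 4) :* k :- con 1ℚ) :* x :+ K :* (con (ℕ→ℚ 4) :* k :+ con (ℕ→ℚ 3)) :* y)
             := con (ℕ→ℚ 2) :* c :* k :* (k :* x) :- con (ℕ→ℚ 2) :* c :* K :* y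
                :+ k :* k :* k :* (con (ℕ→ℚ 4) :* k :- con 1ℚ) :* (k :* (x :* x))
                :+ con (ℕ→ℚ 4) :* k :* K :* (k :* (x :* y))
                :+ (:- (K :* K :* (con (ℕ→ℚ 4) :* k :+ con (ℕ→ℚ 3)))) :* (y :* y)) refl k K c x y ⟩
      ℕ→ℚ 2 * c * k * (k * x) - ℕ→ℚ 2 * c * K * y + C₃ * (k * (x * x)) + ℕ→ℚ 4 * k * K * (k * (x * y)) + last
        ≡⟨ cong (λ z → ℕ→ℚ 2 * c * k * (k * x) - ℕ→ℚ 2 * c * K * y + C₃ * (k * (x * x)) + ℕ→ℚ 4 * k * K * z + last) (cross n) ⟩
      ℕ→ℚ 2 * c * k * (k * x) - ℕ→ℚ 2 * c * K * y + C₃ * (k * (x * x)) + ℕ→ℚ 4 * k * K * (recip c * (ℕ→ℚ 2 * (k * y - k * x))) + last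
        ≡⟨ solve 8 (λ k K c i C x y L → con (ℕ→ℚ 2) :* c :* k :* (k :* x) :- con (ℕ→ℚ 2) :* c :* K :* y :+ C :* (k :* (x :* x))
               :+ con (ℕ→ℚ 4) :* k :* K :* (i :* (con (ℕ→ℚ 2) :* (k :* y :- k :* x))) :+ L
             := (con (ℕ→ℚ 2) :* c :* k :- con (ℕ→ℚ 8) :* k :* K :* i) :* (k :* x)
                :+ (con (ℕ→ℚ 8) :* (k :* k) :* K :* i :- con (ℕ→ℚ 2) :* c :* K) :* y
                :+ C :* (k :* (x :* x)) :+ L) refl k K c (recip c) C₃ x y last ⟩
      rest n + last ∎
      where
      x = r l n
      y = r (suc l) n
      last = - (K * K * (ℕ→ℚ 4 * k + ℕ→ℚ 3)) * (y * y)

-- The sums of 1, r k and (r k)².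

sumsTo-zero : ∀ (ω c : ℕ → ℚ) → SumsTo ω c (λ _ → 0ℚ)
sumsTo-zero ω c = 0ℚ , null-≗ (λ N → trans (cong (_- 0ℚ * c N) (trans (partialSum-cong (λ n → *-comm (ω n) 0ℚ) N) (partialSum-* 0ℚ ω N)))
  (solve 2 (λ S c → con 0ℚ :* S :- con 0ℚ :* c := con 0ℚ) refl (partialSum ω N) (c N))) null-zero

sum₃-1 : Sum₃ (λ _ → 1ℚ)
sum₃-1 = ℕ→ℚ 2 , null-≗ (λ N → trans (cong (_- ℕ→ℚ 2 * seq 1/π N) (partialSum-cong term N))
    (solve 3 (λ s p i → s :- i := (s :- p) :+ (p :- i)) refl (S ½ N) (P ½ N) (ℕ→ℚ 2 * seq 1/π N)))
  (null-+ bauer-P½ P½-2/π)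
  where
  term : ∀ n → ω₃ n * 1ℚ ≡ signed (magnitude ½) n
  term n = trans (solve 3 (λ s n y → s :* (con (ℕ→ℚ 4) :* n :+ con 1ℚ) :* y :* con 1ℚ := s :* ((con ½ :+ con (ℕ→ℚ 2) :* n) :* (con (ℕ→ℚ 2) :* y))) refl
      ((- 1ℚ) ^ℚ n) (ℕ→ℚ n) (b n ^ℚ 3))
    (cong (λ y → (- 1ℚ) ^ℚ n * ((½ + ℕ→ℚ 2 * ℕ→ℚ n) * y)) (sym (w½ n)))

-- In `multiple` the factor i turns the degenerate r 0 into the zero function, which starts the
-- recursion.
sum₃-r : ∀ i → Sum₃ (r (suc i))
sum₃-r i = sum₃-r-suc i sum₃-1 (multiple i)
  where
  multiple : ∀ i → Sum₃ (λ n → ℕ→ℚ i * r i n)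
  multiple zero    = V₃.resp-≗ (λ n → sym (*-zeroˡ (r 0 n))) (sumsTo-zero ω₃ (seq 1/π))
  multiple (suc i) = V₃.scale (ℕ→ℚ (suc i)) (sum₃-r i)

sum₄-k*r : ∀ i → Sum₄ (λ n → ℕ→ℚ i * r i n)
sum₄-r : ∀ i → Sum₄ (r (suc i))
sum₄-k*r zero    = V₄.resp-≗ (λ n → sym (*-zeroˡ (r 0 n))) (sumsTo-zero ω₄ (seq 1/π²))
sum₄-k*r (suc i) = V₄.scale (ℕ→ℚ (suc i)) (sum₄-r i)
sum₄-r i = sum₄-r-suc i (sum₄-k*r i)

sum₄-r² : ∀ i → Sum₄ (λ n → r (suc i) n * r (suc i) n)
sum₄-r² i = sum₄-r²-suc i (sum₄-k*r i) (sum₄-r i) (multiple i)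
  where
  multiple : ∀ i → Sum₄ (λ n → ℕ→ℚ i * (r i n * r i n))
  multiple zero    = V₄.resp-≗ (λ n → sym (*-zeroˡ (r 0 n * r 0 n))) (sumsTo-zero ω₄ (seq 1/π²))
  multiple (suc i) = V₄.scale (ℕ→ℚ (suc i)) (sum₄-r² i)

ℤ→ℚ-neg : ∀ i → ℤ→ℚ (ℤ.- i) ≡ - ℤ→ℚ i
ℤ→ℚ-neg i = begin
  ℤ→ℚ (ℤ.- i)               ≡⟨ cong ℤ→ℚ (ℤₚ.-1*i≡-i i) ⟨
  ℤ→ℚ (-[1+ 0 ] ℤ.* i)      ≡⟨ ℤ→ℚ-* -[1+ 0 ] i ⟩
  - 1ℚ * ℤ→ℚ i              ≡⟨ solve 1 (λ x → con (- 1ℚ) :* x := :- x) refl (ℤ→ℚ i) ⟩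
  - ℤ→ℚ i                   ∎
  where open ≡-Reasoning

ℤ→ℚ-≡0 : ∀ {i} → ℤ→ℚ i ≡ 0ℚ → i ≡ + 0
ℤ→ℚ-≡0 {i} eq with i ℤₚ.≟ + 0
... | yes i≡0 = i≡0
... | no  i≢0 = ⊥-elim (ℤ→ℚ-≢0 i≢0 eq)

ℕ→ℚ-difference : ∀ {i j} → ℕ→ℚ i - ℕ→ℚ j ≡ 0ℚ → i ≡ j
ℕ→ℚ-difference {i} {j} eq = ℤₚ.+-injective (ℤₚ.i-j≡0⇒i≡j (+ i) (+ j) (ℤ→ℚ-≡0
  (trans (ℤ→ℚ-+ (+ i) (ℤ.- (+ j))) (trans (cong (λ y → ℕ→ℚ i + y) (ℤ→ℚ-neg (+ j))) eq))))

-- Partial fractions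

∏ : (ℕ → ℚ) → List ℕ → ℚ
∏ f []      = 1ℚ
∏ f (k ∷ K) = f k * ∏ f K

∏-↭ : ∀ f {K L} → K ↭ L → ∏ f K ≡ ∏ f L
∏-↭ f ↭.refl         = refl
∏-↭ f (↭.prep k p)   = cong (f k *_) (∏-↭ f p)
∏-↭ f (↭.swap {K} {L} i j p) = trans (cong (λ y → f i * (f j * y)) (∏-↭ f p))
  (solve 3 (λ i j y → i :* (j :* y) := j :* (i :* y)) refl (f i) (f j) (∏ f L))
∏-↭ f (↭.trans p p′) = trans (∏-↭ f p) (∏-↭ f p′)

∏-≢0 : ∀ f → (∀ k → f k ≢ 0ℚ) → ∀ K → ∏ f K ≢ 0ℚ
∏-≢0 f f≢0 []      = 1≢0
∏-≢0 f f≢0 (k ∷ K) = x*y≢0 (f≢0 k) (∏-≢0 f f≢0 K)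

∏-∈ : ∀ f {k K} → k ∈ K → f k ≡ 0ℚ → ∏ f K ≡ 0ℚ
∏-∈ f {K = _ ∷ K} (here refl) fk≡0 = trans (cong (_* ∏ f K) fk≡0) (*-zeroˡ (∏ f K))
∏-∈ f {K = j ∷ _} (there k∈)  fk≡0 = trans (cong (f j *_) (∏-∈ f k∈ fk≡0)) (*-zeroʳ (f j))

-- Reads a root back off a vanishing product of linear factors.
∏-≡0 : ∀ f {k} → (∀ j → f j ≡ 0ℚ → j ≡ k) → ∀ K → ∏ f K ≡ 0ℚ → k ∈ K
∏-≡0 f f≡0 []      1≡0 = ⊥-elim (1≢0 1≡0)
∏-≡0 f f≡0 (j ∷ K) eq with f j ≟ 0ℚ
... | yes fj≡0 = here (sym (f≡0 j fj≡0))
... | no  fj≢0 with ∏ f K ≟ 0ℚ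
...   | yes ∏≡0 = there (∏-≡0 f f≡0 K ∏≡0)
...   | no  ∏≢0 = ⊥-elim (x*y≢0 fj≢0 ∏≢0 eq)

-- Partial fractions by induction: `resolvent` replaces r i · r j by a multiple of r i - r j,
-- leaving two products with one factor fewer, each still over distinct indices.
product-in : ∀ V → Subspace V → (∀ i → V (r (suc i))) →
  ∀ i K → Unique (i ∷ K) → V (λ n → ∏ (λ j → r (suc j) n) (i ∷ K))
product-in V sub Vr i []      _ = Subspace.resp-≗ sub (λ n → sym (*-identityʳ (r (suc i) n))) (Vr i)
product-in V sub Vr i (j ∷ K) ((i≢j ∷ i∉K) ∷ j∉K ∷ K!) = resp-≗ split
  (scale (recip c) (add (product-in V sub Vr i K (i∉K ∷ K!)) (scale (- 1ℚ) (product-in V sub Vr j K (j∉K ∷ K!)))))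
  where
  open Subspace sub
  open ≡-Reasoning
  k = ℕ→ℚ (suc i)
  l = ℕ→ℚ (suc j)
  c = (k - l) * (k + l - ½)
  c≢0 : c ≢ 0ℚ
  c≢0 = x*y≢0 (λ eq → i≢j (ℕₚ.suc-injective (ℕ→ℚ-difference eq))) (0<⇒≢0 0<k+l-½)
    where
    0<k+l-½ : 0ℚ < k + l - ½
    0<k+l-½ = subst (0ℚ <_) (trans (solve 2 (λ i j → i :+ j :+ con (1ℚ + ½) := (i :+ con 1ℚ) :+ (j :+ con 1ℚ) :- con ½) refl (ℕ→ℚ i) (ℕ→ℚ j))
        (cong₂ (λ y z → y + z - ½) (sym (ℕ→ℚ-suc i)) (sym (ℕ→ℚ-suc j))))
      (+-mono-≤-< {0ℚ} {_} {0ℚ} (0≤+ (0≤ℕ→ℚ i) (0≤ℕ→ℚ j)) (positive⁻¹ (1ℚ + ½)))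
  split : ∀ n → let Π = ∏ (λ j → r (suc j) n) in recip c * (Π (i ∷ K) + - 1ℚ * Π (j ∷ K)) ≡ Π (i ∷ j ∷ K)
  split n = begin
    recip c * (x * z + - 1ℚ * (y * z))   ≡⟨ solve 4 (λ i x y z → i :* (x :* z :+ con (- 1ℚ) :* (y :* z)) := i :* (x :- y) :* z) refl (recip c) x y z ⟩
    recip c * (x - y) * z                ≡⟨ cong (λ u → recip c * u * z) (resolvent i j n) ⟨
    recip c * (c * (x * y)) * z          ≡⟨ solve 5 (λ i c x y z → i :* (c :* (x :* y)) :* z := i :* c :* (x :* (y :* z))) refl (recip c) c x y z ⟩
    recip c * c * (x * (y * z))          ≡⟨ cong (_* (x * (y * z))) (recip-inverseˡ c≢0) ⟩
    1ℚ * (x * (y * z))                   ≡⟨ *-identityˡ (x * (y * z)) ⟩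
    x * (y * z)                          ∎
    where
    x = r (suc i) n
    y = r (suc j) n
    z = ∏ (λ j → r (suc j) n) K

-- Holds one factor of a product fixed while the other is expanded in partial fractions.
multiplier-subspace : ∀ V → Subspace V → (g : ℕ → ℚ) → Subspace (λ f → V (λ n → g n * f n))
multiplier-subspace V sub g = record
  { resp-≗ = λ {f} {h} f≗h → resp-≗ (λ n → cong (g n *_) (f≗h n))
  ; add    = λ {f} {h} Vf Vh → resp-≗ (λ n → sym (*-distribˡ-+ (g n) (f n) (h n))) (add Vf Vh)
  ; scale  = λ c {f} Vf → resp-≗ (λ n → solve 3 (λ c g f → c :* (g :* f) := g :* (c :* f)) refl c (g n) (f n)) (scale c Vf)
  }
  where open Subspace sub

∏r : List ℕ → ℕ → ℚ
∏r K n = ∏ (λ j → r (suc j) n) K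

sum₃-∏ : ∀ K → Unique K → Sum₃ (∏r K)
sum₃-∏ []      _  = sum₃-1
sum₃-∏ (i ∷ K) K! = product-in Sum₃ (sumsTo-subspace ω₃ (seq 1/π)) sum₃-r i K K!

sum₄-∏ : ∀ i K → Unique (i ∷ K) → Sum₄ (∏r (i ∷ K))
sum₄-∏ = product-in Sum₄ (sumsTo-subspace ω₄ (seq 1/π²)) sum₄-r

sum₄-r*r : ∀ i j → Sum₄ (λ n → r (suc i) n * r (suc j) n)
sum₄-r*r i j = go (i ℕₚ.≟ j)
  where
  go : Dec (i ≡ j) → Sum₄ (λ n → r (suc i) n * r (suc j) n)
  go (yes refl) = sum₄-r² i
  go (no  i≢j)  = V₄.resp-≗ (λ n → cong (r (suc i) n *_) (*-identityʳ (r (suc j) n)))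
    (sum₄-∏ i (j ∷ []) ((i≢j ∷ []) ∷ [] ∷ []))

-- Two expansions, one for each copy of the product: the outer reduces one copy to a single r j, the
-- inner then reduces the other copy with r j held fixed. Only the r i · r j remain.
sum₄-∏² : ∀ i K → Unique (i ∷ K) → Sum₄ (λ n → ∏r (i ∷ K) n * ∏r (i ∷ K) n)
sum₄-∏² i K K! = product-in (λ f → Sum₄ (λ n → Π n * f n)) (multiplier-subspace Sum₄ V₄-sub Π)
  (λ j → V₄.resp-≗ (λ n → *-comm (r (suc j) n) (Π n))
    (product-in (λ f → Sum₄ (λ n → r (suc j) n * f n)) (multiplier-subspace Sum₄ V₄-sub (r (suc j))) (sum₄-r*r j) i K K!))
  i K K!
  where
  V₄-sub = sumsTo-subspace ω₄ (seq 1/π²)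
  Π = ∏r (i ∷ K)

-- Roots and coefficients of p

evalℤ : List ℤ → ℤ → ℤ
evalℤ p z = foldr (λ a v → a ℤ.+ z ℤ.* v) (+ 0) p

eval-ℤ→ℚ : ∀ p z → eval p (ℤ→ℚ z) ≡ ℤ→ℚ (evalℤ p z)
eval-ℤ→ℚ []      z = refl
eval-ℤ→ℚ (a ∷ p) z = sym (trans (ℤ→ℚ-+ a (z ℤ.* evalℤ p z))
  (cong (λ y → ℤ→ℚ a + y) (trans (ℤ→ℚ-* z (evalℤ p z)) (cong (ℤ→ℚ z *_) (sym (eval-ℤ→ℚ p z))))))

x*y≡0⇒y≡0 : ∀ {x y} → x ≢ 0ℚ → x * y ≡ 0ℚ → y ≡ 0ℚ
x*y≡0⇒y≡0 {x} {y} x≢0 eq with y ≟ 0ℚ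
... | yes y≡0 = y≡0
... | no  y≢0 = ⊥-elim (x*y≢0 x≢0 y≢0 eq)

-- The constant coefficient a is divisible by every nonzero integer, in particular by ∣ a ∣ + 1.
vanishing : ∀ p → (∀ x → x ≢ 0ℚ → eval p x ≡ 0ℚ) → ∀ i → coefficient p i ≡ + 0
vanishing []      p≡0 i = refl
vanishing (a ∷ p) p≡0 = coefficients
  where
  N = suc ℤ.∣ a ∣
  sum≡0 : a ℤ.+ + N ℤ.* evalℤ p (+ N) ≡ + 0
  sum≡0 = ℤ→ℚ-≡0 (trans (sym (eval-ℤ→ℚ (a ∷ p) (+ N))) (p≡0 (ℕ→ℚ N) (ℤ→ℚ-≢0 {+ N} λ ())))
  a≡ : a ≡ ℤ.- (+ N ℤ.* evalℤ p (+ N))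
  a≡ = ℤₚ.i-j≡0⇒i≡j a (ℤ.- (+ N ℤ.* evalℤ p (+ N)))
    (trans (cong (λ y → a ℤ.+ y) (ℤₚ.neg-involutive (+ N ℤ.* evalℤ p (+ N)))) sum≡0)
  N∣a : N ∣ ℤ.∣ a ∣
  N∣a = divides ℤ.∣ evalℤ p (+ N) ∣ (trans (cong ℤ.∣_∣ a≡) (trans (ℤₚ.∣-i∣≡∣i∣ (+ N ℤ.* evalℤ p (+ N)))
    (trans (ℤₚ.∣i*j∣≡∣i∣*∣j∣ (+ N) (evalℤ p (+ N))) (ℕₚ.*-comm N ℤ.∣ evalℤ p (+ N) ∣))))
  a≡0 : a ≡ + 0
  a≡0 with ℤ.∣ a ∣ in eq
  ... | zero  = ℤₚ.∣i∣≡0⇒i≡0 eq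
  ... | suc m = ⊥-elim (ℕₚ.<-irrefl refl (subst (λ z → suc z ℕ.≤ z) eq (∣⇒≤ {{subst ℕ.NonZero (sym eq) _}} N∣a)))
  coefficients : ∀ i → coefficient (a ∷ p) i ≡ + 0
  coefficients zero    = a≡0
  coefficients (suc i) = vanishing p (λ x x≢0 → x*y≡0⇒y≡0 x≢0
    (trans (sym (trans (cong (λ z → ℤ→ℚ z + x * eval p x) a≡0) (+-identityˡ (x * eval p x)))) (p≡0 x x≢0))) i

-- The constant coefficient is p(0) = c, so x times the rest of the polynomial vanishes for all x.
constant : ∀ p c → (∀ x → eval p x ≡ c) → ∀ i → coefficient p (suc i) ≡ + 0
constant []      c p≡c i = refl
constant (a ∷ p) c p≡c i = vanishing p (λ x x≢0 → x*y≡0⇒y≡0 x≢0 (begin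
  x * eval p x                         ≡⟨ solve 2 (λ a y → y := (a :+ y) :- a) refl (ℤ→ℚ a) (x * eval p x) ⟩
  (ℤ→ℚ a + x * eval p x) - ℤ→ℚ a       ≡⟨ cong₂ _-_ (p≡c x) a≡c ⟩
  c - c                                ≡⟨ +-inverseʳ c ⟩
  0ℚ                                   ∎)) i
  where
  open ≡-Reasoning
  a≡c : ℤ→ℚ a ≡ c
  a≡c = trans (trans (sym (+-identityʳ (ℤ→ℚ a))) (cong (λ y → ℤ→ℚ a + y) (sym (*-zeroˡ (eval p 0ℚ))))) (p≡c 0ℚ)

-- An index k stands for the root -(k + 1) in the first list and k + ½ in the second. The reflection
-- x ↔ -½ - x exchanges these two, so the symmetry of p makes the lists agree up to order.
negatives halves : ∀ {rs} → All Admissible rs → List ℕ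
negatives []                          = []
negatives (negativeInteger k ∷ as)     = k ∷ negatives as
negatives (positiveHalfInteger k ∷ as) = negatives as
halves []                          = []
halves (negativeInteger k ∷ as)     = halves as
halves (positiveHalfInteger k ∷ as) = k ∷ halves as

negatives-unique : ∀ {rs} (as : All Admissible rs) → Unique rs → Unique (negatives as)
negatives-unique []                          []         = []
negatives-unique (positiveHalfInteger k ∷ as) (_ ∷ rs!) = negatives-unique as rs!
negatives-unique (negativeInteger k ∷ as)     (k∉ ∷ rs!) = fresh as k∉ ∷ negatives-unique as rs!
  where
  fresh : ∀ {rs} (as : All Admissible rs) → All (-[1+ k ] / 1 ≢_) rs → All (k ≢_) (negatives as)
  fresh []                          []         = []
  fresh (positiveHalfInteger j ∷ as) (_ ∷ ≢rs)  = fresh as ≢rs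
  fresh (negativeInteger j ∷ as)     (≢j ∷ ≢rs) = (λ { refl → ≢j refl }) ∷ fresh as ≢rs

halves-unique : ∀ {rs} (as : All Admissible rs) → Unique rs → Unique (halves as)
halves-unique []                          []         = []
halves-unique (negativeInteger k ∷ as)     (_ ∷ rs!)  = halves-unique as rs!
halves-unique (positiveHalfInteger k ∷ as) (k∉ ∷ rs!) = fresh as k∉ ∷ halves-unique as rs!
  where
  fresh : ∀ {rs} (as : All Admissible rs) → All (+ suc (2 ℕ.* k) / 2 ≢_) rs → All (k ≢_) (halves as)
  fresh []                          []         = []
  fresh (negativeInteger j ∷ as)     (_ ∷ ≢rs)  = fresh as ≢rs
  fresh (positiveHalfInteger j ∷ as) (≢j ∷ ≢rs) = (λ { refl → ≢j refl }) ∷ fresh as ≢rs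

x+[k+1] x-[k+½] : ℚ → ℕ → ℚ
x+[k+1] x k = x + (ℕ→ℚ k + 1ℚ)
x-[k+½] x k = x - (ℕ→ℚ k + ½)

negativeInteger-value : ∀ k → -[1+ k ] / 1 ≡ - (ℕ→ℚ k + 1ℚ)
negativeInteger-value k = trans (ℤ→ℚ-neg (+ suc k)) (cong -_ (ℕ→ℚ-suc k))

∏-split : ∀ x {rs} (as : All Admissible rs) →
  foldr _*_ 1ℚ (map (λ ρ → x - ρ) rs) ≡ ∏ (x+[k+1] x) (negatives as) * ∏ (x-[k+½] x) (halves as)
∏-split x []                          = refl
∏-split x (negativeInteger k ∷ as)     = trans
  (cong₂ _*_ (trans (cong (λ y → x - y) (negativeInteger-value k)) (solve 2 (λ x k → x :- (:- k) := x :+ k) refl x (ℕ→ℚ k + 1ℚ))) (∏-split x as))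
  (sym (*-assoc (x+[k+1] x k) (∏ (x+[k+1] x) (negatives as)) (∏ (x-[k+½] x) (halves as))))
∏-split x (positiveHalfInteger k ∷ as) = trans
  (cong₂ _*_ (cong (λ y → x - y) (halfInteger k)) (∏-split x as))
  (solve 3 (λ h A B → h :* (A :* B) := A :* (h :* B)) refl (x-[k+½] x k) (∏ (x+[k+1] x) (negatives as)) (∏ (x-[k+½] x) (halves as)))

module _ {p d} (deg : HasDegree p d) (hr : HasSimpleRootsIn Admissible p d)
         (symmetric : ∀ x → eval p x ≡ eval p (-½ - x)) where

  open HasSimpleRootsIn hr
  open ≡-Reasoning

  private
    lc = ℤ→ℚ (coefficient p d)
    lc≢0 : lc ≢ 0ℚ
    lc≢0 = ℤ→ℚ-≢0 (proj₁ deg)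
    A B : ℚ → ℚ
    A x = ∏ (x+[k+1] x) (negatives roots-in)
    B x = ∏ (x-[k+½] x) (halves roots-in)

    factored : ∀ x → eval p x ≡ lc * (A x * B x)
    factored x = trans (factorisation x) (cong (lc *_) (∏-split x roots-in))

    reflect : ∀ x y → -½ - x ≡ y → A x * B x ≡ 0ℚ → A y * B y ≡ 0ℚ
    reflect x y refl AB≡0 = x*y≡0⇒y≡0 lc≢0 (trans (sym (factored (-½ - x))) (trans (sym (symmetric x))
      (trans (factored x) (trans (cong (lc *_) AB≡0) (*-zeroʳ lc)))))

    -- The reflected root k + ½ is positive, so no factor x + (j + 1) vanishes there, and x - (j +
    -- ½) vanishes there only for j = k.
    negatives⊆halves : ∀ {k} → k ∈ negatives roots-in → k ∈ halves roots-in
    negatives⊆halves {k} k∈ = ∏-≡0 (x-[k+½] (κ + ½))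
      (λ j eq → sym (ℕ→ℚ-difference (trans (solve 2 (λ k j → k :- j := k :+ con ½ :- (j :+ con ½)) refl κ (ℕ→ℚ j)) eq)))
      (halves roots-in)
      (x*y≡0⇒y≡0
        (∏-≢0 (x+[k+1] (κ + ½)) (λ j → 0<⇒≢0 (0<+≤ (0<k+½ k) (<⇒≤ (0<n+1 j)))) (negatives roots-in))
        (reflect (- (κ + 1ℚ)) (κ + ½) (solve 1 (λ k → con -½ :- (:- (k :+ con 1ℚ)) := k :+ con ½) refl κ)
          (trans (cong (_* B (- (κ + 1ℚ))) (∏-∈ (x+[k+1] (- (κ + 1ℚ))) k∈ (+-inverseˡ (κ + 1ℚ)))) (*-zeroˡ (B (- (κ + 1ℚ)))))))
      where κ = ℕ→ℚ k

    halves⊆negatives : ∀ {k} → k ∈ halves roots-in → k ∈ negatives roots-in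
    halves⊆negatives {k} k∈ = ∏-≡0 (x+[k+1] (- (κ + 1ℚ)))
      (λ j eq → ℕ→ℚ-difference (trans (solve 2 (λ k j → j :- k := (:- (k :+ con 1ℚ)) :+ (j :+ con 1ℚ)) refl κ (ℕ→ℚ j)) eq))
      (negatives roots-in)
      (x*y≡0⇒y≡0
        (∏-≢0 (x-[k+½] (- (κ + 1ℚ))) (λ j eq → 0<⇒≢0 (0<+≤ (0<n+1 k) (<⇒≤ (0<k+½ j)))
          (neg-injective (trans (solve 2 (λ k j → :- ((k :+ con 1ℚ) :+ (j :+ con ½)) := (:- (k :+ con 1ℚ)) :- (j :+ con ½)) refl κ (ℕ→ℚ j)) eq))) (halves roots-in))
        (trans (*-comm (B (- (κ + 1ℚ))) (A (- (κ + 1ℚ))))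
          (reflect (κ + ½) (- (κ + 1ℚ)) (solve 1 (λ k → con -½ :- (k :+ con ½) := :- (k :+ con 1ℚ)) refl κ)
            (trans (cong (A (κ + ½) *_) (∏-∈ (x-[k+½] (κ + ½)) k∈ (+-inverseʳ (κ + ½)))) (*-zeroʳ (A (κ + ½)))))))
      where κ = ℕ→ℚ k

    halves↭negatives : halves roots-in ↭ negatives roots-in
    halves↭negatives = ∼bag⇒↭ (unique∧set⇒bag (halves-unique roots-in roots-unique) (negatives-unique roots-in roots-unique)
      (mk⇔ halves⊆negatives negatives⊆halves))

    ∏-inverse : ∀ n K → ∏ (x+[k+1] (ℕ→ℚ n)) K * ∏ (x-[k+½] (ℕ→ℚ n)) K * ∏r K n ≡ 1ℚ
    ∏-inverse n []      = refl
    ∏-inverse n (k ∷ K) = begin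
      u * U * (v * V) * (R * Π)    ≡⟨ solve 6 (λ u U v V R Π → u :* U :* (v :* V) :* (R :* Π) := (u :* v :* R) :* (U :* V :* Π)) refl u U v V R Π ⟩
      (u * v * R) * (U * V * Π)    ≡⟨ cong₂ _*_ factor (∏-inverse n K) ⟩
      1ℚ * 1ℚ                      ≡⟨⟩
      1ℚ                           ∎
      where
      u = x+[k+1] (ℕ→ℚ n) k
      v = x-[k+½] (ℕ→ℚ n) k
      U = ∏ (x+[k+1] (ℕ→ℚ n)) K
      V = ∏ (x-[k+½] (ℕ→ℚ n)) K
      R = r (suc k) n
      Π = ∏r K n
      factor : u * v * R ≡ 1ℚ
      -- The factors of a pair of reflected roots multiply to the denominator of r (k + 1).
      factor = trans (cong₂ (λ y z → y * z * R) (cong (λ y → ℕ→ℚ n + y) (sym (ℕ→ℚ-suc k)))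
          (trans (solve 2 (λ n k → n :- (k :+ con ½) := n :- (k :+ con 1ℚ) :+ con ½) refl (ℕ→ℚ n) (ℕ→ℚ k)) (cong (λ y → ℕ→ℚ n - y + ½) (sym (ℕ→ℚ-suc k)))))
        (r-inverse k n)

  rootIndices : List ℕ
  rootIndices = negatives roots-in

  rootIndices-unique : Unique rootIndices
  rootIndices-unique = negatives-unique roots-in roots-unique

  1/eval≡ : ∀ n → 1/eval deg hr n ≡ recip lc * ∏r rootIndices n
  1/eval≡ n = *-cancelʳ-≢0 e e≢0 (begin
    1/eval deg hr n * e                 ≡⟨ *-inverseˡ e {{eval≢0 deg hr n}} ⟩
    1ℚ                                  ≡⟨ recip-inverseˡ lc≢0 ⟨
    recip lc * lc                       ≡⟨ *-identityʳ (recip lc * lc) ⟨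
    recip lc * lc * 1ℚ                  ≡⟨ cong (recip lc * lc *_) (∏-inverse n rootIndices) ⟨
    recip lc * lc * (A ν * B′ * Π)      ≡⟨ cong (λ y → recip lc * lc * (A ν * y * Π)) (∏-↭ (x-[k+½] ν) halves↭negatives) ⟨
    recip lc * lc * (A ν * B ν * Π)     ≡⟨ solve 5 (λ i l A B P → i :* l :* (A :* B :* P) := i :* P :* (l :* (A :* B))) refl (recip lc) lc (A ν) (B ν) Π ⟩
    recip lc * Π * (lc * (A ν * B ν))   ≡⟨ cong (recip lc * Π *_) (factored ν) ⟨
    recip lc * Π * e                    ∎)
    where
    ν = ℕ→ℚ n
    e = eval p ν
    e≢0 : e ≢ 0ℚ
    e≢0 eq = 1≢0 (trans (sym (*-inverseˡ e {{eval≢0 deg hr n}}))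
      (trans (cong (1/eval deg hr n *_) eq) (*-zeroʳ (1/eval deg hr n))))
    B′ = ∏ (x-[k+½] ν) rootIndices
    Π = ∏r rootIndices n

  -- Without roots the factorisation makes p constant, against its nonzero coefficient in degree d.
  rootIndices-nonempty : 0 ℕ.< d → rootIndices ≢ []
  rootIndices-nonempty (s≤s {n = d′} z≤n) empty = proj₁ deg (constant p lc (λ x → begin
    eval p x          ≡⟨ factored x ⟩
    lc * (A x * B x)  ≡⟨ cong (λ y → lc * (A x * y)) (∏-↭ (x-[k+½] x) halves↭negatives) ⟩
    lc * (A x * ∏ (x-[k+½] x) rootIndices)  ≡⟨ cong (λ K → lc * (∏ (x+[k+1] x) K * ∏ (x-[k+½] x) K)) empty ⟩
    lc * (1ℚ * 1ℚ)    ≡⟨ *-identityʳ lc ⟩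
    lc                ∎) d′)

-- From the comparison of partial sums to the theorem.

SumsTo⇒SumIsRationalMultipleOf : ∀ ω (c : ℝ) (h f : ℕ → ℚ) → (∀ n → ω n * h n ≡ f n) →
  SumsTo ω (seq c) h → SumIsRationalMultipleOf f c
SumsTo⇒SumIsRationalMultipleOf ω c h f eq (t , s0) =
    null-cauchy {partialSum f} {λ n → t * seq c n} s0′ (*-cauchy (λ _ → t) (seq c) (cauchy (fromℚ t)) (cauchy c))
  , t , s0′
  where
  -- This one comparison yields both the convergence of the series and its value.
  s0′ : Null (λ n → partialSum f n - t * seq c n)
  s0′ = null-≗ (λ N → cong (_- t * seq c N) (sym (partialSum-cong eq N))) s0

ℕ→ℚ-4n+1 : ∀ n → 4n+1 n ≡ ℕ→ℚ (4 ℕ.* n ℕ.+ 1)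
ℕ→ℚ-4n+1 n = sym (trans (ℕ→ℚ-+ (4 ℕ.* n) 1) (cong (_+ 1ℚ) (ℕ→ℚ-* 4 n)))

rearrange : ∀ N y e → N * y * e ≡ N * e * y
rearrange = solve 3 (λ N y e → N :* y :* e := N :* e :* y) refl

module _ (i : ℚ) (e : ℕ → ℚ) where

  cubic : ∀ K → Unique K → (∀ n → i * ∏r K n ≡ e n) →
    SumIsRationalMultipleOf (λ n → (- 1ℚ) ^ℚ n * (ℕ→ℚ (4 ℕ.* n ℕ.+ 1) * e n) * b n ^ℚ 3) 1/π
  cubic K K! e≡ = SumsTo⇒SumIsRationalMultipleOf ω₃ 1/π e _
    (λ n → trans (cong (λ N → (- 1ℚ) ^ℚ n * N * b n ^ℚ 3 * e n) (ℕ→ℚ-4n+1 n))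
      (solve 4 (λ s N y e → s :* N :* y :* e := s :* (N :* e) :* y) refl ((- 1ℚ) ^ℚ n) (ℕ→ℚ (4 ℕ.* n ℕ.+ 1)) (b n ^ℚ 3) (e n)))
    (V₃.resp-≗ e≡ (V₃.scale i (sum₃-∏ K K!)))

  -- The nonempty list `k ∷ K` provides a factor r, without which the series would diverge.
  quartic-square : ∀ k K → Unique (k ∷ K) → (∀ n → i * ∏r (k ∷ K) n ≡ e n) →
    SumIsRationalMultipleOf (λ n → (ℕ→ℚ (4 ℕ.* n ℕ.+ 1) * e n ^ℚ 2) * b n ^ℚ 4) 1/π²
  quartic-square k K K! e≡ = SumsTo⇒SumIsRationalMultipleOf ω₄ 1/π² (λ n → e n ^ℚ 2) _
    (λ n → trans (cong (λ N → N * b n ^ℚ 4 * e n ^ℚ 2) (ℕ→ℚ-4n+1 n)) (rearrange (ℕ→ℚ (4 ℕ.* n ℕ.+ 1)) (b n ^ℚ 4) (e n ^ℚ 2)))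
    (V₄.resp-≗ (λ n → trans (solve 2 (λ i P → i :* i :* (P :* P) := (i :* P) :* ((i :* P) :* con 1ℚ)) refl i (∏r (k ∷ K) n))
        (cong (_^ℚ 2) (e≡ n)))
      (V₄.scale (i * i) (sum₄-∏² k K K!)))

  quartic : ∀ k K → Unique (k ∷ K) → (∀ n → i * ∏r (k ∷ K) n ≡ e n) →
    SumIsRationalMultipleOf (λ n → (ℕ→ℚ (4 ℕ.* n ℕ.+ 1) * e n) * b n ^ℚ 4) 1/π²
  quartic k K K! e≡ = SumsTo⇒SumIsRationalMultipleOf ω₄ 1/π² e _
    (λ n → trans (cong (λ N → N * b n ^ℚ 4 * e n) (ℕ→ℚ-4n+1 n)) (rearrange (ℕ→ℚ (4 ℕ.* n ℕ.+ 1)) (b n ^ℚ 4) (e n)))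
    (V₄.resp-≗ e≡ (V₄.scale i (sum₄-∏ k K K!)))

corollary1 : (p : List ℤ) (d : ℕ) (deg : HasDegree p d) → 2 ∣ d →
    (roots : HasSimpleRootsIn Admissible p d) →
    (∀ x → eval p x ≡ eval p (-½ - x)) →
    SumIsRationalMultipleOf
    (λ n → (- 1ℚ) ^ℚ n * (ℕ→ℚ (4 ℕ.* n ℕ.+ 1) * 1/eval deg roots n) * centralBinomial/4^ n ^ℚ 3)
    1/π
    × (0 ℕ.< d →
    SumIsRationalMultipleOf
    (λ n → (ℕ→ℚ (4 ℕ.* n ℕ.+ 1) * 1/eval deg roots n ^ℚ 2) * centralBinomial/4^ n ^ℚ 4)
    1/π²
    × SumIsRationalMultipleOf
    (λ n → (ℕ→ℚ (4 ℕ.* n ℕ.+ 1) * 1/eval deg roots n) * centralBinomial/4^ n ^ℚ 4)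
    1/π²)
corollary1 p d deg _ roots symmetric =
    cubic i e K K! e≡
  , λ 0<d → nonempty K K! e≡ (rootIndices-nonempty deg roots symmetric 0<d)
  where
  K = rootIndices deg roots symmetric
  K! = rootIndices-unique deg roots symmetric
  i = recip (ℤ→ℚ (coefficient p d))
  e = 1/eval deg roots
  e≡ : ∀ n → i * ∏r K n ≡ e n
  e≡ n = sym (1/eval≡ deg roots symmetric n)
  -- Quantified over the list, so that it can be split into head and tail along with the facts about
  -- it.
  nonempty : ∀ K → Unique K → (∀ n → i * ∏r K n ≡ e n) → K ≢ [] →
      SumIsRationalMultipleOf (λ n → (ℕ→ℚ (4 ℕ.* n ℕ.+ 1) * e n ^ℚ 2) * b n ^ℚ 4) 1/π²
    × SumIsRationalMultipleOf (λ n → (ℕ→ℚ (4 ℕ.* n ℕ.+ 1) * e n) * b n ^ℚ 4) 1/π²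
  nonempty []      _  _  K≢[] = ⊥-elim (K≢[] refl)
  nonempty (k ∷ K) K! e≡ _    = quartic-square i e k K K! e≡ , quartic i e k K K! e≡
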